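{- There is an absolute constant $C$ such that the following holds. Let $G$ be a planar graph with a fixed embedding and $\mathcal P$ a finite family of pairwise uncrossed paths in $G$ such that every edge of $G$ lies in at most $k$ paths of $\mathcal P$. Let $U$ be the graph with vertex set $\mathcal P$ in which distinct $P,P'$ are adjacent if and only if they share an edge of $G$. Then $\chi(U)=O(k^2\log|E(U)|)$, i.e. $\chi(U)\le Ck^2\log|E(U)|$ whenever $|E(U)|\ge2$.
   Context: Two paths $P,Q$ cross if there is a maximal common subpath $Z$ (possibly a single node) containing none of their endpoints, with $P=P_1,e,Z,e',P_2$ and $Q=Q_1,g,Z,g',Q_2$, such that the edges appear clockwise around $Z$ in the embedding in the order $e,g,e',g'$ or $e,g',e',g$; otherwise they are uncrossed. $\chi$ denotes chromatic number. -}

module Defs where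

open import Data.Nat using (ℕ; zero; suc; _+_; _*_; _<_; _≤_; _<?_)
open import Data.Bool using (Bool; true; false; not; if_then_else_)
open import Data.Fin using (Fin; toℕ)
open import Data.Fin.Properties using () renaming (_≟_ to _≟ᶠ_)
open import Data.Product using (Σ; ∃; _×_; _,_; proj₁; proj₂)
open import Data.Sum using (_⊎_)
open import Data.List using (List; []; _∷_; _++_; map; reverse; length; filter; allFin; cartesianProduct)
open import Data.Bool.ListAction using (any)
open import Data.List.Relation.Unary.Unique.Propositional using (Unique)
open import Data.List.Relation.Unary.Any using (Any)
import Data.List.Relation.Unary.Any as Any
open import Data.List.Membership.Propositional using (_∈_)
open import Relation.Binary.PropositionalEquality using (_≡_; _≢_)
open import Relation.Nullary using (¬_; does)
open import Relation.Nullary.Decidable using (_×-dec_)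

iter : ∀ {A : Set} → (A → A) → ℕ → A → A
iter f zero    x = x
iter f (suc k) x = f (iter f k x)

SameOrbit : ∀ {A : Set} → (A → A) → A → A → Set
SameOrbit f x y = ∃ λ k → iter f k x ≡ y

NumClasses : ∀ {A : Set} → (A → A → Set) → ℕ → Set
NumClasses {A} R c =
  Σ (A → Fin c) λ cl →
    (∀ x y → cl x ≡ cl y → R x y) × (∀ x y → R x y → cl x ≡ cl y) × (∀ i → ∃ λ x → cl x ≡ i)

-- Darts of a graph with m edges: (edge, orientation)
Dart : ℕ → Set
Dart m = Fin m × Bool

rev : ∀ {m} → Dart m → Dart m
rev (e , b) = (e , not b)

data Conn {m : ℕ} (σ : Dart m → Dart m) : Dart m → Dart m → Set where
  here : ∀ {d} → Conn σ d d
  viaσ : ∀ {d d'} → Conn σ (σ d) d' → Conn σ d d'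
  viaα : ∀ {d d'} → Conn σ (rev d) d' → Conn σ d d'

-- A finite simple graph on vertices Fin n with edges Fin m, embedded in the
-- plane, given as a combinatorial map (rotation system) of genus 0.
-- tail d is the vertex a dart leaves; σ d is the next dart clockwise around tail d.
record PlaneGraph : Set where
  field
    n m   : ℕ
    tail  : Dart m → Fin n
    σ     : Dart m → Dart m
    σ-inj : ∀ d d' → σ d ≡ σ d' → d ≡ d'
    σ-tail : ∀ d → tail (σ d) ≡ tail d
    σ-trans : ∀ d d' → tail d ≡ tail d' → SameOrbit σ d d'
    noLoop : ∀ e → tail (e , false) ≢ tail (e , true)
    noMulti : ∀ d d' → tail d ≡ tail d' → tail (rev d) ≡ tail (rev d') → proj₁ d ≡ proj₁ d'
    -- genus 0 (Euler): #vertex-orbits + #faces = #edges + 2 #components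
    planar : ∃ λ v → ∃ λ f → ∃ λ c →
      NumClasses (SameOrbit σ) v × NumClasses (SameOrbit (λ d → σ (rev d))) f ×
      NumClasses (Conn σ) c × (v + f ≡ m + 2 * c)

module _ (G : PlaneGraph) where
  open PlaneGraph G
  open import Data.List.Membership.DecPropositional (_≟ᶠ_ {m}) using (_∈?_)

  head : Dart m → Fin n
  head d = tail (rev d)

  edge : Dart m → Fin m
  edge = proj₁

  data WalkFrom : Fin n → List (Dart m) → Set where
    nil  : ∀ {v} → WalkFrom v []
    cons : ∀ {v d ds} → tail d ≡ v → WalkFrom (head d) ds → WalkFrom v (d ∷ ds)

  record Path : Set where
    field
      start : Fin n
      darts : List (Dart m)
      walk  : WalkFrom start darts
      distinct : Unique (start ∷ map head darts)

  edges : Path → List (Fin m)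
  edges P = map edge (Path.darts P)

  revDarts : List (Dart m) → List (Dart m)
  revDarts ds = reverse (map rev ds)

  -- rotation around the contracted subpath with dart list Z:
  -- next dart clockwise, skipping darts of edges of Z
  inZ : List (Dart m) → Dart m → Bool
  inZ Z x = any (λ d → does (edge d ≟ᶠ edge x)) Z

  skip : List (Dart m) → ℕ → Dart m → Dart m
  skip Z zero    x = x
  skip Z (suc k) x = if inZ Z x then skip Z k (σ (rev x)) else x

  nextZ : List (Dart m) → Dart m → Dart m
  nextZ Z d = skip Z (2 * m) (σ d)

  CycOrd : (Dart m → Dart m) → Dart m → Dart m → Dart m → Dart m → Set
  CycOrd f a b c d = ∃ λ i → ∃ λ j → ∃ λ k →
    0 < i × i < j × j < k × iter f i a ≡ b × iter f j a ≡ c × iter f k a ≡ d ×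
    (∀ t → 0 < t → t ≤ k → iter f t a ≢ a)

  -- P = P1,e,Z,e',P2 and Q = Q1,g,Z,g',Q2 (same direction along Z), Z maximal,
  -- and e, g, e', g' (or e, g', e', g) clockwise around Z.
  -- Darts leaving Z: rev e, rev g, e', g'.
  CrossDir : List (Dart m) → List (Dart m) → Set
  CrossDir ps qs =
    Σ (List (Dart m)) λ P1 → Σ (Dart m) λ e → Σ (List (Dart m)) λ Z → Σ (Dart m) λ e' → Σ (List (Dart m)) λ P2 →
    Σ (List (Dart m)) λ Q1 → Σ (Dart m) λ g → Σ (Dart m) λ g' → Σ (List (Dart m)) λ Q2 →
      ps ≡ P1 ++ e ∷ Z ++ e' ∷ P2 × qs ≡ Q1 ++ g ∷ Z ++ g' ∷ Q2 ×
      head e ≡ head g × edge e ≢ edge g × edge e' ≢ edge g' ×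
      (CycOrd (nextZ Z) (rev e) (rev g) e' g' ⊎ CycOrd (nextZ Z) (rev e) g' e' (rev g))

  Cross : Path → Path → Set
  Cross P Q = CrossDir (Path.darts P) (Path.darts Q) ⊎ CrossDir (Path.darts P) (revDarts (Path.darts Q))

  module _ {p : ℕ} (𝒫 : Fin p → Path) where
    load : Fin m → ℕ
    load x = length (filter (λ i → x ∈? edges (𝒫 i)) (allFin p))

    Share : Fin p → Fin p → Set
    Share i j = Any (λ x → x ∈ edges (𝒫 j)) (edges (𝒫 i))

    edgeCountU : ℕ
    edgeCountU = length (filter (λ ij → (toℕ (proj₁ ij) <? toℕ (proj₂ ij)) ×-dec
                                         Any.any? (λ x → x ∈? edges (𝒫 (proj₂ ij))) (edges (𝒫 (proj₁ ij))))
                                (cartesianProduct (allFin p) (allFin p)))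

    ColourableU : ℕ → Set
    ColourableU c = Σ (Fin p → Fin c) λ col → ∀ i j → i ≢ j → Share i j → col i ≢ col j

{-# OPTIONS --safe #-}
module Submission where

-- U is O(k)-degenerate, hence O(k)-colourable.  A path has two end edges, so at most 2k paths
-- share an end edge of a given path, and only O(kp) pairs of the p paths are adjacent in this way.
-- For the other pairs, take a random sample of rate 1/(10k) and keep the sampled paths whose end
-- edges carry no other sampled path.  A pair survives with no third sampled path on a chosen common
-- edge with probability Ω(1/k²), so it suffices that kept paths have O(1) such contacts per path.
-- Two kept paths that share an edge separate at both ends of the shared stretch, and being
-- uncrossed they do so consistently; hence the paths on an edge are linearly ordered, compatibly
-- along edges and around vertices, and the paths can be drawn as disjoint curves.  Contracting these
-- curves and keeping one contact per pair gives a simple planar graph.  Its Euler formula comes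
-- from the one of G by counting identifications of corner labels: labels are attached to the gaps
-- between consecutive curves, and an inequality is enough, because one identification
-- lowers the number of classes by at most one.

open import Defs
open import Data.Bool using (Bool; true; false; if_then_else_)
open import Data.Empty using (⊥; ⊥-elim)
open import Data.Fin using (Fin; zero; suc; toℕ; fromℕ<; inject≤; punchIn; punchOut; combine; remQuot; join; splitAt)
open import Data.List using (List; []; _∷_; _++_; map; reverse; length; filter; allFin; lookup; concatMap; take; tabulate; cartesianProduct)
open import Data.List.Membership.Propositional using (_∈_; _∉_; find)
open import Data.List.Relation.Unary.All using ([]; _∷_)
open import Data.List.Relation.Unary.AllPairs using ([]; _∷_)
open import Data.List.Relation.Unary.Any using (Any; here; there)
open import Data.List.Relation.Unary.Unique.Propositional using (Unique)
open import Data.Nat using (ℕ; zero; suc; _+_; _*_; _∸_; _≤_; _<_; z≤n; s≤s; _≤?_; _<?_; >-nonZero)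
open import Data.Nat.Logarithm using (⌊log₂_⌋; ⌊log₂⌋-mono-≤)
open import Data.Nat.Tactic.RingSolver using (solve-∀)
open import Data.Product using (Σ; ∃; _×_; _,_; proj₁; proj₂)
open import Data.Sum using (_⊎_; inj₁; inj₂)
open import Function using (_∘_; id)
open import Relation.Binary.Definitions using (tri<; tri≈; tri>)
open import Relation.Binary.PropositionalEquality using (_≡_; _≢_; refl; sym; trans; cong; cong₂; subst; subst₂; setoid; module ≡-Reasoning)
open import Relation.Nullary using (¬_; Dec; yes; no; does; contradiction)
open import Relation.Nullary.Decidable using (_×-dec_; _⊎-dec_; ¬?)
import Data.Bool.Properties as Boolₚ
import Data.Fin as Fin
import Data.Fin.Properties as Finₚ
import Data.List.Membership.Propositional.Properties as Memₚ
import Data.List.Properties as Listₚ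
import Data.List.Relation.Binary.Permutation.Setoid.Properties as Permₚ
import Data.List.Relation.Unary.All as All
import Data.List.Relation.Unary.All.Properties as Allₚ
import Data.List.Relation.Unary.AllPairs as AllPairs
import Data.List.Relation.Unary.AllPairs.Properties as AllPairsₚ
import Data.List.Relation.Unary.Any as Any
import Data.List.Relation.Unary.Any.Properties as Anyₚ
import Data.List.Relation.Unary.Unique.Propositional.Properties as Uniqueₚ
import Data.Nat.Properties as ℕₚ
import Data.Sum.Properties as Sumₚ

-- A rotation system offers no curves to draw, so regions exist only as classes of gaps between
-- consecutive strands at the tails of darts. Disjointness becomes a property of matchings: the
-- strands around a vertex are numbered clockwise, each is matched with the continuation of its
-- path, and uncrossedness makes this matching noncrossing. Therefore one identification at every
-- vertex follows from the others, and this saving is what yields enough regions.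
--
-- A contact is a rung that cuts the gap between the only two kept paths on its edge; the sampling
-- is there to produce edges with exactly two kept paths. A region without a path end and without
-- the base corner of a component has at least three rung sides. Among `q` kept paths there are at
-- most `2q` path ends, which leads to at most `3(2q + q) = 9q` rungs.
--
-- At most `k + 2k + 2k = 5k` paths can spoil a contact: those on its edge and those on the end
-- edges of its two paths. At rate `1/(10k)` the union bound thus loses only half. The result is
-- `180kp` clean pairs, and with the end-edge pairs the degrees in `U` sum to at most `364kp`.

-- Counting, finite sums and lists with distinct entries.

𝟙 : ∀ {P : Set} → Dec P → ℕ
𝟙 (yes _) = 1
𝟙 (no _)  = 0

𝟙-yes : ∀ {P : Set} (P? : Dec P) → P → 𝟙 P? ≡ 1
𝟙-yes (yes _) _ = refl
𝟙-yes (no ¬p) p = contradiction p ¬p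

𝟙-no : ∀ {P : Set} (P? : Dec P) → ¬ P → 𝟙 P? ≡ 0
𝟙-no (yes p) ¬p = contradiction p ¬p
𝟙-no (no _)  _  = refl

𝟙-mono : ∀ {P Q : Set} (P? : Dec P) (Q? : Dec Q) → (P → Q) → 𝟙 P? ≤ 𝟙 Q?
𝟙-mono (no _)  _  _   = z≤n
𝟙-mono (yes p) Q? P→Q = ℕₚ.≤-reflexive (sym (𝟙-yes Q? (P→Q p)))

𝟙-cong : ∀ {P Q : Set} (P? : Dec P) (Q? : Dec Q) → (P → Q) → (Q → P) → 𝟙 P? ≡ 𝟙 Q?
𝟙-cong P? Q? P→Q Q→P = ℕₚ.≤-antisym (𝟙-mono P? Q? P→Q) (𝟙-mono Q? P? Q→P)

𝟙-⊎ : ∀ {P Q R : Set} (P? : Dec P) (Q? : Dec Q) (R? : Dec R) → (P → Q ⊎ R) → 𝟙 P? ≤ 𝟙 Q? + 𝟙 R?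
𝟙-⊎ (no _)  _  _  _ = z≤n
𝟙-⊎ (yes p) Q? R? h with h p
... | inj₁ q = ℕₚ.≤-trans (ℕₚ.≤-reflexive (sym (𝟙-yes Q? q))) (ℕₚ.m≤m+n _ _)
... | inj₂ r = ℕₚ.≤-trans (ℕₚ.≤-reflexive (sym (𝟙-yes R? r))) (ℕₚ.m≤n+m _ _)

sum : ∀ {n} → (Fin n → ℕ) → ℕ
sum {zero}  f = 0
sum {suc n} f = f zero + sum (f ∘ suc)

sum-cong : ∀ {n} {f g : Fin n → ℕ} → (∀ i → f i ≡ g i) → sum f ≡ sum g
sum-cong {zero}  _   = refl
sum-cong {suc n} f≗g = cong₂ _+_ (f≗g zero) (sum-cong (f≗g ∘ suc))

sum-distrib-+ : ∀ {n} (f g : Fin n → ℕ) → sum (λ i → f i + g i) ≡ sum f + sum g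
sum-distrib-+ {zero}  f g = refl
sum-distrib-+ {suc n} f g =
  trans (cong (f zero + g zero +_) (sum-distrib-+ (f ∘ suc) (g ∘ suc))) (swap (f zero) (g zero) _ _)
  where
  swap : ∀ a b c d → a + b + (c + d) ≡ a + c + (b + d)
  swap = solve-∀

sum-const : ∀ n c → sum {n} (λ _ → c) ≡ n * c
sum-const zero    c = refl
sum-const (suc n) c = cong (c +_) (sum-const n c)

sum-zero : ∀ {n} {f : Fin n → ℕ} → (∀ i → f i ≡ 0) → sum f ≡ 0
sum-zero {n} f≡0 = trans (sum-cong f≡0) (trans (sum-const n 0) (ℕₚ.*-zeroʳ n))

sum-comm : ∀ {m n} (f : Fin m → Fin n → ℕ) → sum (λ i → sum (f i)) ≡ sum (λ j → sum (λ i → f i j))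
sum-comm {zero} {n} f = sym (sum-zero {n} λ _ → refl)
sum-comm {suc m} f =
  trans (cong (sum (f zero) +_) (sum-comm (f ∘ suc))) (sym (sum-distrib-+ (f zero) _))

sum-mono : ∀ {n} {f g : Fin n → ℕ} → (∀ i → f i ≤ g i) → sum f ≤ sum g
sum-mono {zero}  _   = z≤n
sum-mono {suc n} f≤g = ℕₚ.+-mono-≤ (f≤g zero) (sum-mono (f≤g ∘ suc))

sum-mono-< : ∀ {n} {f g : Fin n → ℕ} → (∀ i → f i ≤ g i) → ∀ i → f i < g i → sum f < sum g
sum-mono-< {suc n} f≤g zero    fi<gi = ℕₚ.+-mono-<-≤ fi<gi (sum-mono (f≤g ∘ suc))
sum-mono-< {suc n} f≤g (suc i) fi<gi = ℕₚ.+-mono-≤-< (f≤g zero) (sum-mono-< (f≤g ∘ suc) i fi<gi)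

sum-distribˡ-* : ∀ {n} c (f : Fin n → ℕ) → sum (λ i → c * f i) ≡ c * sum f
sum-distribˡ-* {zero}  c f = sym (ℕₚ.*-zeroʳ c)
sum-distribˡ-* {suc n} c f =
  trans (cong (c * f zero +_) (sum-distribˡ-* c (f ∘ suc))) (sym (ℕₚ.*-distribˡ-+ c (f zero) _))

sum-≟ : ∀ {n} (i : Fin n) → sum (λ j → 𝟙 (i Finₚ.≟ j)) ≡ 1
sum-≟ {suc n} zero = cong suc (sum-zero {n} (λ j → 𝟙-no (zero Finₚ.≟ suc j) λ ()))
sum-≟ {suc n} (suc i) =
  trans (cong (_+ sum (λ j → 𝟙 (suc i Finₚ.≟ suc j))) (𝟙-no (suc i Finₚ.≟ zero) λ ()))
        (trans (sum-cong (λ j → 𝟙-cong (suc i Finₚ.≟ suc j) (i Finₚ.≟ j) Finₚ.suc-injective (cong suc))) (sum-≟ i))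

count : ∀ {n} {P : Fin n → Set} → (∀ i → Dec (P i)) → ℕ
count P? = sum (𝟙 ∘ P?)

count-filter : ∀ {n} {P : Fin n → Set} (P? : ∀ i → Dec (P i)) → length (filter P? (allFin n)) ≡ count P?
count-filter P? = go id
  where
  go : ∀ {n} (f : Fin n → _) → length (filter P? (tabulate f)) ≡ sum (𝟙 ∘ P? ∘ f)
  go {zero}  f = refl
  go {suc n} f with P? (f zero)
  ... | yes _ = cong suc (go (f ∘ suc))
  ... | no _  = go (f ∘ suc)

count-complement : ∀ {n} {P : Fin n → Set} (P? : ∀ i → Dec (P i)) → count P? + count (¬? ∘ P?) ≡ n
count-complement {n} P? =
  trans (sym (sum-distrib-+ (𝟙 ∘ P?) (𝟙 ∘ ¬? ∘ P?)))
        (trans (sum-cong split) (trans (sum-const n 1) (ℕₚ.*-identityʳ n)))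
  where
  split : ∀ i → 𝟙 (P? i) + 𝟙 (¬? (P? i)) ≡ 1
  split i with P? i
  ... | yes _ = refl
  ... | no _  = refl

lookup-injective : ∀ {A : Set} {xs : List A} → Unique xs → ∀ i j → lookup xs i ≡ lookup xs j → i ≡ j
lookup-injective (_ ∷ _)  zero    zero    _  = refl
lookup-injective (x∉ ∷ _) zero    (suc j) eq = contradiction eq (All.lookup x∉ (Memₚ.∈-lookup j))
lookup-injective (x∉ ∷ _) (suc i) zero    eq = contradiction (sym eq) (All.lookup x∉ (Memₚ.∈-lookup i))
lookup-injective (_ ∷ u)  (suc i) (suc j) eq = cong suc (lookup-injective u i j eq)

length≤-injective : ∀ {A B : Set} {xs : List A} {ys : List B} (g : A → B) → Unique xs →
                    (∀ {x y} → x ∈ xs → y ∈ xs → g x ≡ g y → x ≡ y) → (∀ {x} → x ∈ xs → g x ∈ ys) → length xs ≤ length ys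
length≤-injective {xs = xs} {ys} g u inj sub = Finₚ.injective⇒≤ {f = λ i → Any.index (hit i)} inj′
  where
  hit : ∀ i → g (lookup xs i) ∈ ys
  hit i = sub (Memₚ.∈-lookup i)
  inj′ : ∀ {i j} → Any.index (hit i) ≡ Any.index (hit j) → i ≡ j
  inj′ {i} {j} eq = lookup-injective u i j (inj (Memₚ.∈-lookup i) (Memₚ.∈-lookup j)
    (trans (Anyₚ.lookup-index (hit i)) (trans (cong (lookup ys) eq) (sym (Anyₚ.lookup-index (hit j))))))

⊆⇒length≤ : ∀ {A : Set} {xs ys : List A} → Unique xs → (∀ {x} → x ∈ xs → x ∈ ys) → length xs ≤ length ys
⊆⇒length≤ u = length≤-injective id u (λ _ _ eq → eq)

unique-length≤count : ∀ {n} {P : Fin n → Set} (P? : ∀ i → Dec (P i)) {xs : List (Fin n)} →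
                      Unique xs → (∀ {x} → x ∈ xs → P x) → length xs ≤ count P?
unique-length≤count P? u xs⊆P = ℕₚ.≤-trans
  (⊆⇒length≤ u (λ {x} x∈ → Memₚ.∈-filter⁺ P? (Memₚ.∈-allFin x) (xs⊆P x∈)))
  (ℕₚ.≤-reflexive (count-filter P?))

count≤length : ∀ {n} {P : Fin n → Set} (P? : ∀ i → Dec (P i)) {xs : List (Fin n)} →
               (∀ x → P x → x ∈ xs) → count P? ≤ length xs
count≤length P? P⊆xs = ℕₚ.≤-trans (ℕₚ.≤-reflexive (sym (count-filter P?)))
  (⊆⇒length≤ (Uniqueₚ.filter⁺ P? (Uniqueₚ.allFin⁺ _)) (λ x∈ → P⊆xs _ (proj₂ (Memₚ.∈-filter⁻ P? {xs = allFin _} x∈))))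

injective⇒surjective : ∀ {n} (f : Fin n → Fin n) → (∀ i j → f i ≡ f j → i ≡ j) → ∀ y → ∃ λ x → f x ≡ y
injective⇒surjective {suc n} f inj y with Finₚ.any? (λ x → f x Finₚ.≟ y)
... | yes hit = hit
... | no miss = contradiction
  (Finₚ.injective⇒≤ {f = λ x → punchOut (λ eq → miss (x , sym eq))}
    (λ {i} {j} eq → inj i j (Finₚ.punchOut-injective (λ e → miss (i , sym e)) (λ e → miss (j , sym e)) eq)))
  ℕₚ.1+n≰n

-- Imposing one pair either changes nothing or collapses one class: `c` deletes the class of `h b`
-- and redirects it to that of `h a`. So a list of pairs costs at most its length.
quotient : ∀ {N} (ms : List (Fin N × Fin N)) → ∃ λ N′ → Σ (Fin N → Fin N′) λ h →
           N ≤ N′ + length ms × (∀ y → ∃ λ x → h x ≡ y) × (∀ {x y} → (x , y) ∈ ms → h x ≡ h y)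
quotient {N} [] = N , id , ℕₚ.≤-reflexive (sym (ℕₚ.+-identityʳ N)) , (λ y → y , refl) , λ ()
quotient {N} ((a , b) ∷ ms) with quotient ms
... | N′ , h , N≤ , onto , eqs with h a Finₚ.≟ h b
... | yes ha≡hb = N′ , h , ℕₚ.≤-trans N≤ (ℕₚ.+-monoʳ-≤ N′ (ℕₚ.n≤1+n _)) , onto ,
                  λ { (here refl) → ha≡hb ; (there xy∈) → eqs xy∈ }
quotient {N} ((a , b) ∷ ms) | zero , h , _ | no _ = contradiction (h a) Finₚ.¬Fin0
quotient {N} ((a , b) ∷ ms) | suc N′ , h , N≤ , onto , eqs | no ha≢hb =
  N′ , c ∘ h , ℕₚ.≤-trans N≤ (ℕₚ.≤-reflexive (sym (ℕₚ.+-suc N′ _))) , onto′ , merged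
  where
  c : Fin (suc N′) → Fin N′
  c z with h b Finₚ.≟ z
  ... | yes _   = punchOut (ha≢hb ∘ sym)
  ... | no hb≢z = punchOut hb≢z
  onto′ : ∀ y → ∃ λ x → c (h x) ≡ y
  onto′ y with onto (punchIn (h b) y)
  ... | x , hx≡ = x , helper
    where
    helper : c (h x) ≡ y
    helper with h b Finₚ.≟ h x
    ... | yes eq = contradiction (sym (trans eq hx≡)) (Finₚ.punchInᵢ≢i (h b) y)
    ... | no neq = trans (Finₚ.punchOut-cong (h b) {i≢k = λ eq → Finₚ.punchInᵢ≢i (h b) y (sym eq)} hx≡) (Finₚ.punchOut-punchIn (h b))
  ca≡cb : c (h a) ≡ c (h b)
  ca≡cb with h b Finₚ.≟ h a | h b Finₚ.≟ h b
  ... | yes eq | _     = contradiction (sym eq) ha≢hb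
  ... | no _   | no ¬r = contradiction refl ¬r
  ... | no _   | yes _ = Finₚ.punchOut-cong (h b) refl
  merged : ∀ {x y} → (x , y) ∈ (a , b) ∷ ms → c (h x) ≡ c (h y)
  merged (here refl) = ca≡cb
  merged (there xy∈) = cong c (eqs xy∈)

length-take-1 : ∀ {A : Set} (xs : List A) → length (take 1 xs) ≤ 1
length-take-1 []      = z≤n
length-take-1 (_ ∷ _) = s≤s z≤n

∈-take-1 : ∀ {A : Set} {xs ys : List A} {x} → xs ≡ x ∷ ys → x ∈ take 1 xs
∈-take-1 refl = here refl

Unique-reverse : ∀ {A : Set} {xs : List A} → Unique xs → Unique (reverse xs)
Unique-reverse {A} {xs} = Permₚ.Unique-resp-↭ (setoid A) (↭-sym (Permₚ.↭-reverse (setoid A) xs))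
  where open import Data.List.Relation.Binary.Permutation.Setoid (setoid A) using (↭-sym)

-- Used with `f` the edge of a dart and with `f` its head: either one locates a dart on a path.
split-unique : ∀ {A B : Set} (f : A → B) {xs : List A} → Unique (map f xs) → ∀ X Y {x y X′ Y′} →
               xs ≡ X ++ x ∷ X′ → xs ≡ Y ++ y ∷ Y′ → f x ≡ f y → X ≡ Y × x ≡ y × X′ ≡ Y′
split-unique f u       []      []      refl refl _  = refl , refl , refl
split-unique f (n ∷ _) []      (_ ∷ Y) refl refl eq =
  contradiction eq (All.lookup n (Memₚ.∈-map⁺ f (Memₚ.∈-insert Y)))
split-unique f (n ∷ _) (_ ∷ X) []      refl refl eq =
  contradiction (sym eq) (All.lookup n (Memₚ.∈-map⁺ f (Memₚ.∈-insert X)))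
split-unique f (_ ∷ u) (x ∷ X) (_ ∷ Y) {X′ = X′} refl eq fx≡fy with refl , eq′ ← Listₚ.∷-injective eq
  with refl , p , q ← split-unique f u X Y refl eq′ fx≡fy = refl , p , q

-- Paths as lists of darts, traversed in either direction.

module Trails (G : PlaneGraph) where
  open PlaneGraph G

  D : Set
  D = Dart m

  _≟ᵈ_ : (d d′ : D) → Dec (d ≡ d′)
  (e , b) ≟ᵈ (e′ , b′) with e Finₚ.≟ e′ | b Boolₚ.≟ b′
  ... | yes refl | yes refl = yes refl
  ... | no ¬p    | _        = no λ { refl → ¬p refl }
  ... | _        | no ¬p    = no λ { refl → ¬p refl }

  hd : D → Fin n
  hd = head G

  rv : List D → List D
  rv = revDarts G

  rev-rev : (d : D) → rev (rev d) ≡ d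
  rev-rev (e , b) = cong (e ,_) (Boolₚ.not-involutive b)

  rev≢ : (d : D) → rev d ≢ d
  rev≢ (e , true) ()
  rev≢ (e , false) ()

  same-edge : (d d′ : D) → edge G d ≡ edge G d′ → d ≡ d′ ⊎ d ≡ rev d′
  same-edge (e , false) (_ , false) refl = inj₁ refl
  same-edge (e , true)  (_ , true)  refl = inj₁ refl
  same-edge (e , false) (_ , true)  refl = inj₂ refl
  same-edge (e , true)  (_ , false) refl = inj₂ refl

  hd-rev : ∀ d → hd (rev d) ≡ tail d
  hd-rev d = cong tail (rev-rev d)

  rv-∷ : ∀ d ds → rv (d ∷ ds) ≡ rv ds ++ rev d ∷ []
  rv-∷ d ds = Listₚ.unfold-reverse (rev d) (map rev ds)

  rv-++ : ∀ xs ys → rv (xs ++ ys) ≡ rv ys ++ rv xs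
  rv-++ xs ys = trans (cong reverse (Listₚ.map-++ rev xs ys)) (Listₚ.reverse-++ (map rev xs) (map rev ys))

  rv-split : ∀ A d B → rv (A ++ d ∷ B) ≡ rv B ++ rev d ∷ rv A
  rv-split A d B = trans (rv-++ A (d ∷ B)) (trans (cong (_++ rv A) (rv-∷ d B)) (Listₚ.++-assoc (rv B) _ _))

  rv-rv : ∀ ds → rv (rv ds) ≡ ds
  rv-rv []       = refl
  rv-rv (d ∷ ds) = trans (cong rv (rv-∷ d ds)) (trans (rv-++ (rv ds) (rev d ∷ []))
    (cong₂ _∷_ (rev-rev d) (rv-rv ds)))

  Trail : List D → Set
  Trail ds = ∃ λ v → WalkFrom G v ds × Unique (v ∷ map hd ds)

  ∈-head : ∀ {d ds} → d ∈ ds → hd d ∈ map hd ds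
  ∈-head = Memₚ.∈-map⁺ hd

  ∈-tail : ∀ {v d ds} → WalkFrom G v ds → d ∈ ds → tail d ∈ v ∷ map hd ds
  ∈-tail (cons t≡ w) (here refl) = here t≡
  ∈-tail (cons _ w)  (there d∈)  = there (∈-tail w d∈)

  trail-∷ : ∀ {d ds} → Trail (d ∷ ds) → Trail ds
  trail-∷ (_ , cons _ w , _ ∷ u) = _ , w , u

  -- A later dart on the same edge would have the starting vertex as its tail or as its head, and
  -- that vertex does not recur.
  trail-edges : ∀ {ds} → Trail ds → Unique (map (edge G) ds)
  trail-edges {[]}     _ = []
  trail-edges {d ∷ ds} t@(v , cons t≡ w , n ∷ _) = Allₚ.map⁺ (All.tabulate fresh) ∷ trail-edges (trail-∷ t)
    where
    fresh : ∀ {y} → y ∈ ds → edge G d ≢ edge G y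
    fresh {y} y∈ eq with same-edge y d (sym eq)
    ... | inj₁ refl = All.lookup n (∈-tail w y∈) (sym t≡)
    ... | inj₂ refl = All.lookup n (there (∈-head y∈)) (trans (sym t≡) (sym (hd-rev d)))

  trail-heads : ∀ {ds} → Trail ds → Unique (map hd ds)
  trail-heads (_ , _ , _ ∷ u) = u

  trail-next : ∀ {L} → Trail L → ∀ A {x B c} → L ≡ A ++ x ∷ B → c ∈ L → tail c ≡ hd x → ∃ λ B′ → B ≡ c ∷ B′
  trail-next (_ , cons t≡ _ , n ∷ _) [] refl (here refl) tc =
    contradiction (trans (sym t≡) tc) (All.lookup n (here refl))
  trail-next _ [] {B = _ ∷ B′} refl (there (here refl)) _ = B′ , refl
  trail-next (_ , cons _ (cons _ w) , _ ∷ (n ∷ _)) [] refl (there (there c∈)) tc =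
    contradiction (sym tc) (All.lookup n (∈-tail w c∈))
  trail-next (_ , cons t≡ _ , n ∷ _) (_ ∷ A) refl (here refl) tc =
    contradiction (trans (sym t≡) tc) (All.lookup n (there (∈-head (Memₚ.∈-insert A))))
  trail-next t (_ ∷ A) refl (there c∈) tc = trail-next (trail-∷ t) A refl c∈ tc

  end : Fin n → List D → Fin n
  end v []       = v
  end v (d ∷ ds) = end (hd d) ds

  walk-tails : ∀ {v ds} → WalkFrom G v ds → map tail ds ++ end v ds ∷ [] ≡ v ∷ map hd ds
  walk-tails nil           = refl
  walk-tails (cons refl w) = cong (_ ∷_) (walk-tails w)

  walk-snoc : ∀ {v ds d} → WalkFrom G v ds → tail d ≡ end v ds → WalkFrom G v (ds ++ d ∷ [])
  walk-snoc nil         eq = cons eq nil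
  walk-snoc (cons t≡ w) eq = cons t≡ (walk-snoc w eq)

  end-snoc : ∀ v ds d → end v (ds ++ d ∷ []) ≡ hd d
  end-snoc v []       d = refl
  end-snoc v (x ∷ ds) d = end-snoc (hd x) ds d

  walk-rv : ∀ {v ds} → WalkFrom G v ds → WalkFrom G (end v ds) (rv ds) × end (end v ds) (rv ds) ≡ v
  walk-rv nil = nil , refl
  walk-rv {ds = d ∷ ds} (cons refl w) with w′ , e′ ← walk-rv w =
    subst (λ l → WalkFrom G (end (hd d) ds) l × end (end (hd d) ds) l ≡ tail d) (sym (rv-∷ d ds))
      (walk-snoc w′ (sym e′) , trans (end-snoc _ (rv ds) (rev d)) (hd-rev d))

  trail-rv : ∀ {ds} → Trail ds → Trail (rv ds)
  trail-rv {ds} (v , w , u) = end v ds , proj₁ (walk-rv w) , subst Unique verts (Unique-reverse u)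
    where
    heads : ∀ xs → map hd (rv xs) ≡ reverse (map tail xs)
    heads xs = trans (Listₚ.reverse-map hd (map rev xs))
      (cong reverse (trans (sym (Listₚ.map-∘ xs)) (Listₚ.map-cong hd-rev xs)))
    verts : reverse (v ∷ map hd ds) ≡ end v ds ∷ map hd (rv ds)
    verts = trans (cong reverse (sym (walk-tails w)))
      (trans (Listₚ.reverse-++ (map tail ds) (end v ds ∷ [])) (cong (end v ds ∷_) (sym (heads ds))))

  -- A traversal of P at d: P, in one of its two directions, reads A, d, B.
  At : Path G → List D → D → List D → Set
  At P A d B = Path.darts P ≡ A ++ d ∷ B ⊎ rv (Path.darts P) ≡ A ++ d ∷ B

  On : Path G → D → Set
  On P d = edge G d ∈ edges G P

  On? : ∀ P d → Dec (On P d)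
  On? P d = edge G d ∈? edges G P
    where open import Data.List.Membership.DecPropositional (Finₚ._≟_ {m}) using (_∈?_)

  module _ (P : Path G) where
    open Path P

    trail : Trail darts
    trail = start , walk , distinct

    abstract
      At⇒trail : ∀ {A d B} → At P A d B → Trail (A ++ d ∷ B)
      At⇒trail (inj₁ eq) = subst Trail eq trail
      At⇒trail (inj₂ eq) = subst Trail eq (trail-rv trail)

      At-rev : ∀ {A d B} → At P A d B → At P (rv B) (rev d) (rv A)
      At-rev {A} {d} {B} (inj₁ eq) = inj₂ (trans (cong rv eq) (rv-split A d B))
      At-rev {A} {d} {B} (inj₂ eq) = inj₁ (trans (sym (rv-rv darts)) (trans (cong rv eq) (rv-split A d B)))

      At-next : ∀ {A d x B} → At P A d (x ∷ B) → At P (A ++ d ∷ []) x B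
      At-next {A} {d} {x} {B} (inj₁ eq) = inj₁ (trans eq (sym (Listₚ.++-assoc A (d ∷ []) (x ∷ B))))
      At-next {A} {d} {x} {B} (inj₂ eq) = inj₂ (trans eq (sym (Listₚ.++-assoc A (d ∷ []) (x ∷ B))))

      ∈darts⇒At : ∀ {d} → d ∈ darts → ∃ λ A → ∃ λ B → At P A d B
      ∈darts⇒At d∈ with A , B , eq ← Memₚ.∈-∃++ d∈ = A , B , inj₁ eq

      On-∈ : ∀ {d} → On P d → d ∈ darts ⊎ rev d ∈ darts
      On-∈ {d} e∈ with y , y∈ , eq ← Memₚ.∈-map⁻ (edge G) e∈ with same-edge y d (sym eq)
      ... | inj₁ refl = inj₁ y∈
      ... | inj₂ refl = inj₂ y∈

      On⇒At : ∀ {d} → On P d → ∃ λ A → ∃ λ B → At P A d B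
      On⇒At {d} on with On-∈ {d} on
      ... | inj₁ d∈ = ∈darts⇒At d∈
      ... | inj₂ r∈ with A , B , at ← ∈darts⇒At r∈ = rv B , rv A , subst (λ x → At P (rv B) x (rv A)) (rev-rev d) (At-rev at)

      ∈⇒On : ∀ {d} → d ∈ darts → On P d
      ∈⇒On = Memₚ.∈-map⁺ (edge G)

      At⇒On : ∀ {A d B} → At P A d B → On P d
      At⇒On {A} {d} {B} (inj₁ eq) = ∈⇒On (subst (d ∈_) (sym eq) (Memₚ.∈-insert A))
      At⇒On {A} {d} {B} at@(inj₂ eq₀) with At-rev at
      ... | inj₁ eq = ∈⇒On (subst (rev d ∈_) (sym eq) (Memₚ.∈-insert (rv B)))
      ... | inj₂ eq with refl , eq′ , _ ← split-unique (edge G) (trail-edges (trail-rv trail)) A (rv B) eq₀ eq refl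
        = contradiction (sym eq′) (rev≢ d)

      -- Otherwise `d` and `rev d` would both stand in one list whose edges are distinct.
      At-directed : ∀ {A d B A′ B′} → darts ≡ A ++ d ∷ B → rv darts ≡ A′ ++ d ∷ B′ → ⊥
      At-directed {A} {d} {B} {A′} {B′} eq eq′ with At-rev {A′} {d} {B′} (inj₂ eq′)
      ... | inj₁ eq″ = rev≢ d (sym (proj₁ (proj₂ (split-unique (edge G) (trail-edges trail) A (rv B′) eq eq″ refl))))
      ... | inj₂ eq″ = rev≢ d (sym (proj₁ (proj₂ (split-unique (edge G) (trail-edges (trail-rv trail)) A′ (rv B′) eq′ eq″ refl))))

      At-unique : ∀ {A d B A′ B′} → At P A d B → At P A′ d B′ → A ≡ A′ × B ≡ B′
      At-unique {A} {d} {B} {A′} (inj₁ p) (inj₁ q) with a , _ , b ← split-unique (edge G) (trail-edges trail) A A′ p q refl = a , b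
      At-unique {A} {d} {B} {A′} (inj₂ p) (inj₂ q) with a , _ , b ← split-unique (edge G) (trail-edges (trail-rv trail)) A A′ p q refl = a , b
      At-unique {A} {d} {B} {A′} {B′} (inj₁ p) (inj₂ q) = ⊥-elim (At-directed {A} {d} {B} {A′} {B′} p q)
      At-unique {A} {d} {B} {A′} {B′} (inj₂ p) (inj₁ q) = ⊥-elim (At-directed {A′} {d} {B′} {A} {B} q p)

      -- The darts met after d when P is followed in the direction of d.
      rest : D → List D
      rest d with On? P d
      ... | yes on = proj₁ (proj₂ (On⇒At {d} on))
      ... | no _   = []

      rest-At : ∀ {A d B} → At P A d B → rest d ≡ B
      rest-At {A} {d} {B} at with On? P d
      ... | yes on = proj₂ (At-unique (proj₂ (proj₂ (On⇒At {d} on))) at)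
      ... | no ¬on = contradiction (At⇒On {A} at) ¬on

      On⇒rest : ∀ {d} → On P d → ∃ λ A → At P A d (rest d)
      On⇒rest {d} on with A , B , at ← On⇒At {d} on = A , subst (At P A d) (sym (rest-At at)) at

      On-rest : ∀ {d x} → On P d → x ∈ rest d → On P x
      On-rest {d} {x} on x∈ with A , at ← On⇒rest {d} on with B , C , eq ← Memₚ.∈-∃++ x∈ with at
      ... | inj₁ e = At⇒On {A = A ++ d ∷ B} {B = C} (inj₁ (trans e (trans (cong (λ l → A ++ d ∷ l) eq) (sym (Listₚ.++-assoc A (d ∷ B) (x ∷ C))))))
      ... | inj₂ e = At⇒On {A = A ++ d ∷ B} {B = C} (inj₂ (trans e (trans (cong (λ l → A ++ d ∷ l) eq) (sym (Listₚ.++-assoc A (d ∷ B) (x ∷ C))))))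

      rest-∷ : ∀ {d x B} → On P d → rest d ≡ x ∷ B → rest x ≡ B × On P x
      rest-∷ {d} {x} {B} on eq with A , at ← On⇒rest {d} on = rest-At at′ , At⇒On at′
        where
        at′ : At P (A ++ d ∷ []) x B
        at′ = At-next (subst (At P A d) eq at)

      rest-back : ∀ {d x B} → On P d → rest d ≡ x ∷ B → ∃ λ B′ → rest (rev x) ≡ rev d ∷ B′
      rest-back {d} {x} {B} on eq with A , at ← On⇒rest {d} on =
        rv A , trans (rest-At (At-rev (At-next (subst (At P A d) eq at)))) (rv-++ A (d ∷ []))

      rest-walk : ∀ {d} → On P d → WalkFrom G (hd d) (rest d)
      rest-walk {d} on with A , at ← On⇒rest {d} on with v , w , _ ← At⇒trail at = go A w
        where
        go : ∀ {v} A → WalkFrom G v (A ++ d ∷ rest d) → WalkFrom G (hd d) (rest d)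
        go []      (cons _ w) = w
        go (_ ∷ A) (cons _ w) = go A w

      rest-tail : ∀ {d x B} → On P d → rest d ≡ x ∷ B → tail x ≡ hd d
      rest-tail {d} {x} {B} on eq with cons t≡ _ ← subst (WalkFrom G (hd d)) eq (rest-walk {d} on) = t≡

      rest-edge≢ : ∀ {d x} → On P d → x ∈ rest d → edge G x ≢ edge G d
      rest-edge≢ {d} {x} on x∈ eq with A , at ← On⇒rest {d} on with B , C , r≡ ← Memₚ.∈-∃++ x∈ =
        absurd (split-unique (edge G) (trail-edges (At⇒trail at)) A (A ++ d ∷ B) refl
          (trans (cong (λ l → A ++ d ∷ l) r≡) (sym (Listₚ.++-assoc A (d ∷ B) (x ∷ C)))) (sym eq))
        where
        absurd : ∀ {X : Set} → A ≡ A ++ d ∷ B × X → ⊥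
        absurd (p , _) with () ← Listₚ.++-identityʳ-unique A p

      -- The path visits the common tail only once. Follow it in the direction of `rev a`: if it
      -- runs along `c`, then `c` comes directly after `rev a`; if it runs along `rev c`, this dart
      -- enters the same vertex as `rev a` and is therefore `rev a`.
      two-darts : ∀ {a c} → On P a → On P c → tail a ≡ tail c → c ≡ a ⊎ ∃ λ B → rest (rev a) ≡ c ∷ B
      two-darts {a} {c} onA onC ta≡tc with A , at ← On⇒rest {rev a} onA with t ← At⇒trail at = go (On-∈ {c} onC) at
        where
        L : List D
        L = A ++ rev a ∷ rest (rev a)
        fwd : c ∈ L → c ≡ a ⊎ ∃ λ B → rest (rev a) ≡ c ∷ B
        fwd c∈ = inj₂ (trail-next t A refl c∈ (trans (sym ta≡tc) (sym (hd-rev a))))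
        bwd : rev c ∈ L → c ≡ a ⊎ ∃ λ B → rest (rev a) ≡ c ∷ B
        bwd c∈ with B , C , eq ← Memₚ.∈-∃++ c∈ =
          inj₁ (trans (sym (rev-rev c)) (trans (cong rev (proj₁ (proj₂ (split-unique hd (trail-heads t) B A eq refl
            (trans (hd-rev c) (trans (sym ta≡tc) (sym (hd-rev a)))))))) (rev-rev a)))
        flip : ∀ {d} → d ∈ darts → rev d ∈ rv darts
        flip d∈ = Anyₚ.reverse⁺ (Memₚ.∈-map⁺ rev d∈)
        go : c ∈ darts ⊎ rev c ∈ darts → At P A (rev a) (rest (rev a)) → c ≡ a ⊎ ∃ λ B → rest (rev a) ≡ c ∷ B
        go (inj₁ c∈) (inj₁ eq) = fwd (subst (c ∈_) eq c∈)
        go (inj₂ r∈) (inj₁ eq) = bwd (subst (rev c ∈_) eq r∈)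
        go (inj₁ c∈) (inj₂ eq) = bwd (subst (rev c ∈_) eq (flip c∈))
        go (inj₂ r∈) (inj₂ eq) = fwd (subst (c ∈_) eq (subst (_∈ rv darts) (rev-rev c) (flip r∈)))

-- Iteration and clockwise turns at a vertex.

least : ∀ {P : ℕ → Set} → (∀ k → Dec (P k)) → ∀ k → P k → ∃ λ q → P q × (∀ t → t < q → ¬ P t)
least {P} P? k pk with P? 0
... | yes p0 = 0 , p0 , λ _ ()
least {P} P? zero    pk | no ¬p0 = contradiction pk ¬p0
least {P} P? (suc k) pk | no ¬p0 with q , pq , below ← least {P ∘ suc} (P? ∘ suc) k pk =
  suc q , pq , λ { zero _ → ¬p0 ; (suc t) (s≤s t<q) → below t t<q }

iter-+ : ∀ {A : Set} (f : A → A) j k x → iter f (j + k) x ≡ iter f j (iter f k x)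
iter-+ f zero    k x = refl
iter-+ f (suc j) k x = cong f (iter-+ f j k x)

iter-∸ : ∀ {A : Set} (f : A → A) {j k} → j ≤ k → ∀ x → iter f k x ≡ iter f (k ∸ j) (iter f j x)
iter-∸ f {j} {k} j≤k x = trans (cong (λ t → iter f t x) (sym (ℕₚ.m∸n+n≡m j≤k))) (iter-+ f (k ∸ j) j x)

iter-shift : ∀ {A : Set} (f : A → A) k x → iter f (suc k) x ≡ iter f k (f x)
iter-shift f zero    x = refl
iter-shift f (suc k) x = cong f (iter-shift f k x)

module Rotation (G : PlaneGraph) where
  open PlaneGraph G
  open Trails G

  tail-iter : ∀ k d → tail (iter σ k d) ≡ tail d
  tail-iter zero    d = refl
  tail-iter (suc k) d = trans (σ-tail _) (tail-iter k d)

  iter-injective : ∀ k {x y} → iter σ k x ≡ iter σ k y → x ≡ y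
  iter-injective zero    eq = eq
  iter-injective (suc k) eq = iter-injective k (σ-inj _ _ eq)

  -- The number of clockwise steps from a to b; junk value 0 if they leave different vertices.
  abstract
    turn : D → D → ℕ
    turn a b with tail a Finₚ.≟ tail b
    ... | yes eq = proj₁ (least (λ q → iter σ q a ≟ᵈ b) (proj₁ (σ-trans a b eq)) (proj₂ (σ-trans a b eq)))
    ... | no _   = 0

    iter-turn : ∀ {a b} → tail a ≡ tail b → iter σ (turn a b) a ≡ b
    iter-turn {a} {b} eq with tail a Finₚ.≟ tail b
    ... | yes eq′ = proj₁ (proj₂ (least (λ q → iter σ q a ≟ᵈ b) (proj₁ (σ-trans a b eq′)) (proj₂ (σ-trans a b eq′))))
    ... | no neq  = contradiction eq neq

    turn-min : ∀ {a b t} → t < turn a b → iter σ t a ≢ b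
    turn-min {a} {b} {t} t< with tail a Finₚ.≟ tail b
    ... | yes eq = proj₂ (proj₂ (least (λ q → iter σ q a ≟ᵈ b) (proj₁ (σ-trans a b eq)) (proj₂ (σ-trans a b eq)))) t t<
    turn-min () | no _

  -- Since `turn a a` is 0, the full turn is measured from `σ a` and increased by one.
  degree : D → ℕ
  degree a = suc (turn (σ a) a)

  abstract
    iter-degree : ∀ a → iter σ (degree a) a ≡ a
    iter-degree a = trans (iter-shift σ (turn (σ a) a) a) (iter-turn (σ-tail a))

    below-degree : ∀ {a t} → 0 < t → t < degree a → iter σ t a ≢ a
    below-degree {a} {suc t} _ (s≤s t<) eq = turn-min t< (trans (sym (iter-shift σ t a)) eq)

    turn<degree : ∀ {a b} → tail a ≡ tail b → turn a b < degree a
    turn<degree {a} {b} eq with turn a b <? degree a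
    ... | yes p = p
    ... | no ¬p = contradiction
      (trans (cong (iter σ (turn a b ∸ degree a)) (sym (iter-degree a)))
        (trans (sym (iter-∸ σ (ℕₚ.≮⇒≥ ¬p) a)) (iter-turn eq)))
      (turn-min {a} {b} (ℕₚ.∸-monoʳ-< {turn a b} {degree a} {0} (s≤s z≤n) (ℕₚ.≮⇒≥ ¬p)))

    turn-unique : ∀ {a b q} → q < degree a → iter σ q a ≡ b → turn a b ≡ q
    turn-unique {a} {b} {q} q< eq with ℕₚ.<-cmp (turn a b) q
    ... | tri≈ _ p _ = p
    ... | tri> _ _ p = contradiction eq (turn-min p)
    ... | tri< p _ _ = contradiction
      (iter-injective (turn a b) (trans (sym (iter-+ σ (turn a b) (q ∸ turn a b) a))
        (trans (cong (λ t → iter σ t a) (ℕₚ.m+[n∸m]≡n (ℕₚ.<⇒≤ p)))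
          (trans eq (sym (iter-turn ta≡tb))))))
      (below-degree (ℕₚ.m<n⇒0<n∸m p) (ℕₚ.≤-<-trans (ℕₚ.m∸n≤m q (turn a b)) q<))
      where
      ta≡tb : tail a ≡ tail b
      ta≡tb = trans (sym (tail-iter q a)) (cong tail eq)

    turn-injective : ∀ {a b c} → tail a ≡ tail b → tail a ≡ tail c → turn a b ≡ turn a c → b ≡ c
    turn-injective {a} p q eq = trans (sym (iter-turn p)) (trans (cong (λ t → iter σ t a) eq) (iter-turn q))

    period : ∀ {a b t} → tail a ≡ tail b → iter σ t a ≡ a → iter σ t b ≡ b
    period {a} {b} {t} eq pa = subst (λ x → iter σ t x ≡ x) (iter-turn eq)
      (trans (sym (iter-+ σ t k a)) (trans (cong (λ s → iter σ s a) (ℕₚ.+-comm t k))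
        (trans (iter-+ σ k t a) (cong (iter σ k) pa))))
      where
      k : ℕ
      k = turn a b

    degree≤ : ∀ {a b} → tail a ≡ tail b → degree b ≤ degree a
    degree≤ {a} {b} eq with degree a <? degree b
    ... | yes p = contradiction (period {t = degree a} eq (iter-degree a)) (below-degree (s≤s z≤n) p)
    ... | no ¬p = ℕₚ.≮⇒≥ ¬p

    degree-cong : ∀ {a b} → tail a ≡ tail b → degree a ≡ degree b
    degree-cong eq = ℕₚ.≤-antisym (degree≤ (sym eq)) (degree≤ eq)

    -- All comparisons at a vertex are made from one reference dart `β`; this lemma and `turn-wrap`
    -- change the reference. The second one covers the rotations from `x` to `y` that pass `β`.
    turn-fwd : ∀ β {x y} → tail β ≡ tail x → tail β ≡ tail y → turn β x ≤ turn β y → turn x y ≡ turn β y ∸ turn β x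
    turn-fwd β {x} {y} bx by le = turn-unique
      (ℕₚ.≤-<-trans (ℕₚ.m∸n≤m (turn β y) (turn β x)) (subst (turn β y <_) (degree-cong bx) (turn<degree by)))
      (trans (cong (iter σ (turn β y ∸ turn β x)) (sym (iter-turn bx)))
        (trans (sym (iter-∸ σ le β)) (iter-turn by)))

    turn-wrap : ∀ β {x y} → tail β ≡ tail x → tail β ≡ tail y → turn β y < turn β x →
                turn x y ≡ (degree β ∸ turn β x) + turn β y
    turn-wrap β {x} {y} bx by lt = turn-unique
      (subst ((degree β ∸ turn β x) + turn β y <_) (trans (ℕₚ.m∸n+n≡m (ℕₚ.<⇒≤ (turn<degree bx))) (degree-cong bx))
        (ℕₚ.+-monoʳ-< (degree β ∸ turn β x) lt))
      (trans (cong (iter σ ((degree β ∸ turn β x) + turn β y)) (sym (iter-turn bx)))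
        (trans (sym (iter-+ σ ((degree β ∸ turn β x) + turn β y) (turn β x) β))
          (trans (cong (λ t → iter σ t β) (rearrange (ℕₚ.<⇒≤ (turn<degree bx))))
            (trans (iter-+ σ (turn β y) (degree β) β) (trans (cong (iter σ (turn β y)) (iter-degree β)) (iter-turn by))))))
      where
      rearrange : turn β x ≤ degree β → (degree β ∸ turn β x) + turn β y + turn β x ≡ turn β y + degree β
      rearrange le = trans (cong (_+ turn β x) (ℕₚ.+-comm (degree β ∸ turn β x) (turn β y)))
        (trans (ℕₚ.+-assoc (turn β y) _ _) (cong (turn β y +_) (ℕₚ.m∸n+n≡m le)))

-- The contour of a contracted subpath, and how it certifies a crossing.

module Contour (G : PlaneGraph) where
  open PlaneGraph G
  open Trails G
  open Rotation G

  inZ-true : ∀ Z {x} → inZ G Z x ≡ true → ∃ λ z → z ∈ Z × edge G z ≡ edge G x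
  inZ-true (d ∷ Z) {x} eq with edge G d Finₚ.≟ edge G x
  ... | yes p = d , here refl , p
  ... | no _  with z , z∈ , p ← inZ-true Z {x} eq = z , there z∈ , p

  inZ-∈ : ∀ Z {x} → x ∈ Z → inZ G Z x ≡ true
  inZ-∈ (d ∷ Z) {x} x∈ with edge G d Finₚ.≟ edge G x | x∈
  ... | yes _ | _          = refl
  ... | no ¬p | here refl  = contradiction refl ¬p
  ... | no _  | there x∈Z  = inZ-∈ Z x∈Z

  module _ (Z : List D) (a : D) where

    -- The contour of Z, one dart at a time: darts off Z are visited and rotated past,
    -- darts on Z are followed to their other end.  The index counts the latter.
    data Creep : D → D → ℕ → Set where
      stop : ∀ {x} → Creep x x 0
      past : ∀ {x b s} → inZ G Z x ≡ false → x ≢ a → Creep (σ x) b s → Creep x b s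
      jump : ∀ {x b s} → inZ G Z x ≡ true → Creep (σ (rev x)) b s → Creep x b (suc s)

    creep-run : ∀ β k lo → (∀ t → lo ≤ t → t < k + lo → inZ G Z (iter σ t β) ≡ false × iter σ t β ≢ a) →
                Creep (iter σ lo β) (iter σ (k + lo) β) 0
    creep-run β zero    lo _ = stop
    creep-run β (suc k) lo h with o , ne ← h lo ℕₚ.≤-refl (s≤s (ℕₚ.m≤n+m lo k)) =
      past o ne (subst (λ t → Creep (σ (iter σ lo β)) (iter σ t β) 0) (ℕₚ.+-suc k lo)
        (creep-run β k (suc lo) λ t lo≤ t< → h t (ℕₚ.<⇒≤ lo≤) (subst (t <_) (ℕₚ.+-suc k lo) t<)))

    creep-++ : ∀ {x y z s s′} → Creep x y s → Creep y z s′ → Creep x z (s + s′)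
    creep-++ stop         c′ = c′
    creep-++ (past o n c) c′ = past o n (creep-++ c c′)
    creep-++ (jump i c)   c′ = jump i (creep-++ c c′)

    skip-out : ∀ K {x} → inZ G Z x ≡ false → skip G Z K x ≡ x
    skip-out zero    _ = refl
    skip-out (suc K) o rewrite o = refl

    -- The index of `Creep` bounds the jumps made before `skip` stops, so fuel beyond it has no
    -- effect.
    skip-fuel : ∀ {x b s} → Creep x b s → inZ G Z b ≡ false → ∀ K K′ → s ≤ K → s ≤ K′ → skip G Z K x ≡ skip G Z K′ x
    skip-fuel stop         o K K′ _ _ = trans (skip-out K o) (sym (skip-out K′ o))
    skip-fuel (past o _ _) _ K K′ _ _ = trans (skip-out K o) (sym (skip-out K′ o))
    skip-fuel (jump i c)   o (suc K) (suc K′) (s≤s p) (s≤s p′) rewrite i = skip-fuel c o K K′ p p′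

    f : D → D
    f = nextZ G Z

    -- Each `past` of the creep is one iteration of `nextZ`, and each `jump` is absorbed by `skip`.
    -- The bound `2 * m` is the fuel that `nextZ` provides.
    creep-skip : ∀ {x b s} → Creep x b s → inZ G Z b ≡ false → s ≤ 2 * m →
                 ∃ λ k → iter f k (skip G Z (2 * m) x) ≡ b × (∀ t → t < k → iter f t (skip G Z (2 * m) x) ≢ a)
    creep-skip stop o _ = 0 , skip-out (2 * m) o , λ _ ()
    creep-skip {b = b} (past {x} o ne c) ob s≤ with k , eq , ok ← creep-skip c ob s≤ =
      subst (λ y → ∃ λ k → iter f k y ≡ b × (∀ t → t < k → iter f t y ≢ a)) (sym (skip-out (2 * m) o))
        (suc k , trans (iter-shift f k x) eq ,
         λ { zero _ → ne ; (suc t) (s≤s t<) eq′ → ok t t< (trans (sym (iter-shift f t x)) eq′) })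
    creep-skip (jump {x} {b} {s} i c) ob s≤ with k , eq , ok ← creep-skip c ob (ℕₚ.<⇒≤ s≤) =
      k , trans (cong (iter f k) same) eq , λ t t< eq′ → ok t t< (trans (cong (iter f t) (sym same)) eq′)
      where
      unfold : ∀ K → s < K → skip G Z K x ≡ skip G Z (2 * m) (σ (rev x))
      unfold (suc K) (s≤s s≤K) rewrite i = skip-fuel c ob K (2 * m) s≤K (ℕₚ.<⇒≤ s≤)
      same : skip G Z (2 * m) x ≡ skip G Z (2 * m) (σ (rev x))
      same = unfold (2 * m) s≤

    Reach : D → D → ℕ → Set
    Reach x b k = 0 < k × iter f k x ≡ b × (∀ t → 0 < t → t ≤ k → iter f t x ≢ a)

    creep⇒reach : ∀ {x b s} → Creep (σ x) b s → inZ G Z b ≡ false → b ≢ a → s ≤ 2 * m → ∃ (Reach x b)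
    creep⇒reach {x} c ob b≢a s≤ with k , eq , ok ← creep-skip c ob s≤ =
      suc k , s≤s z≤n , trans (iter-shift f k x) eq , avoid
      where
      avoid : ∀ t → 0 < t → t ≤ suc k → iter f t x ≢ a
      avoid (suc t) _ (s≤s t≤k) eq′ with ℕₚ.m≤n⇒m<n∨m≡n t≤k
      ... | inj₁ t<k  = ok t t<k (trans (sym (iter-shift f t x)) eq′)
      ... | inj₂ refl = b≢a (trans (sym eq) (trans (sym (iter-shift f t x)) eq′))

    reach-+ : ∀ {x y z j k} → Reach x y j → Reach y z k → Reach x z (k + j)
    reach-+ {x} {y} {z} {j} {k} (0<j , jy , oj) (0<k , kz , ok) =
      ℕₚ.≤-trans 0<k (ℕₚ.m≤m+n k j) , trans (iter-+ f k j x) (trans (cong (iter f k) jy) kz) , avoid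
      where
      avoid : ∀ t → 0 < t → t ≤ k + j → iter f t x ≢ a
      avoid t 0<t t≤ eq with t ≤? j
      ... | yes t≤j = oj t 0<t t≤j eq
      ... | no t≰j  = ok (t ∸ j) (ℕₚ.m<n⇒0<n∸m j<t) (subst (t ∸ j ≤_) (ℕₚ.m+n∸n≡m k j) (ℕₚ.∸-monoˡ-≤ j t≤))
        (trans (cong (iter f (t ∸ j)) (sym jy)) (trans (sym (iter-∸ f (ℕₚ.<⇒≤ j<t) x)) eq))
        where j<t = ℕₚ.≰⇒> t≰j

    reach⇒cyc : ∀ {b c d i j k} → Reach a b i → Reach b c j → Reach c d k → CycOrd G f a b c d
    reach⇒cyc {i = i} {j} {k} r s t with rs ← reach-+ r s with rst ← reach-+ rs t =
      i , j + i , k + (j + i) , proj₁ r , ℕₚ.+-monoˡ-< i (proj₁ s) , ℕₚ.+-monoˡ-< (j + i) (proj₁ t) ,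
      proj₁ (proj₂ r) , proj₁ (proj₂ rs) , proj₁ (proj₂ rst) , proj₂ (proj₂ rst)

  trail-length : ∀ {L} → Trail L → length L ≤ m
  trail-length {L} t = ℕₚ.≤-trans (ℕₚ.≤-reflexive (sym (Listₚ.length-map (edge G) L)))
    (ℕₚ.≤-trans (⊆⇒length≤ (trail-edges t) (λ {x} _ → Memₚ.∈-allFin x)) (ℕₚ.≤-reflexive (Listₚ.length-tabulate id)))

  module _ (P : Path G) {A B Zs X : List D} {e z e′ l : D} (at : At P A e (z ∷ Zs ++ e′ ∷ B)) (lastZ : z ∷ Zs ≡ X ++ l ∷ [])
           {g g′ : D} (tg : tail z ≡ hd g) (tg′ : tail g′ ≡ hd l)
           (e<g : turn z (rev e) < turn z (rev g)) (e′<g′ : turn (rev l) e′ < turn (rev l) g′) where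

    private
      Z = z ∷ Zs
      a = rev e
      tG = turn z (rev g)

    abstract
     private
       onE : On P e
       onE = At⇒On P {A} at

       restE : rest P e ≡ Z ++ e′ ∷ B
       restE = rest-At P at

       On-Z : ∀ {x} → x ∈ Z → On P x
       On-Z {x} x∈ = On-rest P {e} {x} onE (subst (x ∈_) (sym restE) (Memₚ.∈-++⁺ˡ x∈))

       inZ⇒On : ∀ {x} → inZ G Z x ≡ true → On P x
       inZ⇒On {x} i with y , y∈ , eq ← inZ-true Z {x} i = subst (_∈ edges G P) eq (On-Z y∈)

       off : ∀ {x} → ¬ On P x → inZ G Z x ≡ false
       off {x} ¬on with inZ G Z x in eq
       ... | true  = contradiction (inZ⇒On {x} eq) ¬on
       ... | false = refl

       onE′ : On P e′
       onE′ = On-rest P {e} onE (subst (e′ ∈_) (sym restE) (Memₚ.∈-insert Z))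

       suffix : ∀ Y {y W} → Z ≡ Y ++ y ∷ W → rest P y ≡ W ++ e′ ∷ B
       suffix Y {y} {W} eq = rest-At P (reassoc at)
         where
         shape : A ++ e ∷ Z ++ e′ ∷ B ≡ (A ++ e ∷ Y) ++ y ∷ W ++ e′ ∷ B
         shape = trans (cong (λ k → A ++ e ∷ k ++ e′ ∷ B) eq)
           (trans (cong (λ k → A ++ e ∷ k) (Listₚ.++-assoc Y (y ∷ W) (e′ ∷ B)))
             (sym (Listₚ.++-assoc A (e ∷ Y) _)))
         reassoc : At P A e (Z ++ e′ ∷ B) → At P (A ++ e ∷ Y) y (W ++ e′ ∷ B)
         reassoc (inj₁ p) = inj₁ (trans p shape)
         reassoc (inj₂ p) = inj₂ (trans p shape)

       outE′ : inZ G Z e′ ≡ false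
       outE′ with inZ G Z e′ in eq
       ... | false = refl
       ... | true  with y , y∈ , p ← inZ-true Z {e′} eq with Y , W , q ← Memₚ.∈-∃++ y∈ =
         contradiction (sym p) (rest-edge≢ P {y} (On-Z y∈) (subst (e′ ∈_) (sym (suffix Y q)) (Memₚ.∈-insert W)))

       tailZ : tail z ≡ hd e
       tailZ = rest-tail P {e} onE restE

       -- At the first vertex of Z the path P occupies only z and rev e.
       off-first : ∀ t → turn z (rev e) < t → t < degree z → ¬ On P (iter σ t z)
       off-first t lo hi on with rest-back P {e} onE restE
       ... | B′ , back with two-darts P {z} {iter σ t z} (On-Z (here refl)) on (sym (tail-iter t z))
       ... | inj₁ eq = below-degree (ℕₚ.≤-<-trans z≤n lo) hi eq
       ... | inj₂ (_ , eq) = ℕₚ.<⇒≢ lo (turn-unique hi (sym (Listₚ.∷-injectiveˡ (trans (sym back) eq))))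

       off-between : ∀ {y x W} → On P y → rest P y ≡ x ∷ W → ∀ t → 0 < t → t < degree (rev y) → t ≢ turn (rev y) x →
                     ¬ On P (iter σ t (rev y))
       off-between {y} {x} onY ry t lo hi t≢ on
         with two-darts P {rev y} {iter σ t (rev y)} onY on (sym (tail-iter t (rev y)))
       ... | inj₁ eq = below-degree lo hi eq
       ... | inj₂ (_ , eq) = t≢ (sym (turn-unique hi
               (sym (Listₚ.∷-injectiveˡ (trans (trans (sym ry) (cong (rest P) (sym (rev-rev y)))) eq)))))

       ≢a : ∀ {x} → ¬ On P x → x ≢ a
       ≢a ¬on refl = ¬on onE

       to-next : ∀ {y x W} → On P y → rest P y ≡ x ∷ W → Creep Z a (σ (rev y)) x 0
       to-next {y} {x} {W} onY ry with turn (rev y) x in t≡ | iter-turn {rev y} {x} (sym (rest-tail P {y} onY ry)) | turn<degree {rev y} {x} (sym (rest-tail P {y} onY ry))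
       ... | zero | p | _ = contradiction (trans (cong (edge G) (sym p)) refl) (rest-edge≢ P {y} onY (subst (x ∈_) (sym ry) (here refl)))
       ... | suc k | p | q = subst (λ w → Creep Z a (σ (rev y)) w 0)
               (trans (cong (λ t → iter σ t (rev y)) (ℕₚ.+-comm k 1)) p)
               (creep-run Z a (rev y) k 1 λ t lo hi → offs t lo (subst (t <_) (ℕₚ.+-comm k 1) hi))
         where
         offs : ∀ t → 1 ≤ t → t < suc k → inZ G Z (iter σ t (rev y)) ≡ false × iter σ t (rev y) ≢ a
         offs t lo hi = off {iter σ t (rev y)} no-on , ≢a {iter σ t (rev y)} no-on
           where
           no-on : ¬ On P (iter σ t (rev y))
           no-on = off-between {y} onY ry t lo (ℕₚ.<-trans hi q) (λ eq → ℕₚ.<⇒≢ hi (trans eq t≡))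

       to-end : ∀ {y} W → On P y → rest P y ≡ W ++ e′ ∷ B → (∀ {x} → x ∈ W → inZ G Z x ≡ true) →
                Creep Z a (σ (rev y)) e′ (length W)
       to-end {y} []      onY ry _ = to-next {y} onY ry
       to-end {y} (x ∷ W) onY ry h with rx , onX ← rest-∷ P {y} onY ry =
         creep-++ Z a (to-next {y} onY ry) (jump (h (here refl)) (to-end {x} W onX rx (h ∘ there)))

       tail-revG : tail z ≡ tail (rev g)
       tail-revG = tg
       tG< : tG < degree z
       tG< = turn<degree tail-revG

       between : ∀ β {x y} → turn β x < turn β y → tail β ≡ tail x → tail β ≡ tail y →
                 (∀ t → turn β x < t → t < turn β y → inZ G Z (iter σ t β) ≡ false × iter σ t β ≢ a) →
                 Creep Z a (σ x) y 0
       between β {x} {y} lt bx by h =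
         subst (λ w → Creep Z a w y 0) (cong σ (iter-turn bx))
           (subst (λ w → Creep Z a (iter σ (suc tx) β) w 0) (trans (cong (λ t → iter σ t β) (ℕₚ.m∸n+n≡m lt)) (iter-turn by))
             (creep-run Z a β (turn β y ∸ suc tx) (suc tx) λ t lo hi → h t lo (subst (t <_) (ℕₚ.m∸n+n≡m lt) hi)))
         where
         tx : ℕ
         tx = turn β x

       off-revG : ¬ On P (rev g)
       off-revG = subst (λ x → ¬ On P x) (iter-turn tail-revG) (off-first tG e<g tG<)

       onL : On P l
       onL = On-Z (subst (l ∈_) (sym lastZ) (Memₚ.∈-insert X))

       restL : rest P l ≡ e′ ∷ B
       restL = suffix X lastZ

       tE′ : tail (rev l) ≡ tail e′
       tE′ = sym (rest-tail P {l} onL restL)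

       tG′< : turn (rev l) g′ < degree (rev l)
       tG′< = turn<degree (sym tg′)

       off-g′ : ¬ On P g′
       off-g′ = subst (λ x → ¬ On P x) (iter-turn (sym tg′))
         (off-between {l} onL restL (turn (rev l) g′) (ℕₚ.≤-<-trans z≤n e′<g′) tG′< (ℕₚ.<⇒≢ e′<g′ ∘ sym))

       seg₁ : Creep Z a (σ (rev e)) (rev g) 0
       seg₁ = between z e<g tailZ tail-revG λ t lo hi → let o = off-first t lo (ℕₚ.<-trans hi tG<) in off {iter σ t z} o , ≢a {iter σ t z} o

       seg₂ : Creep Z a (σ (rev g)) e′ (length Z)
       seg₂ = creep-++ Z a (toZ (degree z ∸ suc tG) (ℕₚ.m∸n+n≡m tG<))
                (jump (inZ-∈ Z (here refl)) (to-end {z} Zs (On-Z (here refl)) (suffix [] refl) (inZ-∈ Z ∘ there)))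
         where
         toZ : ∀ k → k + suc tG ≡ degree z → Creep Z a (σ (rev g)) z 0
         toZ k eq = subst (λ w → Creep Z a w z 0) (cong σ (iter-turn tail-revG))
           (subst (λ w → Creep Z a (iter σ (suc tG) z) w 0) (trans (cong (λ t → iter σ t z) eq) (iter-degree z))
             (creep-run Z a z k (suc tG) λ t lo hi →
               let o = off-first t (ℕₚ.<-trans e<g lo) (subst (t <_) eq hi) in off {iter σ t z} o , ≢a {iter σ t z} o))

       seg₃ : Creep Z a (σ e′) g′ 0
       seg₃ = between (rev l) e′<g′ tE′ (sym tg′) λ t lo hi →
         let o = off-between {l} onL restL t (ℕₚ.≤-<-trans z≤n lo) (ℕₚ.<-trans hi tG′<) (ℕₚ.<⇒≢ lo ∘ sym) in off {iter σ t (rev l)} o , ≢a {iter σ t (rev l)} o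

       -- A trail uses each edge at most once, so the fuel of `nextZ` suffices for one jump per dart
       -- of `Z`.
       lenZ : length Z ≤ 2 * m
       lenZ = ℕₚ.≤-trans short (ℕₚ.m≤m+n m _)
         where
         short : length Z ≤ m
         short = ℕₚ.≤-trans (ℕₚ.≤-trans (Listₚ.length-++-≤ˡ Z {e′ ∷ B}) (ℕₚ.≤-trans (ℕₚ.n≤1+n _) (Listₚ.length-++-≤ʳ (e ∷ Z ++ e′ ∷ B) {A})))
           (trail-length (At⇒trail P at))

    -- The turn hypotheses say that `g` joins `Z` from the left of `P` and `g′` leaves to the right.
    -- Starting at `rev e`, the contour runs clockwise at the first vertex to `rev g`, then on to
    -- `z` and along the left side of `Z` to `e′`, and clockwise at the last vertex to `g′`. It does
    -- not meet `rev e` again, because `P` is a trail and occupies only two darts at each vertex of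
    -- `Z`.
    contour-crossing : CycOrd G (nextZ G Z) (rev e) (rev g) e′ g′ × edge G e ≢ edge G g × edge G e′ ≢ edge G g′
    contour-crossing
      with i , r₁ ← creep⇒reach Z a seg₁ (off {rev g} off-revG) (≢a {rev g} off-revG) z≤n
      with j , r₂ ← creep⇒reach Z a seg₂ outE′ (λ eq → rest-edge≢ P {e} onE (subst (e′ ∈_) (sym restE) (Memₚ.∈-insert Z)) (cong (edge G) eq)) lenZ
      with k , r₃ ← creep⇒reach Z a seg₃ (off {g′} off-g′) (≢a {g′} off-g′) z≤n =
      reach⇒cyc Z a r₁ r₂ r₃ ,
      (λ eq → off-revG (subst (_∈ edges G P) eq onE)) , (λ eq → off-g′ (subst (_∈ edges G P) eq onE′))

-- The left-to-right order of the paths along a dart.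

module Strands (G : PlaneGraph) {q : ℕ} (𝒬 : Fin q → Path G)
               (uncrossed : ∀ i j → i ≢ j → ¬ Cross G (𝒬 i) (𝒬 j))
               (proper : ∀ i j d → i ≢ j → Trails.On G (𝒬 i) d → Trails.On G (𝒬 j) d → Trails.rest G (𝒬 i) d ≢ []) where
  open PlaneGraph G
  open Trails G
  open Rotation G
  open Contour G

  -- Two continuations of d are compared by the side on which they separate.
  data Lex : D → List D → List D → Set where
    here  : ∀ {d x y xs ys} → turn (rev d) x < turn (rev d) y → Lex d (x ∷ xs) (y ∷ ys)
    there : ∀ {d x xs ys} → Lex x xs ys → Lex d (x ∷ xs) (x ∷ ys)

  On′ : Fin q → D → Set
  On′ i d = On (𝒬 i) d

  rst : Fin q → D → List D
  rst i = rest (𝒬 i)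

  infix 4 _<[_]_
  _<[_]_ : Fin q → D → Fin q → Set
  i <[ d ] j = Lex d (rst i d) (rst j d)

  lex? : ∀ d xs ys → Dec (Lex d xs ys)
  lex? d []       ys = no λ ()
  lex? d (x ∷ xs) [] = no λ ()
  lex? d (x ∷ xs) (y ∷ ys) with turn (rev d) x <? turn (rev d) y
  ... | yes lt = yes (here lt)
  ... | no ¬lt with x ≟ᵈ y
  ... | no x≢y = no λ { (here lt) → ¬lt lt ; (there _) → x≢y refl }
  ... | yes refl with lex? x xs ys
  ... | yes l = yes (there l)
  ... | no ¬l = no λ { (here lt) → ¬lt lt ; (there l) → ¬l l }

  lex-irrefl : ∀ {d xs} → ¬ Lex d xs xs
  lex-irrefl (here lt) = ℕₚ.<-irrefl refl lt
  lex-irrefl (there l) = lex-irrefl l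

  lex-trans : ∀ {d xs ys zs} → Lex d xs ys → Lex d ys zs → Lex d xs zs
  lex-trans (here p)  (here p′)  = here (ℕₚ.<-trans p p′)
  lex-trans (here p)  (there _)  = here p
  lex-trans (there _) (here p)   = here p
  lex-trans (there l) (there l′) = there (lex-trans l l′)

  -- Exposes the common prefix `W` and the two darts at which the continuations separate. The last
  -- common dart `l` is `d` itself when `W` is empty.
  lex-split : ∀ {d xs ys} → WalkFrom G (hd d) ys → Lex d xs ys →
    ∃ λ W → ∃ λ x → ∃ λ xs′ → ∃ λ y → ∃ λ ys′ → ∃ λ X → ∃ λ l →
    xs ≡ W ++ x ∷ xs′ × ys ≡ W ++ y ∷ ys′ × d ∷ W ≡ X ++ l ∷ [] × turn (rev l) x < turn (rev l) y × tail y ≡ hd l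
  lex-split {d} (cons t≡ _) (here lt) = [] , _ , _ , _ , _ , [] , d , refl , refl , refl , lt , t≡
  lex-split {d} (cons _ w) (there {x = x} l)
    with W , x , _ , y , _ , X , k , p , q , r , lt , t≡ ← lex-split w l =
    _ ∷ W , x , _ , y , _ , d ∷ X , k , cong (_ ∷_) p , cong (_ ∷_) q , cong (d ∷_) r , lt , t≡

  abstract
    -- `proper` excludes that one continuation ends while the paths still run together, and a dart
    -- at a vertex is determined by its turn. So the continuations must separate, to one side or the
    -- other.
    <-total : ∀ {i j d} → i ≢ j → On′ i d → On′ j d → i <[ d ] j ⊎ j <[ d ] i
    <-total {i} {j} {d} i≢j oi oj = go (rst i d) d refl oi oj
      where
      go : ∀ xs d → rst i d ≡ xs → On′ i d → On′ j d → Lex d xs (rst j d) ⊎ Lex d (rst j d) xs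
      go []       d eq oi oj = contradiction eq (proper i j d i≢j oi oj)
      go (x ∷ xs) d eq oi oj with rst j d in eq′
      ... | []     = contradiction eq′ (proper j i d (i≢j ∘ sym) oj oi)
      ... | y ∷ ys with ℕₚ.<-cmp (turn (rev d) x) (turn (rev d) y)
      ... | tri< lt _ _ = inj₁ (here lt)
      ... | tri> _ _ gt = inj₂ (here gt)
      ... | tri≈ _ t≡ _
        with refl ← turn-injective {rev d} {x} {y} (sym (rest-tail (𝒬 i) {d} oi eq)) (sym (rest-tail (𝒬 j) {d} oj eq′)) t≡
        with rx , ox ← rest-∷ (𝒬 i) {d} oi eq | ry , oy ← rest-∷ (𝒬 j) {d} oj eq′
        with go xs x rx ox oy
      ... | inj₁ l = inj₁ (there (subst (Lex x xs) ry l))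
      ... | inj₂ l = inj₂ (there (subst (λ k → Lex x k xs) ry l))

    -- Reversal exchanges left and right, so preceding `j` in both directions puts `i` on different
    -- sides of `j` at the two ends of the common stretch. Read along `d`, this stretch consists of
    -- the reversed prefix `W′` shared along `rev d`, then `d`, then the prefix `W` shared along
    -- `d`.
    crossing : ∀ {i j d A B} → Path.darts (𝒬 i) ≡ A ++ d ∷ B → On′ j d → i <[ d ] j → i <[ rev d ] j → Cross G (𝒬 i) (𝒬 j)
    crossing {i} {j} {d} {A} {B} eqi oj l l′
      with A′ , B′ , atj ← On⇒At (𝒬 j) {d} oj
      with W , x , xs , y , ys , X , k , p , q , r , lt , ty ←
             lex-split (rest-walk (𝒬 j) {d} oj) l
      with W′ , x′ , xs′ , y′ , ys′ , X′ , k′ , p′ , q′ , r′ , lt′ , ty′ ←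
             lex-split (rest-walk (𝒬 j) {rev d} oj) l′
      = assemble atj (contour-crossing (𝒬 i) {rv xs′} {xs} {rv X′ ++ W} {rv W′ ++ X} {rev x′} {rev k′} {x} {k}
          (inj₁ listᵢ) lastZ {rev y′} {y} (sym (trans (hd-rev y′) ty′)) ty
          (subst₂ (λ u v → turn (rev k′) u < turn (rev k′) v) (sym (rev-rev x′)) (sym (rev-rev y′)) lt′) lt)
      where
      Z : List D
      Z = rev k′ ∷ rv X′ ++ W
      Z≡ : rv W′ ++ d ∷ W ≡ Z
      Z≡ = trans (sym (Listₚ.++-assoc (rv W′) (d ∷ []) W)) (cong (_++ W)
        (trans (cong (λ z → rv W′ ++ z ∷ []) (sym (rev-rev d))) (trans (sym (rv-∷ (rev d) W′)) (trans (cong rv r′) (rv-++ X′ (k′ ∷ []))))))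
      lastZ : Z ≡ (rv W′ ++ X) ++ k ∷ []
      lastZ = trans (sym Z≡) (trans (cong (rv W′ ++_) r) (sym (Listₚ.++-assoc (rv W′) X (k ∷ []))))
      shape : ∀ {A B x x′ xs xs′} → rv A ≡ W′ ++ x′ ∷ xs′ → B ≡ W ++ x ∷ xs → A ++ d ∷ B ≡ rv xs′ ++ rev x′ ∷ Z ++ x ∷ xs
      shape {A} {B} {x} {x′} {xs} {xs′} a b = trans (cong₂ (λ u v → u ++ d ∷ v) a′ b)
        (trans (Listₚ.++-assoc (rv xs′) (rev x′ ∷ rv W′) (d ∷ W ++ x ∷ xs))
          (cong (λ u → rv xs′ ++ rev x′ ∷ u) (trans (sym (Listₚ.++-assoc (rv W′) (d ∷ W) (x ∷ xs))) (cong (_++ x ∷ xs) Z≡))))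
        where
        a′ : A ≡ rv xs′ ++ rev x′ ∷ rv W′
        a′ = trans (sym (rv-rv A)) (trans (cong rv a) (rv-split W′ x′ xs′))
      listᵢ : Path.darts (𝒬 i) ≡ rv xs′ ++ rev x′ ∷ Z ++ x ∷ xs
      listᵢ = trans eqi (shape (trans (sym (rest-At (𝒬 i) (At-rev (𝒬 i) {A} (inj₁ eqi)))) p′) (trans (sym (rest-At (𝒬 i) (inj₁ eqi))) p))
      listⱼ : A′ ++ d ∷ B′ ≡ rv ys′ ++ rev y′ ∷ Z ++ y ∷ ys
      listⱼ = shape (trans (sym (rest-At (𝒬 j) (At-rev (𝒬 j) {A′} atj))) q′) (trans (sym (rest-At (𝒬 j) atj)) q)
      heads : hd (rev x′) ≡ hd (rev y′)
      heads = trans (sym (rest-tail (𝒬 i) {rev x′} onx restx)) (sym (trans (hd-rev y′) ty′))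
        where
        onx : On′ i (rev x′)
        onx = At⇒On (𝒬 i) {rv xs′} (inj₁ listᵢ)
        restx : rst i (rev x′) ≡ rev k′ ∷ (rv X′ ++ W) ++ x ∷ xs
        restx = rest-At (𝒬 i) {rv xs′} (inj₁ listᵢ)
      assemble : At (𝒬 j) A′ d B′ → CycOrd G (nextZ G Z) (rev (rev x′)) (rev (rev y′)) x y × edge G (rev x′) ≢ edge G (rev y′) × edge G x ≢ edge G y → Cross G (𝒬 i) (𝒬 j)
      assemble (inj₁ eqj) (cyc , e≢ , e′≢) = inj₁ (rv xs′ , rev x′ , Z , x , xs , rv ys′ , rev y′ , y , ys , listᵢ , trans eqj listⱼ , heads , e≢ , e′≢ , inj₁ cyc)
      assemble (inj₂ eqj) (cyc , e≢ , e′≢) = inj₂ (rv xs′ , rev x′ , Z , x , xs , rv ys′ , rev y′ , y , ys , listᵢ , trans eqj listⱼ , heads , e≢ , e′≢ , inj₁ cyc)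

    <-rev : ∀ {i j d} → i ≢ j → On′ i d → On′ j d → i <[ d ] j → j <[ rev d ] i
    <-rev {i} {j} {d} i≢j oi oj l with <-total {i} {j} {rev d} i≢j oi oj
    ... | inj₂ l′ = l′
    ... | inj₁ l′ with A , B , at ← On⇒At (𝒬 i) {d} oi with at
    ... | inj₁ eq = contradiction (crossing {A = A} eq oj l l′) (uncrossed i j i≢j)
    ... | inj₂ eq with At-rev (𝒬 i) {A} {d} {B} (inj₂ eq)
    -- `crossing` wants the dart in the direction in which `𝒬 i` is listed. Here that is `rev d`, so
    -- the two inequalities exchange their roles.
    ... | inj₁ eq′ = contradiction (crossing {A = rv B} {rv A} eq′ oj l′ (subst (λ x → i <[ x ] j) (sym (rev-rev d)) l)) (uncrossed i j i≢j)
    ... | inj₂ eq′ = contradiction (sym (proj₁ (proj₂ (split-unique (edge G) (trail-edges (trail-rv (trail (𝒬 i)))) A (rv B) eq eq′ refl)))) (rev≢ d)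

    <-unfold : ∀ {i j a x y xs ys} → rst i (rev a) ≡ x ∷ xs → rst j (rev a) ≡ y ∷ ys → On′ i a → On′ j a →
               i <[ rev a ] j → turn a x < turn a y ⊎ x ≡ y × i <[ x ] j
    <-unfold {i} {j} {a} {x} {y} p q oi oj l with rst i (rev a) in p′ | rst j (rev a) in q′ | l
    ... | _ ∷ _ | _ ∷ _ | here lt with refl , _ ← Listₚ.∷-injective p | refl , _ ← Listₚ.∷-injective q =
      inj₁ (subst (λ b → turn b x < turn b y) (rev-rev a) lt)
    ... | z ∷ zs | _ ∷ zs′ | there l′ with refl , _ ← Listₚ.∷-injective p | refl , _ ← Listₚ.∷-injective q =
      inj₂ (refl , subst₂ (Lex z) (sym (proj₁ (rest-∷ (𝒬 i) {rev a} oi p′))) (sym (proj₁ (rest-∷ (𝒬 j) {rev a} oj q′))) l′)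

    ℓ : D → ℕ
    ℓ d = count (λ i → On? (𝒬 i) d)

    before? : ∀ d i j → Dec (On′ j d × j <[ d ] i)
    before? d i j = On? (𝒬 j) d ×-dec lex? d (rst j d) (rst i d)

    rk : D → Fin q → ℕ
    rk d i = count (before? d i)

    ℓ-def : ∀ d → ℓ d ≡ count (λ i → On? (𝒬 i) d)
    ℓ-def d = refl

    ℓ-rev : ∀ d → ℓ (rev d) ≡ ℓ d
    ℓ-rev d = refl

    rk-mono : ∀ {d i j} → On′ i d → i <[ d ] j → rk d i < rk d j
    rk-mono {d} {i} {j} oi i<j = sum-mono-< (λ h → 𝟙-mono (before? d i h) (before? d j h) λ { (oh , h<i) → oh , lex-trans h<i i<j })
      i (subst₂ _<_ (sym (𝟙-no (before? d i i) (lex-irrefl ∘ proj₂))) (sym (𝟙-yes (before? d j i) (oi , i<j))) (s≤s z≤n))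

    rk<ℓ : ∀ {d i} → On′ i d → rk d i < ℓ d
    rk<ℓ {d} {i} oi = sum-mono-< (λ h → 𝟙-mono (before? d i h) (On? (𝒬 h) d) proj₁)
      i (subst₂ _<_ (sym (𝟙-no (before? d i i) (lex-irrefl ∘ proj₂))) (sym (𝟙-yes (On? (𝒬 i) d) oi)) (s≤s z≤n))

    rk-reflect : ∀ {d i j} → On′ i d → On′ j d → rk d i < rk d j → i <[ d ] j
    rk-reflect {d} {i} {j} oi oj lt with i Finₚ.≟ j
    ... | yes refl = contradiction lt (ℕₚ.<-irrefl refl)
    ... | no i≢j with <-total {i} {j} {d} i≢j oi oj
    ... | inj₁ l = l
    ... | inj₂ l = contradiction (rk-mono {d} {j} {i} oj l) (ℕₚ.<-asym lt)

    rk-injective : ∀ {d i j} → On′ i d → On′ j d → rk d i ≡ rk d j → i ≡ j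
    rk-injective {d} {i} {j} oi oj eq with i Finₚ.≟ j
    ... | yes i≡j = i≡j
    ... | no i≢j with <-total {i} {j} {d} i≢j oi oj
    ... | inj₁ l = contradiction eq (ℕₚ.<⇒≢ (rk-mono {d} {i} {j} oi l))
    ... | inj₂ l = contradiction (sym eq) (ℕₚ.<⇒≢ (rk-mono {d} {j} {i} oj l))

    -- By `<-rev` the order along `rev d` is the opposite one, so each other path on `d` is counted
    -- in exactly one of the two ranks; the remaining 1 is `i` itself.
    rk-rev : ∀ {d i} → On′ i d → suc (rk d i + rk (rev d) i) ≡ ℓ d
    rk-rev {d} {i} oi = trans (ℕₚ.+-comm 1 _) (trans (cong₂ _+_ (sym (sum-distrib-+ (𝟙 ∘ before? d i) (𝟙 ∘ before? (rev d) i))) (sym (sum-≟ i)))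
      (trans (sym (sum-distrib-+ (λ h → 𝟙 (before? d i h) + 𝟙 (before? (rev d) i h)) (λ h → 𝟙 (i Finₚ.≟ h)))) (sum-cong pointwise)))
      where
      other : ∀ h → i ≢ h → Dec (On′ h d) → 𝟙 (before? d i h) + 𝟙 (before? (rev d) i h) ≡ 𝟙 (On? (𝒬 h) d)
      other h i≢h (no ¬oh) = trans (cong₂ _+_ (𝟙-no (before? d i h) (¬oh ∘ proj₁)) (𝟙-no (before? (rev d) i h) (¬oh ∘ proj₁)))
        (sym (𝟙-no (On? (𝒬 h) d) ¬oh))
      other h i≢h (yes oh) with <-total {h} {i} {d} (i≢h ∘ sym) oh oi
      ... | inj₁ l = trans (cong₂ _+_ (𝟙-yes (before? d i h) (oh , l))
              (𝟙-no (before? (rev d) i h) λ { (_ , l′) → lex-irrefl (lex-trans l′ (<-rev {h} {i} {d} (i≢h ∘ sym) oh oi l)) }))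
              (sym (𝟙-yes (On? (𝒬 h) d) oh))
      ... | inj₂ l = trans (cong₂ _+_ (𝟙-no (before? d i h) λ { (_ , l′) → lex-irrefl (lex-trans l l′) })
              (𝟙-yes (before? (rev d) i h) (oh , <-rev {i} {h} {d} i≢h oi oh l)))
              (sym (𝟙-yes (On? (𝒬 h) d) oh))
      pointwise : ∀ h → 𝟙 (before? d i h) + 𝟙 (before? (rev d) i h) + 𝟙 (i Finₚ.≟ h) ≡ 𝟙 (On? (𝒬 h) d)
      pointwise h with i Finₚ.≟ h
      ... | yes refl rewrite 𝟙-no (before? d i i) (lex-irrefl ∘ proj₂) | 𝟙-no (before? (rev d) i i) (lex-irrefl ∘ proj₂) = sym (𝟙-yes (On? (𝒬 i) d) oi)
      ... | no i≢h = trans (ℕₚ.+-identityʳ _) (other h i≢h (On? (𝒬 h) d))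

    -- The ranks map the `ℓ d` paths on `d` injectively into `ℓ d` values, hence onto them.
    strand-at : ∀ d r → r < ℓ d → ∃ λ i → On′ i d × rk d i ≡ r
    strand-at d r r<ℓ = lookup users (proj₁ hit) , onk (proj₁ hit) ,
      trans (sym (Finₚ.toℕ-fromℕ< (bound (proj₁ hit)))) (trans (cong toℕ (proj₂ hit)) (Finₚ.toℕ-fromℕ< (subst (r <_) (sym len) r<ℓ)))
      where
      users : List (Fin q)
      users = filter (λ i → On? (𝒬 i) d) (allFin q)
      len : length users ≡ ℓ d
      len = count-filter (λ i → On? (𝒬 i) d)
      onk : ∀ k → On′ (lookup users k) d
      onk k = proj₂ (Memₚ.∈-filter⁻ (λ i → On? (𝒬 i) d) {xs = allFin q} (Memₚ.∈-lookup k))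
      bound : ∀ k → rk d (lookup users k) < length users
      bound k = subst (rk d (lookup users k) <_) (sym len) (rk<ℓ {d} (onk k))
      ranks : Fin (length users) → Fin (length users)
      ranks k = fromℕ< (bound k)
      inj : ∀ i j → ranks i ≡ ranks j → i ≡ j
      inj i j eq = lookup-injective (Uniqueₚ.filter⁺ (λ i → On? (𝒬 i) d) (Uniqueₚ.allFin⁺ q)) i j
        (rk-injective {d} (onk i) (onk j) (trans (sym (Finₚ.toℕ-fromℕ< (bound i))) (trans (cong toℕ eq) (Finₚ.toℕ-fromℕ< (bound j)))))
      hit : ∃ λ k → ranks k ≡ fromℕ< (subst (r <_) (sym len) r<ℓ)
      hit = injective⇒surjective ranks inj (fromℕ< (subst (r <_) (sym len) r<ℓ))

-- Noncrossing matchings and a redundant identification.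

-- Positions 0, …, D - 1 are matched without crossings and the D + 1 gaps around them are
-- labelled.  If every position other than the last identifies the gap after it with the gap
-- before its partner whenever the partner comes first, then every position does.
module Noncrossing {A L : Set} (num : A → ℕ) (D : ℕ) (num<D : ∀ a → num a < D)
                   (onto : ∀ x → x < D → ∃ λ a → num a ≡ x)
                   (part : A → A) (part-cong : ∀ a b → num a ≡ num b → num (part a) ≡ num (part b))
                   (part-part : ∀ a → num (part (part a)) ≡ num a)
                   (noncross : ∀ a c → num a < num c → num c < num (part a) → num (part a) < num (part c) → ⊥)
                   (Λ : ℕ → L) (wrap : Λ D ≡ Λ 0)
                   (close : ∀ a → num (part a) ≤ num a → suc (num a) < D → Λ (suc (num a)) ≡ Λ (num (part a))) where

  private
    Closed : ℕ → ℕ → Set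
    Closed lo b = ∀ a → lo ≤ num a → num a < b → lo ≤ num (part a) × num (part a) < b

    part-swap : ∀ a c → num (part c) ≡ num a → num c ≡ num (part a)
    part-swap a c eq = trans (sym (part-part c)) (part-cong (part c) a eq)

    -- Descends from `g` to `lo`. The position just below `g` has its partner at or below itself,
    -- because the interval from `g` to `b` is closed. So `close` leads to the gap before that
    -- partner, and noncrossingness keeps the interval from there to `b` closed. The argument `n`
    -- only bounds the recursion.
    walk : ∀ lo b → b < D → Closed lo b → ∀ n g → g ≤ n → lo ≤ g → g ≤ b → Closed g b → Λ g ≡ Λ lo
    walk lo b b<D clo n g g≤n lo≤g g≤b cg with ℕₚ.m≤n⇒m<n∨m≡n lo≤g
    ... | inj₂ refl = refl
    walk lo b b<D clo (suc n) (suc x) (s≤s x≤n) lo≤g g≤b cg | inj₁ (s≤s lo≤x)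
      with a , refl ← onto x (ℕₚ.<-trans g≤b b<D) =
      trans (close a πx≤x (ℕₚ.≤-<-trans g≤b b<D))
        (walk lo b b<D clo n (num (part a)) (ℕₚ.≤-trans πx≤x x≤n) (proj₁ cla) (ℕₚ.<⇒≤ (proj₂ cla)) cπ)
      where
      cla : lo ≤ num (part a) × num (part a) < b
      cla = clo a lo≤x g≤b
      πx≤x : num (part a) ≤ num a
      πx≤x with num (part a) ≤? num a
      ... | yes p = p
      ... | no ¬p = contradiction (subst (num a <_) (part-part a) (proj₁ (cg (part a) (ℕₚ.≰⇒> ¬p) (proj₂ cla)))) (ℕₚ.<-irrefl refl)
      cπ : Closed (num (part a)) b
      cπ c lo≤c c<b with num (part a) ≤? num (part c)
      ... | yes p = p , proj₂ (clo c (ℕₚ.≤-trans (proj₁ cla) lo≤c) c<b)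
      ... | no ¬p with πc<πa ← ℕₚ.≰⇒> ¬p with suc (num a) ≤? num c
      ... | yes a<c = contradiction (ℕₚ.<-trans πc<πa (ℕₚ.≤-<-trans πx≤x (proj₁ (cg c a<c c<b)))) (ℕₚ.<-irrefl refl)
      ... | no ¬a<c with ℕₚ.m≤n⇒m<n∨m≡n (ℕₚ.≮⇒≥ ¬a<c) | ℕₚ.m≤n⇒m<n∨m≡n lo≤c
      ... | inj₂ c≡a | _ = contradiction (part-cong c a c≡a) (ℕₚ.<⇒≢ πc<πa)
      ... | inj₁ _ | inj₂ πa≡c = contradiction πc<πa (ℕₚ.≤⇒≯ (subst (num (part a) ≤_)
              (trans (sym (part-part a)) (part-cong (part a) c πa≡c)) πx≤x))
      ... | inj₁ c<a | inj₁ πa<c = ⊥-elim (noncross (part c) (part a) πc<πa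
              (subst (num (part a) <_) (sym (part-part c)) πa<c)
              (subst₂ _<_ (sym (part-part c)) (sym (part-part a)) c<a))

    trivial : ∀ b → Closed b b
    trivial b a b≤ a< = contradiction a< (ℕₚ.≤⇒≯ b≤)

  closure : ∀ a → Λ (suc (num a)) ≡ Λ (num (part a))
  closure a with num (part a) ≤? num a
  -- The partner comes later. The positions strictly between the two are matched among themselves,
  -- so `walk` crosses them.
  ... | no ¬p = sym (walk (suc (num a)) b (num<D (part a)) cl b b ℕₚ.≤-refl a<b ℕₚ.≤-refl (trivial b))
    where
    b = num (part a)
    a<b = ℕₚ.≰⇒> ¬p
    cl : Closed (suc (num a)) b
    cl c a<c c<b = lower , upper
      where
      lower : suc (num a) ≤ num (part c)
      lower with ℕₚ.<-cmp (num a) (num (part c))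
      ... | tri< lt _ _ = lt
      ... | tri≈ _ eq _ = contradiction (part-swap a c (sym eq)) (ℕₚ.<⇒≢ c<b)
      ... | tri> _ _ gt = ⊥-elim (noncross (part c) a gt (subst (num a <_) (sym (part-part c)) a<c) (subst (_< b) (sym (part-part c)) c<b))
      upper : num (part c) < b
      upper with ℕₚ.<-cmp (num (part c)) b
      ... | tri< lt _ _ = lt
      ... | tri≈ _ eq _ = contradiction (trans (sym (part-part a)) (sym (part-swap (part a) c eq))) (ℕₚ.<⇒≢ a<c)
      ... | tri> _ _ gt = ⊥-elim (noncross a c a<c c<b gt)
  ... | yes p with ℕₚ.m≤n⇒m<n∨m≡n (num<D a)
  ... | inj₁ lt = close a p lt
  -- The last position, for which `close` says nothing. The gap after it is gap 0 by `wrap`, and the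
  -- positions before its partner are matched among themselves.
  ... | inj₂ eq = trans (cong Λ eq) (trans wrap (sym (walk 0 y (num<D (part a)) cl y y ℕₚ.≤-refl z≤n ℕₚ.≤-refl (trivial y))))
    where
    y = num (part a)
    cl : Closed 0 y
    cl c _ c<y = z≤n , upper
      where
      upper : num (part c) < y
      upper with ℕₚ.<-cmp (num (part c)) y | ℕₚ.<-cmp (num (part c)) (num a)
      ... | tri< lt _ _ | _ = lt
      ... | tri≈ _ e _ | _ = contradiction (trans (part-swap (part a) c e) (part-part a)) (ℕₚ.<⇒≢ (ℕₚ.<-≤-trans c<y p))
      ... | tri> _ _ _ | tri≈ _ e _ = contradiction (part-swap a c e) (ℕₚ.<⇒≢ c<y)
      ... | tri> _ _ _ | tri> _ _ gt = contradiction (num<D (part c)) (ℕₚ.≤⇒≯ (subst (_≤ num (part c)) eq gt))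
      ... | tri> _ _ gt | tri< lt _ _ = ⊥-elim (noncross c (part a) c<y gt (subst (num (part c) <_) (sym (part-part a)) lt))

-- The two darts of a path at a vertex, and crossings at a single vertex.

module Positions (G : PlaneGraph) {q : ℕ} (𝒬 : Fin q → Path G)
                 (uncrossed : ∀ i j → i ≢ j → ¬ Cross G (𝒬 i) (𝒬 j))
                 (proper : ∀ i j d → i ≢ j → Trails.On G (𝒬 i) d → Trails.On G (𝒬 j) d → Trails.rest G (𝒬 i) d ≢ []) where
  open PlaneGraph G
  open Trails G
  open Rotation G
  open Contour G
  open Strands G 𝒬 uncrossed proper

  headOr : D → List D → D
  headOr d []      = d
  headOr d (x ∷ _) = x

  -- The other dart of path i at the tail of d, or d itself if path i ends there.
  prt : Fin q → D → D
  prt i d = headOr d (rst i (rev d))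

  abstract
    no-loop : ∀ d → tail d ≢ tail (rev d)
    no-loop (e , false) eq = noLoop e eq
    no-loop (e , true)  eq = noLoop e (sym eq)

    prt-∷ : ∀ {i d x B} → rst i (rev d) ≡ x ∷ B → prt i d ≡ x
    prt-∷ {i} {d} eq = cong (headOr d) eq

    prt-view : ∀ i d → On′ i d → prt i d ≢ d → ∃ λ B → rst i (rev d) ≡ prt i d ∷ B
    prt-view i d on ne with rst i (rev d)
    ... | []    = contradiction refl ne
    ... | x ∷ B = B , refl

    prt-On : ∀ i d → On′ i d → On′ i (prt i d)
    prt-On i d on with rst i (rev d) in eq
    ... | []    = on
    ... | x ∷ B = proj₂ (rest-∷ (𝒬 i) {rev d} on eq)

    prt-tail : ∀ i d → On′ i d → tail (prt i d) ≡ tail d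
    prt-tail i d on with rst i (rev d) in eq
    ... | []    = refl
    ... | x ∷ B = trans (rest-tail (𝒬 i) {rev d} on eq) (hd-rev d)

    prt-prt : ∀ i d → On′ i d → prt i (prt i d) ≡ d
    prt-prt i d on with rst i (rev d) in eq
    ... | []    = cong (headOr d) eq
    ... | x ∷ B with _ , back ← rest-back (𝒬 i) {rev d} on eq = trans (cong (headOr x) back) (rev-rev d)

    at-vertex : ∀ i {a c} → On′ i a → On′ i c → tail a ≡ tail c → c ≡ a ⊎ c ≡ prt i a
    at-vertex i {a} {c} oa oc eq with two-darts (𝒬 i) {a} {c} oa oc eq
    ... | inj₁ p       = inj₁ p
    ... | inj₂ (_ , p) = inj₂ (sym (prt-∷ {i} {a} p))

    cyc₄ : ∀ {a b c d} → tail a ≡ tail b → tail a ≡ tail c → tail a ≡ tail d → 0 < turn a b → turn a b < turn a c → turn a c < turn a d →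
           CycOrd G (nextZ G []) a b c d
    cyc₄ {a} {b} {c} {d} ab ac ad p q r =
      turn a b , turn a c , turn a d , p , q , r ,
      trans (f≗ (turn a b) a) (iter-turn ab) , trans (f≗ (turn a c) a) (iter-turn ac) , trans (f≗ (turn a d) a) (iter-turn ad) ,
      λ t 0<t t≤ eq → below-degree {a} {t} 0<t (ℕₚ.≤-<-trans t≤ (turn<degree ad)) (trans (sym (f≗ t a)) eq)
      where
      f≗ : ∀ k x → iter (nextZ G []) k x ≡ iter σ k x
      f≗ zero    x = refl
      f≗ (suc k) x = trans (skip-out [] a (2 * m) refl) (cong σ (f≗ k x))

    -- The crossing has an empty common subpath, for which `nextZ` is plain rotation. If `𝒬 i` is
    -- listed from `d₂` to `d₁`, the cyclic order is started at `d₂`, and this gives the other of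
    -- the two admissible orders.
    vertex-crossing : ∀ β {i j d₁ d₂ d₃ d₄ B B′} → On′ i d₁ → On′ j d₃ → rst i (rev d₁) ≡ d₂ ∷ B → rst j (rev d₃) ≡ d₄ ∷ B′ →
      tail β ≡ tail d₁ → tail β ≡ tail d₂ → tail β ≡ tail d₃ → tail β ≡ tail d₄ →
      turn β d₁ < turn β d₃ → turn β d₃ < turn β d₂ → turn β d₂ < turn β d₄ → Cross G (𝒬 i) (𝒬 j)
    vertex-crossing β {i} {j} {d₁} {d₂} {d₃} {d₄} {B} {B′} o₁ o₃ r₁ r₃ t₁ t₂ t₃ t₄ u₁₃ u₃₂ u₂₄
      with A , at ← On⇒rest (𝒬 i) {rev d₁} o₁ with A′ , at′ ← On⇒rest (𝒬 j) {rev d₃} o₃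
      = go (subst (At (𝒬 i) A (rev d₁)) r₁ at) (subst (At (𝒬 j) A′ (rev d₃)) r₃ at′)
      where
      distinct-edges : ∀ {x y} → tail β ≡ tail x → tail β ≡ tail y → turn β x < turn β y → edge G x ≢ edge G y
      distinct-edges {x} {y} tx ty lt eq with same-edge x y eq
      ... | inj₁ refl = ℕₚ.<-irrefl refl lt
      ... | inj₂ refl = no-loop y (trans (sym ty) tx)
      u₁₂ : turn β d₁ < turn β d₂
      u₁₂ = ℕₚ.<-trans u₁₃ u₃₂
      u₁₄ : turn β d₁ < turn β d₄
      u₁₄ = ℕₚ.<-trans u₁₂ u₂₄
      fwd : ∀ {x y} → tail β ≡ tail x → tail β ≡ tail y → turn β x < turn β y → turn x y ≡ turn β y ∸ turn β x
      fwd tx ty lt = turn-fwd β tx ty (ℕₚ.<⇒≤ lt)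
      cyc : CycOrd G (nextZ G []) d₁ d₃ d₂ d₄
      cyc = cyc₄ (trans (sym t₁) t₃) (trans (sym t₁) t₂) (trans (sym t₁) t₄)
        (subst (0 <_) (sym (fwd t₁ t₃ u₁₃)) (ℕₚ.m<n⇒0<n∸m u₁₃))
        (subst₂ _<_ (sym (fwd t₁ t₃ u₁₃)) (sym (fwd t₁ t₂ u₁₂)) (ℕₚ.∸-monoˡ-< u₃₂ (ℕₚ.<⇒≤ u₁₃)))
        (subst₂ _<_ (sym (fwd t₁ t₂ u₁₂)) (sym (fwd t₁ t₄ u₁₄)) (ℕₚ.∸-monoˡ-< u₂₄ (ℕₚ.<⇒≤ u₁₂)))
      cyc′ : CycOrd G (nextZ G []) d₂ d₄ d₁ d₃
      cyc′ = cyc₄ (trans (sym t₂) t₄) (trans (sym t₂) t₁) (trans (sym t₂) t₃)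
        (subst (0 <_) (sym (fwd t₂ t₄ u₂₄)) (ℕₚ.m<n⇒0<n∸m u₂₄))
        (subst₂ _<_ (sym (fwd t₂ t₄ u₂₄)) (sym (turn-wrap β t₂ t₁ u₁₂))
          (ℕₚ.<-≤-trans (ℕₚ.∸-monoˡ-< (turn<degree t₄) (ℕₚ.<⇒≤ u₂₄)) (ℕₚ.m≤m+n _ _)))
        (subst₂ _<_ (sym (turn-wrap β t₂ t₁ u₁₂)) (sym (turn-wrap β t₂ t₃ u₃₂)) (ℕₚ.+-monoʳ-< (degree β ∸ turn β d₂) u₁₃))
      heads : hd (rev d₁) ≡ hd (rev d₃)
      heads = trans (hd-rev d₁) (trans (sym t₁) (trans t₃ (sym (hd-rev d₃))))
      heads′ : hd (rev d₂) ≡ hd (rev d₃)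
      heads′ = trans (hd-rev d₂) (trans (sym t₂) (trans t₃ (sym (hd-rev d₃))))
      RR : ∀ {x y z w} → CycOrd G (nextZ G []) x y z w → CycOrd G (nextZ G []) (rev (rev x)) y z w
      RR {x} {y} {z} {w} = subst (λ u → CycOrd G (nextZ G []) u y z w) (sym (rev-rev x))
      dir : ∀ {L} → L ≡ A′ ++ rev d₃ ∷ d₄ ∷ B′ → At (𝒬 i) A (rev d₁) (d₂ ∷ B) → CrossDir G (Path.darts (𝒬 i)) L
      dir eq′ (inj₁ eq) = A , rev d₁ , [] , d₂ , B , A′ , rev d₃ , d₄ , B′ , eq , eq′ , heads ,
        distinct-edges t₁ t₃ u₁₃ , distinct-edges t₂ t₄ u₂₄ ,
        inj₁ (RR (subst (λ u → CycOrd G (nextZ G []) d₁ u d₂ d₄) (sym (rev-rev d₃)) cyc))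
      dir eq′ at@(inj₂ eq) with At-rev (𝒬 i) (At-next (𝒬 i) {A} {rev d₁} {d₂} {B} at)
      ... | inj₂ eq″ = ⊥-elim (rev≢ d₂ (sym (proj₁ (proj₂ (split-unique (edge G) (trail-edges (trail-rv (trail (𝒬 i)))) (A ++ rev d₁ ∷ []) (rv B)
                (trans eq (sym (Listₚ.++-assoc A (rev d₁ ∷ []) (d₂ ∷ B)))) eq″ refl)))))
      ... | inj₁ eq″ = rv B , rev d₂ , [] , d₁ , rv A , A′ , rev d₃ , d₄ , B′ ,
        trans eq″ (cong (λ l → rv B ++ rev d₂ ∷ l) (trans (rv-++ A (rev d₁ ∷ [])) (cong (_∷ rv A) (rev-rev d₁)))) ,
        eq′ , heads′ , (distinct-edges t₃ t₂ u₃₂ ∘ sym) , distinct-edges t₁ t₄ u₁₄ ,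
        inj₂ (RR (subst (λ u → CycOrd G (nextZ G []) d₂ d₄ d₁ u) (sym (rev-rev d₃)) cyc′))
      go : At (𝒬 i) A (rev d₁) (d₂ ∷ B) → At (𝒬 j) A′ (rev d₃) (d₄ ∷ B′) → Cross G (𝒬 i) (𝒬 j)
      go at (inj₁ eq′) = inj₁ (dir eq′ at)
      go at (inj₂ eq′) = inj₂ (dir eq′ at)

-- Numbering the strands and the gaps around a vertex.

off : (ℕ → ℕ) → ℕ → ℕ
off w zero    = 0
off w (suc j) = w 0 + off (w ∘ suc) j

off-suc : ∀ w j → off w (suc j) ≡ off w j + w j
off-suc w zero    = ℕₚ.+-identityʳ (w 0)
off-suc w (suc j) = trans (cong (w 0 +_) (off-suc (w ∘ suc) j)) (sym (ℕₚ.+-assoc (w 0) _ _))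

off-mono : ∀ w {i j} → i ≤ j → off w i ≤ off w j
off-mono w z≤n       = z≤n
off-mono w (s≤s i≤j) = ℕₚ.+-monoʳ-≤ (w 0) (off-mono (w ∘ suc) i≤j)

locate : ∀ w k x → x < off w k → ∃ λ j → ∃ λ r → j < k × r < w j × x ≡ off w j + r
locate w (suc k) x x< with x <? w 0
... | yes x<w = 0 , x , s≤s z≤n , x<w , refl
... | no x≮w with w≤x ← ℕₚ.≮⇒≥ x≮w
  with j , r , j<k , r<w , eq ← locate (w ∘ suc) k (x ∸ w 0)
         (ℕₚ.+-cancelˡ-< (w 0) _ _ (subst (_< w 0 + off (w ∘ suc) k) (sym (ℕₚ.m+[n∸m]≡n w≤x)) x<)) =
  suc j , r , s≤s j<k , r<w , trans (sym (ℕₚ.m+[n∸m]≡n w≤x)) (trans (cong (w 0 +_) eq) (sym (ℕₚ.+-assoc (w 0) _ r)))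

-- A block with `w j` positions has one more gap than positions, and its last gap is the first gap
-- of the next block; `glue-spec` asks that the two labels agree.
glue : ∀ {L : Set} → (ℕ → ℕ) → (ℕ → ℕ → L) → ℕ → ℕ → L
glue w Λ zero    x = Λ 0 x
glue w Λ (suc k) x with x ≤? w 0
... | yes _ = Λ 0 x
... | no _  = glue (w ∘ suc) (Λ ∘ suc) k (x ∸ w 0)

glue-0 : ∀ {L : Set} (w : ℕ → ℕ) (Λ : ℕ → ℕ → L) k → glue w Λ k 0 ≡ Λ 0 0
glue-0 w Λ zero    = refl
glue-0 w Λ (suc k) with 0 ≤? w 0
... | yes _ = refl
... | no ¬p = contradiction z≤n ¬p

glue-spec : ∀ {L : Set} (w : ℕ → ℕ) (Λ : ℕ → ℕ → L) k → (∀ j → j < k → Λ j (w j) ≡ Λ (suc j) 0) →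
            ∀ j r → j ≤ k → r ≤ w j → glue w Λ k (off w j + r) ≡ Λ j r
glue-spec w Λ zero    border zero r _ _ = refl
glue-spec w Λ (suc k) border zero r _ r≤ with r ≤? w 0
... | yes _ = refl
... | no ¬p = contradiction r≤ ¬p
glue-spec w Λ (suc k) border (suc j) r (s≤s j≤k) r≤ with w 0 + off (w ∘ suc) j + r ≤? w 0
... | no ¬p = trans (cong (glue (w ∘ suc) (Λ ∘ suc) k) cancel) ih
  where
  ih = glue-spec (w ∘ suc) (Λ ∘ suc) k (λ i i<k → border (suc i) (s≤s i<k)) j r j≤k r≤
  cancel : w 0 + off (w ∘ suc) j + r ∸ w 0 ≡ off (w ∘ suc) j + r
  cancel = trans (cong (_∸ w 0) (ℕₚ.+-assoc (w 0) _ r)) (ℕₚ.m+n∸m≡n (w 0) _)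
-- Here `r` is 0 and all blocks strictly between the first one and the target are empty, so the gap
-- is also the last gap of the first block.
... | yes p = trans (cong (Λ 0) (trans (ℕₚ.+-assoc (w 0) _ r) (trans (cong (w 0 +_) none) (ℕₚ.+-identityʳ (w 0)))))
                (trans (border 0 (s≤s z≤n)) (trans (sym (glue-0 (w ∘ suc) (Λ ∘ suc) k)) (trans (cong (glue (w ∘ suc) (Λ ∘ suc) k) (sym none)) ih)))
  where
  ih = glue-spec (w ∘ suc) (Λ ∘ suc) k (λ i i<k → border (suc i) (s≤s i<k)) j r j≤k r≤
  none : off (w ∘ suc) j + r ≡ 0
  none = ℕₚ.n≤0⇒n≡0 (ℕₚ.+-cancelˡ-≤ (w 0) _ _ (subst₂ _≤_ (ℕₚ.+-assoc (w 0) _ r) (sym (ℕₚ.+-identityʳ (w 0))) p))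

module Around (G : PlaneGraph) {q : ℕ} (𝒬 : Fin q → Path G)
              (uncrossed : ∀ i j → i ≢ j → ¬ Cross G (𝒬 i) (𝒬 j))
              (proper : ∀ i j d → i ≢ j → Trails.On G (𝒬 i) d → Trails.On G (𝒬 j) d → Trails.rest G (𝒬 i) d ≢ [])
              (β : Dart (PlaneGraph.m G)) where
  open PlaneGraph G
  open Trails G
  open Rotation G
  open Strands G 𝒬 uncrossed proper
  open Positions G 𝒬 uncrossed proper

  weight : ℕ → ℕ
  weight t = ℓ (iter σ t β)

  size : ℕ
  size = off weight (degree β)

  -- Ranks along a dart grow clockwise as seen from its tail, so counting by darts clockwise from
  -- `β` and then by rank numbers all strands clockwise around the vertex.
  num : D → Fin q → ℕ
  num d i = off weight (turn β d) + rk d i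

  Here : D → Set
  Here d = tail β ≡ tail d

  abstract
    weight-turn : ∀ {d} → Here d → weight (turn β d) ≡ ℓ d
    weight-turn h = cong ℓ (iter-turn h)

    num-block : ∀ {d d′ i j} → Here d → On′ i d → turn β d < turn β d′ → num d i < num d′ j
    num-block {d} {d′} {i} {j} h oi lt = ℕₚ.<-≤-trans
      (subst (num d i <_) (sym (off-suc weight (turn β d))) (ℕₚ.+-monoʳ-< _ (subst (rk d i <_) (sym (weight-turn h)) (rk<ℓ {d} oi))))
      (ℕₚ.≤-trans (off-mono weight lt) (ℕₚ.m≤m+n _ _))

    num-< : ∀ {d d′ i j} → Here d → Here d′ → On′ i d → On′ j d′ → num d i < num d′ j →
            turn β d < turn β d′ ⊎ d ≡ d′ × i <[ d ] j
    num-< {d} {d′} {i} {j} h h′ oi oj lt with ℕₚ.<-cmp (turn β d) (turn β d′)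
    ... | tri< p _ _ = inj₁ p
    ... | tri> _ _ p = contradiction (num-block {d′} {d} {j} {i} h′ oj p) (ℕₚ.<-asym lt)
    ... | tri≈ _ p _ with refl ← turn-injective {β} {d} {d′} h h′ p =
      inj₂ (refl , rk-reflect {d} {i} {j} oi oj (ℕₚ.+-cancelˡ-< (off weight (turn β d)) _ _ lt))

    num-injective : ∀ {d d′ i j} → Here d → Here d′ → On′ i d → On′ j d′ → num d i ≡ num d′ j → d ≡ d′ × i ≡ j
    num-injective {d} {d′} {i} {j} h h′ oi oj eq with ℕₚ.<-cmp (turn β d) (turn β d′)
    ... | tri< p _ _ = contradiction eq (ℕₚ.<⇒≢ (num-block {d} {d′} {i} {j} h oi p))
    ... | tri> _ _ p = contradiction (sym eq) (ℕₚ.<⇒≢ (num-block {d′} {d} {j} {i} h′ oj p))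
    ... | tri≈ _ p _ with refl ← turn-injective {β} {d} {d′} h h′ p =
      refl , rk-injective {d} oi oj (ℕₚ.+-cancelˡ-≡ (off weight (turn β d)) _ _ eq)

    num<size : ∀ {d i} → Here d → On′ i d → num d i < size
    num<size {d} {i} h oi = ℕₚ.<-≤-trans
      (subst (num d i <_) (sym (off-suc weight (turn β d))) (ℕₚ.+-monoʳ-< _ (subst (rk d i <_) (sym (weight-turn h)) (rk<ℓ {d} oi))))
      (off-mono weight (turn<degree h))

    num-onto : ∀ x → x < size → ∃ λ d → ∃ λ i → Here d × On′ i d × num d i ≡ x
    num-onto x x< with t , r , t< , r< , x≡ ← locate weight (degree β) x x<
      with i , oi , rk≡ ← strand-at (iter σ t β) r r< =
      iter σ t β , i , sym (tail-iter t β) , oi ,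
      trans (cong₂ (λ a b → off weight a + b) (turn-unique t< refl) rk≡) (sym x≡)

    -- Four distinct darts would give a crossing at the vertex. If two of them coincide, the paths
    -- share a dart; `<-rev` then orders their continuations, clockwise from the shared dart,
    -- against the assumed numbering. If `i` and `j` are equal, the path has no further position at
    -- this vertex.
    noncrossing : ∀ {d₁ i d₃ j} → Here d₁ → On′ i d₁ → Here d₃ → On′ j d₃ →
      num d₁ i < num d₃ j → num d₃ j < num (prt i d₁) i → num (prt i d₁) i < num (prt j d₃) j → ⊥
    noncrossing {d₁} {i} {d₃} {j} h₁ o₁ h₃ o₃ l₁₃ l₃₂ l₂₄ with i Finₚ.≟ j
    ... | yes refl with at-vertex i {d₁} {d₃} o₁ o₃ (trans (sym h₁) h₃)
    ... | inj₁ refl = ℕₚ.<-irrefl refl l₁₃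
    ... | inj₂ refl = ℕₚ.<-irrefl refl l₃₂
    noncrossing {d₁} {i} {d₃} {j} h₁ o₁ h₃ o₃ l₁₃ l₃₂ l₂₄ | no i≢j =
      go (num-< {d₁} {d₃} {i} {j} h₁ h₃ o₁ o₃ l₁₃) (num-< {d₃} {d₂} {j} {i} h₃ h₂ o₃ o₂ l₃₂) (num-< {d₂} {d₄} {i} {j} h₂ h₄ o₂ o₄ l₂₄)
      where
      d₂ d₄ : D
      d₂ = prt i d₁
      d₄ = prt j d₃
      h₂ : Here d₂
      h₂ = trans h₁ (sym (prt-tail i d₁ o₁))
      h₄ : Here d₄
      h₄ = trans h₃ (sym (prt-tail j d₃ o₃))
      o₂ : On′ i d₂
      o₂ = prt-On i d₁ o₁
      o₄ : On′ j d₄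
      o₄ = prt-On j d₃ o₃
      d₂≢d₁ : d₂ ≢ d₁
      d₂≢d₁ eq = ℕₚ.<⇒≢ (ℕₚ.<-trans l₁₃ l₃₂) (cong (λ d → num d i) (sym eq))
      d₄≢d₃ : d₄ ≢ d₃
      d₄≢d₃ eq = ℕₚ.<⇒≢ (ℕₚ.<-trans l₃₂ l₂₄) (cong (λ d → num d j) (sym eq))
      r₁ : ∃ λ B → rst i (rev d₁) ≡ d₂ ∷ B
      r₁ = prt-view i d₁ o₁ d₂≢d₁
      r₃ : ∃ λ B → rst j (rev d₃) ≡ d₄ ∷ B
      r₃ = prt-view j d₃ o₃ d₄≢d₃
      back : ∀ {k d} → On′ k d → prt k d ≢ d → ∃ λ B → rst k (rev (prt k d)) ≡ d ∷ B
      back {k} {d} o ne with B , eq ← prt-view k (prt k d) (prt-On k d o) (λ e → ne (sym (trans (sym (prt-prt k d o)) e))) =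
        B , trans eq (cong (_∷ B) (prt-prt k d o))
      r₂ : ∃ λ B → rst i (rev d₂) ≡ d₁ ∷ B
      r₂ = back {i} {d₁} o₁ d₂≢d₁
      r₄ : ∃ λ B → rst j (rev d₄) ≡ d₃ ∷ B
      r₄ = back {j} {d₃} o₃ d₄≢d₃
      same : ∀ {x y} → x ≡ y → ¬ turn β x < turn β y
      same refl = ℕₚ.<-irrefl refl
      fwd-< : ∀ {x y z} → Here x → Here y → Here z → turn β x < turn β y → turn β y < turn β z → turn x y < turn x z
      fwd-< hx hy hz p p′ = subst₂ _<_ (sym (turn-fwd β hx hy (ℕₚ.<⇒≤ p))) (sym (turn-fwd β hx hz (ℕₚ.<⇒≤ (ℕₚ.<-trans p p′)))) (ℕₚ.∸-monoˡ-< p′ (ℕₚ.<⇒≤ p))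
      go : turn β d₁ < turn β d₃ ⊎ d₁ ≡ d₃ × i <[ d₁ ] j → turn β d₃ < turn β d₂ ⊎ d₃ ≡ d₂ × j <[ d₃ ] i →
           turn β d₂ < turn β d₄ ⊎ d₂ ≡ d₄ × i <[ d₂ ] j → ⊥
      go (inj₁ u₁₃) (inj₁ u₃₂) (inj₁ u₂₄) = uncrossed i j i≢j
        (vertex-crossing β {i} {j} o₁ o₃ (proj₂ r₁) (proj₂ r₃) h₁ h₂ h₃ h₄ u₁₃ u₃₂ u₂₄)
      go (inj₂ (e , _)) (inj₂ (e′ , _)) _ = d₂≢d₁ (sym (trans e e′))
      go _ (inj₂ (e , _)) (inj₂ (e′ , _)) = d₄≢d₃ (sym (trans e e′))
      go (inj₂ (d₁≡d₃ , l)) (inj₁ u₃₂) third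
        with <-unfold {j} {i} {d₁} (trans (cong (λ d → rst j (rev d)) d₁≡d₃) (proj₂ r₃)) (proj₂ r₁)
               (subst (On′ j) (sym d₁≡d₃) o₃) o₁ (<-rev {i} {j} {d₁} i≢j o₁ (subst (On′ j) (sym d₁≡d₃) o₃) l) | third
      ... | inj₁ lt | inj₁ u₂₄ = ℕₚ.<-asym lt (fwd-< h₁ h₂ h₄ (subst (λ d → turn β d < turn β d₂) (sym d₁≡d₃) u₃₂) u₂₄)
      ... | inj₁ lt | inj₂ (d₂≡d₄ , _) = ℕₚ.<-irrefl (cong (turn d₁) (sym d₂≡d₄)) lt
      ... | inj₂ (d₄≡d₂ , _) | inj₁ u₂₄ = same (sym d₄≡d₂) u₂₄
      ... | inj₂ (d₄≡d₂ , l′) | inj₂ (_ , l″) = lex-irrefl (lex-trans l″ (subst (λ d → j <[ d ] i) d₄≡d₂ l′))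
      go (inj₁ u₁₃) (inj₂ (d₃≡d₂ , l)) (inj₁ u₂₄)
        with <-unfold {i} {j} {d₃} (trans (cong (λ d → rst i (rev d)) d₃≡d₂) (proj₂ r₂)) (proj₂ r₃)
               (subst (On′ i) (sym d₃≡d₂) o₂) o₃ (<-rev {j} {i} {d₃} (i≢j ∘ sym) o₃ (subst (On′ i) (sym d₃≡d₂) o₂) l)
      ... | inj₁ lt = ℕₚ.<-asym lt (subst₂ _<_ (sym (turn-fwd β h₃ h₄ (ℕₚ.<⇒≤ u₃₄))) (sym (turn-wrap β h₃ h₁ u₁₃))
              (ℕₚ.<-≤-trans (ℕₚ.∸-monoˡ-< (turn<degree h₄) (ℕₚ.<⇒≤ u₃₄)) (ℕₚ.m≤m+n _ _)))
        where
        u₃₄ : turn β d₃ < turn β d₄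
        u₃₄ = subst (λ d → turn β d < turn β d₄) (sym d₃≡d₂) u₂₄
      ... | inj₂ (d₁≡d₄ , _) = same d₁≡d₄ (ℕₚ.<-trans u₁₃ (subst (λ d → turn β d < turn β d₄) (sym d₃≡d₂) u₂₄))
      go (inj₁ u₁₃) (inj₁ u₃₂) (inj₂ (d₂≡d₄ , l))
        with <-unfold {j} {i} {d₂} (trans (cong (λ d → rst j (rev d)) d₂≡d₄) (proj₂ r₄)) (proj₂ r₂)
               (subst (On′ j) (sym d₂≡d₄) o₄) o₂ (<-rev {i} {j} {d₂} i≢j o₂ (subst (On′ j) (sym d₂≡d₄) o₄) l)
      ... | inj₁ lt = ℕₚ.<-asym lt (subst₂ _<_ (sym (turn-wrap β h₂ h₁ (ℕₚ.<-trans u₁₃ u₃₂))) (sym (turn-wrap β h₂ h₃ u₃₂)) (ℕₚ.+-monoʳ-< (degree β ∸ turn β d₂) u₁₃))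
      ... | inj₂ (d₃≡d₁ , _) = same (sym d₃≡d₁) u₁₃

  module _ {L : Set} (Λ : D → ℕ → L) (border : ∀ d → Here d → Λ d (ℓ d) ≡ Λ (σ d) 0)
           (kept : ∀ d i → Here d → On′ i d → num (prt i d) i ≤ num d i → suc (num d i) < size →
                   Λ d (suc (rk d i)) ≡ Λ (prt i d) (rk (prt i d) i)) where

    private
      Pos : Set
      Pos = Σ D λ d → Σ (Fin q) λ i → Here d × On′ i d

      num′ : Pos → ℕ
      num′ (d , i , _) = num d i

      part : Pos → Pos
      part (d , i , h , o) = prt i d , i , trans h (sym (prt-tail i d o)) , prt-On i d o

      Λ′ : ℕ → ℕ → L
      Λ′ t = Λ (iter σ t β)

      Λᵥ : ℕ → L
      Λᵥ = glue weight Λ′ (degree β)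

    abstract
      private
        Λᵥ-spec : ∀ t r → t ≤ degree β → r ≤ weight t → Λᵥ (off weight t + r) ≡ Λ′ t r
        Λᵥ-spec = glue-spec weight Λ′ (degree β) (λ t _ → border (iter σ t β) (sym (tail-iter t β)))

        Λᵥ-num : ∀ {d r} → Here d → r ≤ ℓ d → Λᵥ (off weight (turn β d) + r) ≡ Λ d r
        Λᵥ-num {d} {r} h r≤ = trans (Λᵥ-spec (turn β d) r (ℕₚ.<⇒≤ (turn<degree h)) (subst (r ≤_) (sym (weight-turn h)) r≤))
          (cong (λ x → Λ x r) (iter-turn h))

        wrap : Λᵥ size ≡ Λᵥ 0
        wrap = trans (cong Λᵥ (sym (ℕₚ.+-identityʳ size)))
          (trans (Λᵥ-spec (degree β) 0 ℕₚ.≤-refl z≤n) (trans (cong (λ x → Λ x 0) (iter-degree β)) (sym (glue-0 weight Λ′ (degree β)))))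

        after : ∀ d i → Here d → On′ i d → Λᵥ (suc (num d i)) ≡ Λ d (suc (rk d i))
        after d i h o = trans (cong Λᵥ (sym (ℕₚ.+-suc _ (rk d i)))) (Λᵥ-num h (rk<ℓ {d} o))

        before : ∀ d i → Here d → On′ i d → Λᵥ (num d i) ≡ Λ d (rk d i)
        before d i h o = Λᵥ-num h (ℕₚ.<⇒≤ (rk<ℓ {d} o))

        cong-part : ∀ a b → num′ a ≡ num′ b → num′ (part a) ≡ num′ (part b)
        cong-part (d , i , h , o) (d′ , j , h′ , o′) eq with refl , refl ← num-injective {d} {d′} {i} {j} h h′ o o′ eq = refl

      -- `border` joins the gaps of consecutive darts into one cyclic sequence. `kept` provides the
      -- identification at every position with an earlier partner, except at the last position, and
      -- the matching argument supplies all others.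
      all-merged : ∀ d i → Here d → On′ i d → Λ d (suc (rk d i)) ≡ Λ (prt i d) (rk (prt i d) i)
      all-merged d i h o = trans (sym (after d i h o)) (trans
        (Noncrossing.closure num′ size (λ (_ , _ , h , o) → num<size h o)
          (λ x x< → let (d , i , h , o , eq) = num-onto x x< in (d , i , h , o) , eq)
          part cong-part (λ (d , i , h , o) → cong (λ x → num x i) (prt-prt i d o))
          (λ (d , i , h , o) (d′ , j , h′ , o′) → noncrossing {d} {i} {d′} {j} h o h′ o′)
          Λᵥ wrap
          (λ (d , i , h , o) le lt → trans (after d i h o) (trans (kept d i h o le lt)
             (sym (before (prt i d) i (trans h (sym (prt-tail i d o))) (prt-On i d o)))))
          (d , i , h , o))
        (before (prt i d) i (trans h (sym (prt-tail i d o))) (prt-On i d o)))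

-- Items that carry identifications, and the choice of one redundant item per vertex.

filter-complement : ∀ {A : Set} {P : A → Set} (P? : ∀ x → Dec (P x)) (xs : List A) →
                    length (filter P? xs) + length (filter (¬? ∘ P?) xs) ≡ length xs
filter-complement P? [] = refl
filter-complement P? (x ∷ xs) with P? x
... | yes _ = cong suc (filter-complement P? xs)
... | no _  = trans (ℕₚ.+-suc _ _) (cong suc (filter-complement P? xs))

concatMap-length : ∀ {A B : Set} {f : A → List B} → (∀ x → length (f x) ≤ 1) → ∀ xs → length (concatMap f xs) ≤ length xs
concatMap-length h [] = z≤n
concatMap-length {f = f} h (x ∷ xs) =
  ℕₚ.≤-trans (ℕₚ.≤-reflexive (Listₚ.length-++ (f x))) (ℕₚ.+-mono-≤ (h x) (concatMap-length h xs))

module _ {a b c : ℕ} where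
  enc : Fin a ⊎ (Fin b ⊎ Fin c) → Fin (a + (b + c))
  enc (inj₁ x) = join a (b + c) (inj₁ x)
  enc (inj₂ y) = join a (b + c) (inj₂ (join b c y))

  dec : Fin (a + (b + c)) → Fin a ⊎ (Fin b ⊎ Fin c)
  dec x with splitAt a x
  ... | inj₁ y = inj₁ y
  ... | inj₂ y = inj₂ (splitAt b y)

  enc-dec : ∀ x → enc (dec x) ≡ x
  enc-dec x with splitAt a x in eq
  ... | inj₁ y = trans (cong (join a (b + c)) (sym eq)) (Finₚ.join-splitAt a (b + c) x)
  ... | inj₂ y = trans (cong (join a (b + c) ∘ inj₂) (Finₚ.join-splitAt b c y))
                   (trans (cong (join a (b + c)) (sym eq)) (Finₚ.join-splitAt a (b + c) x))

  dec-enc : ∀ y → dec (enc y) ≡ y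
  dec-enc (inj₁ x) rewrite Finₚ.splitAt-join a (b + c) (inj₁ x) = refl
  dec-enc (inj₂ y) rewrite Finₚ.splitAt-join a (b + c) (inj₂ (join b c y)) = cong inj₂ (Finₚ.splitAt-join b c y)

module Vertices (G : PlaneGraph) {q : ℕ} (𝒬 : Fin q → Path G)
                (uncrossed : ∀ i j → i ≢ j → ¬ Cross G (𝒬 i) (𝒬 j))
                (proper : ∀ i j d → i ≢ j → Trails.On G (𝒬 i) d → Trails.On G (𝒬 j) d → Trails.rest G (𝒬 i) d ≢ [])
                {v c : ℕ} (V : NumClasses (SameOrbit (PlaneGraph.σ G)) v) (K : NumClasses (Conn (PlaneGraph.σ G)) c) where
  open PlaneGraph G
  open Trails G
  open Rotation G
  open Strands G 𝒬 uncrossed proper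
  open Positions G 𝒬 uncrossed proper

  -- Vertices are taken as orbits of darts, which are what Euler's formula counts here; isolated
  -- vertices do not occur among them.
  vx : D → Fin v
  vx = proj₁ V

  base : Fin v → D
  base u = proj₁ (proj₂ (proj₂ (proj₂ V)) u)

  vx-base : ∀ u → vx (base u) ≡ u
  vx-base u = proj₂ (proj₂ (proj₂ (proj₂ V)) u)

  tail⇒vx : ∀ {d d′} → tail d ≡ tail d′ → vx d ≡ vx d′
  tail⇒vx {d} {d′} eq = proj₁ (proj₂ (proj₂ V)) d d′ (σ-trans d d′ eq)

  vx⇒tail : ∀ {d d′} → vx d ≡ vx d′ → tail d ≡ tail d′
  vx⇒tail {d} {d′} eq with k , it ← proj₁ (proj₂ V) d d′ eq = trans (sym (tail-iter k d)) (cong tail it)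

  comp : Fin c → D
  comp κ = proj₁ (proj₂ (proj₂ (proj₂ K)) κ)

  to-comp : ∀ d → ∃ λ κ → Conn σ d (comp κ)
  to-comp d = proj₁ K d , proj₁ (proj₂ K) d _ (sym (proj₂ (proj₂ (proj₂ (proj₂ K)) (proj₁ K d))))

  module At-vertex (u : Fin v) = Around G 𝒬 uncrossed proper (base u)

  size : Fin v → ℕ
  size u = At-vertex.size u

  num : Fin v → D → Fin q → ℕ
  num u = At-vertex.num u

  at-base : ∀ {d u} → vx d ≡ u → tail (base u) ≡ tail d
  at-base {d} {u} eq = vx⇒tail (trans (vx-base u) (sym eq))

  abstract
    unloaded : ∀ {u d} → size u ≡ 0 → vx d ≡ u → ℓ d ≡ 0
    unloaded {u} {d} s≡0 vd = ℕₚ.n≤0⇒n≡0 (ℕₚ.≤-trans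
      (subst (_≤ off w (suc (turn (base u) d))) (At-vertex.weight-turn u (at-base vd))
        (subst (w (turn (base u) d) ≤_) (sym (off-suc w (turn (base u) d))) (ℕₚ.m≤n+m (w (turn (base u) d)) (off w (turn (base u) d)))))
      (ℕₚ.≤-trans (off-mono w (turn<degree (at-base vd))) (ℕₚ.≤-reflexive s≡0)))
      where
      w : ℕ → ℕ
      w = At-vertex.weight u

  anyD? : ∀ {P : D → Set} → (∀ d → Dec (P d)) → Dec (∃ P)
  anyD? {P} P? with Finₚ.any? (λ e → P? (e , false) ⊎-dec P? (e , true))
  ... | yes (e , inj₁ p) = yes ((e , false) , p)
  ... | yes (e , inj₂ p) = yes ((e , true) , p)
  ... | no ¬p = no λ { ((e , false) , p) → ¬p (e , inj₁ p) ; ((e , true) , p) → ¬p (e , inj₂ p) }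

  -- Bounded distance from the set of loaded vertices and base vertices of components. `rank` is the
  -- distance itself, and any other vertex has a neighbour of smaller rank as its parent.
  Near : ℕ → Fin v → Set
  Near zero    u = 0 < size u ⊎ ∃ λ κ → vx (comp κ) ≡ u
  Near (suc t) u = Near t u ⊎ ∃ λ d → vx d ≡ u × Near t (vx (rev d))

  near? : ∀ t u → Dec (Near t u)
  near? zero    u = 0 <? size u ⊎-dec Finₚ.any? (λ κ → vx (comp κ) Finₚ.≟ u)
  near? (suc t) u = near? t u ⊎-dec anyD? (λ d → vx d Finₚ.≟ u ×-dec near? t (vx (rev d)))

  abstract
    near : ∀ {d κ} → Conn σ d (comp κ) → ∃ λ t → Near t (vx d)
    near {κ = κ} here = 0 , inj₂ (κ , refl)
    near {d} (viaσ p) with t , n ← near p = t , subst (Near t) (tail⇒vx (σ-tail d)) n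
    near {d} (viaα p) with t , n ← near p = suc t , inj₂ (d , refl , n)

    near-all : ∀ u → ∃ λ t → Near t u
    near-all u with t , n ← near (proj₂ (to-comp (base u))) = t , subst (Near t) (vx-base u) n

    rank : Fin v → ℕ
    rank u = proj₁ (least (λ t → near? t u) (proj₁ (near-all u)) (proj₂ (near-all u)))

    Near-rank : ∀ u → Near (rank u) u
    Near-rank u = proj₁ (proj₂ (least (λ t → near? t u) (proj₁ (near-all u)) (proj₂ (near-all u))))

    rank-min : ∀ {u t} → t < rank u → ¬ Near t u
    rank-min {u} {t} = proj₂ (proj₂ (least (λ t → near? t u) (proj₁ (near-all u)) (proj₂ (near-all u)))) t

  data Kind (u : Fin v) : Set where
    loaded : 0 < size u → Kind u
    root   : size u ≡ 0 → ∀ κ → vx (comp κ) ≡ u → Kind u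
    child  : size u ≡ 0 → ∀ d → vx d ≡ u → rank (vx (rev d)) < rank u → Kind u

  abstract
    kind : ∀ u → Kind u
    kind u with 0 <? size u
    ... | yes p = loaded p
    ... | no ¬p = go (rank u) refl (Near-rank u)
      where
      s≡0 : size u ≡ 0
      s≡0 = ℕₚ.n≤0⇒n≡0 (ℕₚ.≮⇒≥ ¬p)
      go : ∀ t → rank u ≡ t → Near t u → Kind u
      go zero    _  (inj₁ p)       = loaded p
      go zero    _  (inj₂ (κ , p)) = root s≡0 κ p
      go (suc t) eq (inj₁ n)       = contradiction n (rank-min (subst (t <_) (sym eq) ℕₚ.≤-refl))
      go (suc t) eq (inj₂ (d , vd , n)) = child s≡0 d vd (subst (rank (vx (rev d)) <_) (sym eq)
        (s≤s (ℕₚ.≮⇒≥ λ t< → rank-min {vx (rev d)} t< n)))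

  -- Each visit of a path to a vertex is named by the edge through which the path enters,
  -- or, at the first vertex, by the path.
  Item : Set
  Item = Fin m ⊎ (Fin (q * m) ⊎ Fin q)

  edge-item : Fin m → Item
  edge-item e = inj₁ e

  visit-item : Fin q → Fin m → Item
  visit-item i e = inj₂ (inj₁ (combine i e))

  start-item : Fin q → Item
  start-item i = inj₂ (inj₂ i)

  darts : Fin q → List D
  darts i = Path.darts (𝒬 i)

  _∈?_ : (d : D) (ds : List D) → Dec (d ∈ ds)
  d ∈? ds = Any.any? (d ≟ᵈ_) ds

  -- The dart of `e` in the direction of path `i`; `(e , true)` is a default when the path avoids
  -- `e`.
  forward : Fin q → Fin m → D
  forward i e = if does ((e , false) ∈? darts i) then (e , false) else (e , true)

  -- For a dart `a` on path `i`, this names the visit at the tail of `a`. The path enters through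
  -- `a` if it runs along `rev a`; otherwise it enters through `prt i a` or starts there.
  itm : Fin q → D → Item
  itm i a with rev a ∈? darts i
  ... | yes _ = visit-item i (edge G a)
  ... | no _ with prt i a ≟ᵈ a
  ... | yes _ = start-item i
  ... | no _  = visit-item i (edge G (prt i a))

  data Entry : Item → Fin q → D → Set where
    visit : ∀ i {e a} → rev a ∈ darts i → edge G a ≡ e → Entry (visit-item i e) i a
    start : ∀ i {a B} → darts i ≡ a ∷ B → Entry (start-item i) i a

  abstract
    forward-∈ : ∀ {i d} → d ∈ darts i → forward i (edge G d) ≡ d
    forward-∈ {i} {e , b} d∈ with (e , false) ∈? darts i | b
    ... | yes _ | false = refl
    ... | no _  | true  = refl
    ... | no ¬p | false = contradiction d∈ ¬p
    ... | yes p | true  with A , B , eq ← Memₚ.∈-∃++ p | A′ , B′ , eq′ ← Memₚ.∈-∃++ d∈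
      with () ← proj₁ (proj₂ (split-unique (edge G) (trail-edges (trail (𝒬 i))) A A′ eq eq′ refl))

    itm-entry : ∀ {i a} → On′ i a → Entry (itm i a) i a ⊎ Entry (itm i a) i (prt i a)
    itm-entry {i} {a} on with rev a ∈? darts i
    ... | yes r∈ = inj₁ (visit i r∈ refl)
    ... | no r∉ with On-∈ (𝒬 i) {a} on
    ... | inj₂ r∈ = contradiction r∈ r∉
    ... | inj₁ a∈ with A , B , eq ← Memₚ.∈-∃++ a∈ with restA ← rest-At (𝒬 i) (At-rev (𝒬 i) {A} {a} {B} (inj₁ eq)) with prt i a ≟ᵈ a
    ... | yes p≡a = inj₁ (start i (go A eq restA))
      where
      go : ∀ A → darts i ≡ A ++ a ∷ B → rst i (rev a) ≡ rv A → darts i ≡ a ∷ B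
      go []      eq _ = eq
      go (x ∷ A) eq r with Memₚ.∈-∃++ (subst (rev x ∈_) (sym (rv-∷ x A)) (Memₚ.∈-++⁺ʳ (rv A) (here refl)))
      ... | X , Y , e with X
      ... | [] = contradiction (cong (edge G) (trans (sym (prt-∷ {i} {a} (trans r e))) p≡a))
                   (rest-edge≢ (𝒬 i) {rev a} on (subst (rev x ∈_) (sym (trans r e)) (here refl)))
      ... | y ∷ _ = contradiction (cong (edge G) (trans (sym (prt-∷ {i} {a} (trans r e))) p≡a))
                   (rest-edge≢ (𝒬 i) {rev a} on (subst (y ∈_) (sym (trans r e)) (here refl)))
    ... | no p≢a with B′ , r ← prt-view i a on p≢a = inj₂ (visit i p∈ refl)
      where
      p∈A : prt i a ∈ rv A
      p∈A = subst (prt i a ∈_) (trans (sym r) restA) (here refl)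
      p∈ : rev (prt i a) ∈ darts i
      p∈ with y , y∈ , e ← Memₚ.∈-map⁻ rev {xs = A} (Anyₚ.reverse⁻ p∈A) =
        subst (_∈ darts i) (sym (trans (cong rev e) (rev-rev y))) (subst (y ∈_) (sym eq) (Memₚ.∈-++⁺ˡ y∈))

    entry-unique : ∀ {x i j a b} → Entry x i a → Entry x j b → i ≡ j × a ≡ b
    entry-unique (visit i {e} {a} p refl) q = go p q refl
      where
      go : ∀ {x j b} → rev a ∈ darts i → Entry x j b → x ≡ visit-item i e → i ≡ j × a ≡ b
      go {b = b} p (visit j {e′} p′ refl) eq
        with refl , refl ← Finₚ.combine-injective j e′ i e (Sumₚ.inj₁-injective (Sumₚ.inj₂-injective eq)) =
        refl , trans (sym (rev-rev a)) (trans (cong rev (trans (sym (forward-∈ p)) (forward-∈ p′))) (rev-rev b))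
    entry-unique (start i eq) (start .i eq′) = refl , Listₚ.∷-injectiveˡ (trans (sym eq) eq′)

    -- An item determines its path and its entry dart, and that dart is one of the at most two darts
    -- of the path at the vertex.
    itm-injective : ∀ {i j a b} → On′ i a → On′ j b → itm i a ≡ itm j b → i ≡ j × (b ≡ a ⊎ b ≡ prt i a)
    itm-injective {i} {j} {a} {b} oa ob eq with itm-entry {i} {a} oa | itm-entry {j} {b} ob
    ... | inj₁ p | inj₁ p′ with refl , e ← entry-unique p (subst (λ x → Entry x j b) (sym eq) p′) = refl , inj₁ (sym e)
    ... | inj₂ p | inj₁ p′ with refl , e ← entry-unique p (subst (λ x → Entry x j b) (sym eq) p′) = refl , inj₂ (sym e)
    ... | inj₁ p | inj₂ p′ with refl , e ← entry-unique p (subst (λ x → Entry x j _) (sym eq) p′) =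
      refl , inj₂ (trans (sym (prt-prt j b ob)) (cong (prt j) (sym e)))
    ... | inj₂ p | inj₂ p′ with refl , e ← entry-unique p (subst (λ x → Entry x j _) (sym eq) p′) =
      refl , inj₁ (trans (sym (prt-prt j b ob)) (trans (cong (prt j) (sym e)) (prt-prt i a oa)))

    last-position : ∀ {u} → 0 < size u → ∃ λ d → ∃ λ i → tail (base u) ≡ tail d × On′ i d × suc (num u d i) ≡ size u
    last-position {u} 0<s with size u in eq
    ... | suc s with d , i , h , o , n≡ ← At-vertex.num-onto u s (subst (s <_) (sym eq) ℕₚ.≤-refl) = d , i , h , o , cong suc n≡

  drop-kind : ∀ {u} → Kind u → Item ⊎ Fin c
  drop-kind (loaded p) with d , i , _ ← last-position p = inj₁ (itm i d)
  drop-kind (root _ κ _)    = inj₂ κ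
  drop-kind (child _ d _ _) = inj₁ (edge-item (edge G d))

  -- One identification per vertex is redundant: at a vertex on some path, the one made by the
  -- last position; at any other vertex, the one across the edge towards its parent.
  drop : Fin v → Item ⊎ Fin c
  drop u = drop-kind (kind u)

  abstract
    itm≢edge : ∀ {i a e} → itm i a ≢ edge-item e
    itm≢edge {i} {a} eq with rev a ∈? darts i
    itm≢edge () | yes _
    itm≢edge {i} {a} eq | no _ with prt i a ≟ᵈ a
    itm≢edge () | no _ | yes _
    itm≢edge () | no _ | no _

    -- A visit takes place at one vertex, the base dart of a component has one tail, and an edge
    -- towards a parent is dropped only at its end of larger rank.
    drop-injective : ∀ {u u′} → drop u ≡ drop u′ → u ≡ u′
    drop-injective {u} {u′} = go (kind u) (kind u′)
      where
      go : (k : Kind u) (k′ : Kind u′) → drop-kind k ≡ drop-kind k′ → u ≡ u′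
      go (loaded p) (loaded p′) eq with d , i , h , o , _ ← last-position p | d′ , i′ , h′ , o′ , _ ← last-position p′
        with refl , e ← itm-injective {i} {i′} {d} {d′} o o′ (Sumₚ.inj₁-injective eq) =
        trans (sym (vx-base u)) (trans (tail⇒vx (trans h (trans (same e) (sym h′)))) (vx-base u′))
        where
        same : d′ ≡ d ⊎ d′ ≡ prt i d → tail d ≡ tail d′
        same (inj₁ e) = cong tail (sym e)
        same (inj₂ e) = trans (sym (prt-tail i d o)) (cong tail (sym e))
      go (root _ κ p) (root _ κ′ p′) eq with refl ← Sumₚ.inj₂-injective eq = trans (sym p) p′
      go (child _ d p r) (child _ d′ p′ r′) eq with same-edge d d′ (Sumₚ.inj₁-injective (Sumₚ.inj₁-injective eq))
      ... | inj₁ refl = trans (sym p) p′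
      ... | inj₂ refl = contradiction (subst₂ (λ x y → rank x < rank y) (trans (cong vx (rev-rev d′)) p′) refl r)
              (ℕₚ.<-asym (subst (λ x → rank x < rank u′) p r′))
      go (loaded p) (child _ d′ _ _) eq with d , i , _ ← last-position p = contradiction (Sumₚ.inj₁-injective eq) (itm≢edge {i} {d})
      go (child _ d′ _ _) (loaded p) eq with d , i , _ ← last-position p = contradiction (Sumₚ.inj₁-injective (sym eq)) (itm≢edge {i} {d})
      go (loaded p) (root _ _ _) eq with d , i , _ ← last-position p with () ← eq
      go (root _ _ _) (loaded p) eq with d , i , _ ← last-position p with () ← eq

  Dropped : Item → Set
  Dropped x = ∃ λ u → drop u ≡ inj₁ x

  dropped? : ∀ x → Dec (Dropped x)
  dropped? x = Finₚ.any? (λ u → drop u ≟ inj₁ x)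
    where
    _≟_ : (y z : Item ⊎ Fin c) → Dec (y ≡ z)
    _≟_ = Sumₚ.≡-dec (Sumₚ.≡-dec Finₚ._≟_ (Sumₚ.≡-dec Finₚ._≟_ Finₚ._≟_)) Finₚ._≟_

  items : List Item
  items = map (dec {m} {q * m} {q}) (allFin (m + (q * m + q)))

  kept : List Item
  kept = filter (¬? ∘ dropped?) items

  abstract
    ∈-items : ∀ x → x ∈ items
    ∈-items x = subst (_∈ items) (dec-enc x) (Memₚ.∈-map⁺ (dec {m} {q * m} {q}) (Memₚ.∈-allFin (enc x)))

    ∈-kept : ∀ {x} → ¬ Dropped x → x ∈ kept
    ∈-kept ¬d = Memₚ.∈-filter⁺ (¬? ∘ dropped?) (∈-items _) ¬d

    -- `drop` is injective and at most `c` of its values are components, so at least `v - c` items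
    -- are dropped.
    kept-length : length kept + v ≤ m + (q * m + q) + c
    kept-length = ℕₚ.≤-trans (ℕₚ.+-monoʳ-≤ (length kept) v≤) (ℕₚ.≤-reflexive
      (trans (sym (ℕₚ.+-assoc (length kept) (length gone) c)) (cong (_+ c)
        (trans (ℕₚ.+-comm (length kept) (length gone)) (trans (filter-complement dropped? items)
          (trans (Listₚ.length-map (dec {m} {q * m} {q}) (allFin (m + (q * m + q)))) (Listₚ.length-tabulate {n = m + (q * m + q)} id)))))))
      where
      gone : List Item
      gone = filter dropped? items
      targets : List (Item ⊎ Fin c)
      targets = map inj₁ gone ++ map inj₂ (allFin c)
      sub : ∀ {y} → y ∈ map drop (allFin v) → y ∈ targets
      sub y∈ with u , _ , refl ← Memₚ.∈-map⁻ drop y∈ = sub′ (drop u) refl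
        where
        sub′ : ∀ y → drop u ≡ y → y ∈ targets
        sub′ (inj₁ x) eq = Memₚ.∈-++⁺ˡ (Memₚ.∈-map⁺ inj₁ (Memₚ.∈-filter⁺ dropped? (∈-items x) (u , eq)))
        sub′ (inj₂ κ) eq = Memₚ.∈-++⁺ʳ (map inj₁ gone) (Memₚ.∈-map⁺ inj₂ (Memₚ.∈-allFin κ))
      v≤ : v ≤ length gone + c
      v≤ = subst₂ _≤_ (trans (Listₚ.length-map drop (allFin v)) (Listₚ.length-tabulate id))
        (trans (Listₚ.length-++ (map inj₁ gone)) (cong₂ _+_ (Listₚ.length-map inj₁ gone)
          (trans (Listₚ.length-map inj₂ (allFin c)) (Listₚ.length-tabulate id))))
        (⊆⇒length≤ (Uniqueₚ.map⁺ drop-injective (Uniqueₚ.allFin⁺ v)) sub)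

-- Labels of regions, their identifications, and the Euler inequality.

term≤sum : ∀ {n} (f : Fin n → ℕ) i → f i ≤ sum f
term≤sum f zero    = ℕₚ.m≤m+n _ _
term≤sum f (suc i) = ℕₚ.≤-trans (term≤sum (f ∘ suc) i) (ℕₚ.m≤n+m _ _)

module Regions (G : PlaneGraph) {q : ℕ} (𝒬 : Fin q → Path G)
               (uncrossed : ∀ i j → i ≢ j → ¬ Cross G (𝒬 i) (𝒬 j))
               (proper : ∀ i j d → i ≢ j → Trails.On G (𝒬 i) d → Trails.On G (𝒬 j) d → Trails.rest G (𝒬 i) d ≢ [])
               {v f c : ℕ} (V : NumClasses (SameOrbit (PlaneGraph.σ G)) v) (K : NumClasses (Conn (PlaneGraph.σ G)) c)
               (F : NumClasses (SameOrbit (λ d → PlaneGraph.σ G (rev d))) f)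
               (euler : v + f ≡ PlaneGraph.m G + 2 * c)
               (Rung : Fin (PlaneGraph.m G) → Set) (rung? : ∀ e → Dec (Rung e))
               (two : ∀ e b → Rung e → Strands.ℓ G 𝒬 uncrossed proper (e , b) ≡ 2) where
  open PlaneGraph G
  open Trails G
  open Rotation G
  open Strands G 𝒬 uncrossed proper
  open Positions G 𝒬 uncrossed proper
  open Vertices G 𝒬 uncrossed proper V K

  fc : D → Fin f
  fc = proj₁ F

  fc-onto : ∀ x → ∃ λ d → fc d ≡ x
  fc-onto = proj₂ (proj₂ (proj₂ F))

  fc-next : ∀ d → fc (σ (rev d)) ≡ fc d
  fc-next d = sym (proj₁ (proj₂ (proj₂ F)) d (σ (rev d)) (1 , refl))

  fc-rev : ∀ d → fc (rev d) ≡ fc (σ d)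
  fc-rev d = trans (sym (fc-next (rev d))) (cong (fc ∘ σ) (rev-rev d))

  -- One label for each face of `G`, one for the gap just after the strand of a path on an edge, and
  -- one for the second half of a gap cut by a rung. Labels without such a gap are included to make
  -- the total simple; each is merged with a face at the cost of one identification.
  Label : Set
  Label = Fin f ⊎ (Fin (q * m) ⊎ Fin m)

  face : Fin f → Label
  face x = inj₁ x

  strand : Fin q → Fin m → Label
  strand i e = inj₂ (inj₁ (combine i e))

  half : Fin m → Label
  half e = inj₂ (inj₂ e)

  gap₀ : Fin m → ℕ → Label
  gap₀ e zero = face (fc (e , false))
  gap₀ e (suc r) with r <? ℓ (e , false)
  ... | yes r< = strand (proj₁ (strand-at (e , false) r r<)) e
  ... | no _   = face (fc (e , false))

  Cut : Fin m → ℕ → Set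
  Cut e r = Rung e × r ≡ 1

  cut? : ∀ e r → Dec (Cut e r)
  cut? e r = rung? e ×-dec r ℕₚ.≟ 1

  gap₁ : ∀ e r → Dec (Cut e r) → Label
  gap₁ e r (yes _) = half e
  gap₁ e r (no _)  = gap₀ e (ℓ (e , false) ∸ r)

  -- The gap near the tail of d with r strands on its counterclockwise side, 0 ≤ r ≤ ℓ d.
  -- The two ends of an edge see the same gaps, except that a rung cuts the middle gap in two.
  gap : D → ℕ → Label
  gap (e , false) r = gap₀ e r
  gap (e , true)  r = gap₁ e r (cut? e r)

  -- Each visit makes one identification, at the later of its two positions in the numbering around
  -- the vertex; this is the form that the matching argument asks for.
  closing : ∀ {P : Set} → Fin q → (a b : D) → Dec P → Label × Label
  closing i a b (yes _) = gap a (suc (rk a i)) , gap b (rk b i)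
  closing i a b (no _)  = gap b (suc (rk b i)) , gap a (rk a i)

  merge-at : Fin q → D → Label × Label
  merge-at i a = closing i a (prt i a) (num (vx a) (prt i a) i ≤? num (vx a) a i)

  visit-merge : ∀ i e → Dec (On′ i (e , false)) → Label × Label
  visit-merge i e (yes _) = merge-at i (rev (forward i e))
  visit-merge i e (no _)  = strand i e , face (fc (e , false))

  start-merges : Fin q → List D → List (Label × Label)
  start-merges i []      = []
  start-merges i (a ∷ _) = merge-at i a ∷ []

  -- The item of an edge joins the gap after its last strand to the face beyond it. On an edge
  -- without strands this joins the two incident faces, so the edge is erased.
  item-merges : Item → List (Label × Label)
  item-merges (inj₁ e) = (gap (e , false) (ℓ (e , false)) , face (fc (σ (e , false)))) ∷ []
  item-merges (inj₂ (inj₁ k)) =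
    visit-merge (proj₁ (remQuot {q} m k)) (proj₂ (remQuot {q} m k)) (On? (𝒬 (proj₁ (remQuot {q} m k))) (proj₂ (remQuot {q} m k) , false)) ∷ []
  item-merges (inj₂ (inj₂ i)) = start-merges i (darts i)

  uncut : List (Fin m)
  uncut = filter (¬? ∘ rung?) (allFin m)

  merges : List (Label × Label)
  merges = concatMap item-merges kept ++ map (λ e → half e , face (fc (e , false))) uncut

  pairs : List (Fin (f + (q * m + m)) × Fin (f + (q * m + m)))
  pairs = map (λ (s , t) → enc {f} {q * m} {m} s , enc {f} {q * m} {m} t) merges

  abstract
    N : ℕ
    N = proj₁ (quotient pairs)

    lab : Label → Fin N
    lab t = proj₁ (proj₂ (quotient pairs)) (enc {f} {q * m} {m} t)

    lab-onto : ∀ y → ∃ λ t → lab t ≡ y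
    lab-onto y with x , eq ← proj₁ (proj₂ (proj₂ (proj₂ (quotient pairs)))) y =
      dec {f} {q * m} {m} x , trans (cong (proj₁ (proj₂ (quotient pairs))) (enc-dec {f} {q * m} {m} x)) eq

    lab-merge : ∀ {s t} → (s , t) ∈ merges → lab s ≡ lab t
    lab-merge st∈ = proj₂ (proj₂ (proj₂ (proj₂ (quotient pairs)))) (Memₚ.∈-map⁺ _ st∈)

    lab-item : ∀ {x s t} → ¬ Dropped x → (s , t) ∈ item-merges x → lab s ≡ lab t
    lab-item {x} ¬d st∈ = lab-merge (Memₚ.∈-++⁺ˡ (Memₚ.∈-concatMap⁺ item-merges (Any.map (λ { refl → st∈ }) (∈-kept {x} ¬d))))

    lab-half : ∀ {e} → ¬ Rung e → lab (half e) ≡ lab (face (fc (e , false)))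
    lab-half {e} ¬r = lab-merge (Memₚ.∈-++⁺ʳ (concatMap item-merges kept)
      (Memₚ.∈-map⁺ (λ e → half e , face (fc (e , false))) (Memₚ.∈-filter⁺ (¬? ∘ rung?) (Memₚ.∈-allFin e) ¬r)))

    -- Euler's formula for the contact graph, as an inequality.
    euler-N : count rung? + c ≤ N + q
    -- There are `f + (q * m + m)` labels. The identifications number at most those of `kept`, which
    -- `kept-length` bounds, plus those of `uncut`. Every component of `G` counts all its faces as
    -- on a sphere of its own, hence the term `c`.
    euler-N = ℕₚ.+-cancelˡ-≤ (m + (q * m + m) + c) _ _ (begin
      m + (q * m + m) + c + (count rung? + c)             ≡⟨ shuffle₁ m (q * m) c (count rung?) ⟩
      (m + 2 * c) + (q * m + m) + count rung?             ≡⟨ cong (λ x → x + (q * m + m) + count rung?) (sym euler) ⟩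
      (v + f) + (q * m + m) + count rung?                 ≡⟨ shuffle₂ v f (q * m + m) (count rung?) ⟩
      (f + (q * m + m)) + (v + count rung?)               ≤⟨ ℕₚ.+-monoˡ-≤ _ (proj₁ (proj₂ (proj₂ (quotient pairs)))) ⟩
      (N + length pairs) + (v + count rung?)              ≤⟨ ℕₚ.+-monoˡ-≤ _ (ℕₚ.+-monoʳ-≤ N pairs≤) ⟩
      (N + (length kept + length uncut)) + (v + count rung?) ≡⟨ shuffle₃ N (length kept) (length uncut) v (count rung?) ⟩
      N + (length kept + v) + (count rung? + length uncut) ≤⟨ ℕₚ.+-monoˡ-≤ _ (ℕₚ.+-monoʳ-≤ N kept-length) ⟩
      N + (m + (q * m + q) + c) + (count rung? + length uncut) ≡⟨ cong (N + (m + (q * m + q) + c) +_) (trans (cong (count rung? +_) (count-filter (¬? ∘ rung?))) (count-complement rung?)) ⟩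
      N + (m + (q * m + q) + c) + m                       ≡⟨ shuffle₄ N m (q * m) q c ⟩
      m + (q * m + m) + c + (N + q)                       ∎)
      where
      open ℕₚ.≤-Reasoning
      short : ∀ x → length (item-merges x) ≤ 1
      short (inj₁ e) = s≤s z≤n
      short (inj₂ (inj₁ k)) = s≤s z≤n
      short (inj₂ (inj₂ i)) = go (darts i)
        where
        go : ∀ ds → length (start-merges i ds) ≤ 1
        go []      = z≤n
        go (_ ∷ _) = s≤s z≤n
      pairs≤ : length pairs ≤ length kept + length uncut
      pairs≤ = ℕₚ.≤-trans (ℕₚ.≤-reflexive (trans (Listₚ.length-map _ merges) (Listₚ.length-++ (concatMap item-merges kept))))
        (ℕₚ.+-mono-≤ (concatMap-length short kept) (ℕₚ.≤-reflexive (Listₚ.length-map _ uncut)))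
      shuffle₁ : ∀ m a c E → m + (a + m) + c + (E + c) ≡ (m + 2 * c) + (a + m) + E
      shuffle₁ = solve-∀
      shuffle₂ : ∀ v f a E → (v + f) + a + E ≡ (f + a) + (v + E)
      shuffle₂ = solve-∀
      shuffle₃ : ∀ N k u v E → (N + (k + u)) + (v + E) ≡ N + (k + v) + (E + u)
      shuffle₃ = solve-∀
      shuffle₄ : ∀ N m a q c → N + (m + (a + q) + c) + m ≡ m + (a + m) + c + (N + q)
      shuffle₄ = solve-∀

  Λ : D → ℕ → Fin N
  Λ d r = lab (gap d r)

  abstract
    gap₁-cut : ∀ {e r} → Cut e r → gap (e , true) r ≡ half e
    gap₁-cut {e} {r} cut with cut? e r
    ... | yes _ = refl
    ... | no ¬c = contradiction cut ¬c

    gap₁-no : ∀ {e r} → ¬ Cut e r → gap (e , true) r ≡ gap₀ e (ℓ (e , false) ∸ r)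
    gap₁-no {e} {r} ¬cut with cut? e r
    ... | yes cut = contradiction cut ¬cut
    ... | no _    = refl

    gap-rev : ∀ d r → r ≤ ℓ d → ¬ Cut (edge G d) r → gap d r ≡ gap (rev d) (ℓ d ∸ r)
    gap-rev (e , false) r r≤ ¬cut = sym (trans (gap₁-no {e} {ℓ (e , false) ∸ r} ¬cut′)
      (cong (gap₀ e) (ℕₚ.m∸[m∸n]≡n r≤)))
      where
      ¬cut′ : ¬ Cut e (ℓ (e , false) ∸ r)
      ¬cut′ (rg , eq) = ¬cut (rg , trans (sym (ℕₚ.m∸[m∸n]≡n r≤)) (cong₂ _∸_ (two e false rg) eq))
    gap-rev (e , true) r r≤ ¬cut = trans (gap₁-no {e} {r} ¬cut) (cong (λ k → gap₀ e (k ∸ r)) (ℓ-rev (e , true)))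

    gap-strand : ∀ {i e} → On′ i (e , false) → gap₀ e (suc (rk (e , false) i)) ≡ strand i e
    gap-strand {i} {e} on with rk (e , false) i <? ℓ (e , false)
    ... | no ¬p = contradiction (rk<ℓ {e , false} on) ¬p
    ... | yes p with j , oj , eq ← strand-at (e , false) (rk (e , false) i) p =
      cong (λ k → strand k e) (rk-injective {e , false} oj on eq)

    dropped-edge : ∀ {u e} → drop u ≡ inj₁ (edge-item e) →
                   ∃ λ d → edge G d ≡ e × vx d ≡ u × size u ≡ 0 × rank (vx (rev d)) < rank u
    dropped-edge {u} {e} = go (kind u)
      where
      go : (k : Kind u) → drop-kind k ≡ inj₁ (edge-item e) → ∃ λ d → edge G d ≡ e × vx d ≡ u × size u ≡ 0 × rank (vx (rev d)) < rank u
      go (loaded p) eq with d , i , _ ← last-position p = contradiction (Sumₚ.inj₁-injective eq) (itm≢edge {i} {d})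
      go (child s d p r) eq = d , Sumₚ.inj₁-injective (Sumₚ.inj₁-injective eq) , p , s , r

    dropped-visit : ∀ {u x} → drop u ≡ inj₁ (inj₂ x) →
      ∃ λ d → ∃ λ i → tail (base u) ≡ tail d × On′ i d × suc (num u d i) ≡ size u × itm i d ≡ inj₂ x
    dropped-visit {u} {x} = go (kind u)
      where
      go : (k : Kind u) → drop-kind k ≡ inj₁ (inj₂ x) → ∃ λ d → ∃ λ i → tail (base u) ≡ tail d × On′ i d × suc (num u d i) ≡ size u × itm i d ≡ inj₂ x
      go (loaded p) eq with d , i , h , o , l ← last-position p = d , i , h , o , l , Sumₚ.inj₁-injective eq

    itm-visit : ∀ i a → ∃ λ x → itm i a ≡ inj₂ x
    itm-visit i a with itm i a in eq
    ... | inj₁ e = contradiction eq (itm≢edge {i} {a})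
    ... | inj₂ x = x , refl

  Sides : D → Set
  Sides d = lab (face (fc d)) ≡ lab (face (fc (σ d)))

  abstract
    sides-rev : ∀ d → Sides (rev d) → Sides d
    sides-rev d s = trans (cong (lab ∘ face) (sym (fc-next d))) (trans (sym s) (cong (lab ∘ face) (fc-rev d)))

    sides-rev′ : ∀ {d d′} → d ≡ d′ ⊎ d ≡ rev d′ → Sides d → Sides d′
    sides-rev′ (inj₁ refl) s = s
    sides-rev′ {d′ = d′} (inj₂ refl) s = sides-rev d′ s

    kept-sides : ∀ {d} → ℓ d ≡ 0 → ¬ Dropped (edge-item (edge G d)) → Sides d
    kept-sides {d@(e , b)} ℓ≡0 ¬d = sides-rev′ (flip b) (trans (cong (lab ∘ gap₀ e) (sym (zero′ b ℓ≡0))) (lab-item {edge-item e} ¬d (here refl)))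
      where
      zero′ : ∀ b → ℓ (e , b) ≡ 0 → ℓ (e , false) ≡ 0
      zero′ false z = z
      zero′ true  z = trans (ℓ-rev (e , true)) z
      flip : ∀ b → (e , false) ≡ (e , b) ⊎ (e , false) ≡ rev (e , b)
      flip false = inj₁ refl
      flip true  = inj₂ refl

    -- All edges at an unloaded vertex but the one to its parent are identified across,
    -- hence, going around the vertex, so is that one.
    parent-sides : ∀ n u d → sum rank ≤ n + rank u → drop u ≡ inj₁ (edge-item (edge G d)) → vx d ≡ u → size u ≡ 0 →
                   rank (vx (rev d)) < rank u → Sides d
    parent-sides n u d M≤ du vd s≡0 r< = trans (sym (cong (lab ∘ face ∘ fc) (iter-degree d))) (sym (go (turn (σ d) d) ℕₚ.≤-refl))
      where
      -- The recursion moves to vertices of larger rank. No rank exceeds `sum rank`, and this bounds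
      -- its depth.
      up : ∀ n → sum rank ≤ n + rank u → ∀ u′ {d″} → drop u′ ≡ inj₁ (edge-item (edge G d″)) → vx d″ ≡ u′ → size u′ ≡ 0 →
           rank u < rank u′ → rank (vx (rev d″)) < rank u′ → Sides d″
      up zero    M≤ u′ _ _ _ lt _ = contradiction (ℕₚ.≤-trans (term≤sum rank u′) M≤) (ℕₚ.<⇒≱ lt)
      up (suc n) M≤ u′ {d″} du′ vd″ s″ lt r″ = parent-sides n u′ d″
        (ℕₚ.≤-trans M≤ (ℕₚ.≤-trans (ℕₚ.≤-reflexive (sym (ℕₚ.+-suc n (rank u)))) (ℕₚ.+-monoʳ-≤ n lt))) du′ vd″ s″ r″
      others : ∀ n → sum rank ≤ n + rank u → ∀ d′ → vx d′ ≡ u → d′ ≢ d → Sides d′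
      others n M≤ d′ vd′ d′≢d with dropped? (edge-item (edge G d′))
      ... | no ¬dr = kept-sides {d′} (unloaded s≡0 vd′) ¬dr
      ... | yes (u′ , du′) with d″ , e″ , vd″ , s″ , r″ ← dropped-edge du′ with same-edge d″ d′ e″
      -- The edge of `d′` was dropped at its other end `u′`, for which `u` is the parent.
      ... | inj₂ refl = sides-rev d′ (up n M≤ u′ du′ vd″ s″ (subst (λ x → rank x < rank u′) (trans (cong vx (rev-rev d′)) vd′) r″) r″)
      ... | inj₁ refl with refl ← trans (sym vd″) vd′ with same-edge d′ d (Sumₚ.inj₁-injective (Sumₚ.inj₁-injective (trans (sym du′) du)))
      ... | inj₁ eq = contradiction eq d′≢d
      ... | inj₂ eq = contradiction (trans (vx⇒tail {d} {d′} (trans vd (sym vd′))) (cong tail eq)) (no-loop d)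
      go : ∀ t → t < degree d → lab (face (fc (σ d))) ≡ lab (face (fc (iter σ (suc t) d)))
      go zero    _  = refl
      go (suc t) t< = trans (go t (ℕₚ.<⇒≤ t<)) (others n M≤ (iter σ (suc t) d) (trans (tail⇒vx (tail-iter (suc t) d)) vd) (below-degree (s≤s z≤n) t<))

    across : ∀ e → Λ (e , false) (ℓ (e , false)) ≡ lab (face (fc (σ (e , false))))
    across e with dropped? (edge-item e)
    ... | no ¬d = lab-item {edge-item e} ¬d (here refl)
    ... | yes (u , du) with d , refl , vd , s≡0 , r< ← dropped-edge du =
      trans (cong (lab ∘ gap₀ e) zero′) (sides-rev′ (flip d) (parent-sides (sum rank) u d (ℕₚ.m≤m+n _ _) du vd s≡0 r<))
      where
      flip : ∀ d → d ≡ (edge G d , false) ⊎ d ≡ rev (edge G d , false)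
      flip (e , false) = inj₁ refl
      flip (e , true)  = inj₂ refl
      zero′ : ℓ (e , false) ≡ 0
      zero′ with flip d
      ... | inj₁ eq = trans (cong ℓ (sym eq)) (unloaded s≡0 vd)
      ... | inj₂ eq = trans (sym (ℓ-rev (e , false))) (trans (cong ℓ (sym eq)) (unloaded s≡0 vd))

    Λ-0 : ∀ d → Λ d 0 ≡ lab (face (fc d))
    Λ-0 (e , false) = refl
    Λ-0 (e , true)  = trans (cong lab (gap₁-no {e} {0} λ ())) (trans (across e) (cong (lab ∘ face) (fc-next (e , true))))

    border : ∀ d → Λ d (ℓ d) ≡ Λ (σ d) 0
    border (e , false) = trans (across e) (sym (Λ-0 (σ (e , false))))
    border (e , true)  = trans (cong lab (trans (cong (gap (e , true)) (sym (ℓ-rev (e , true)))) (trans (gap₁-no {e} {ℓ (e , false)} uncut′) (cong (gap₀ e) (ℕₚ.n∸n≡0 (ℓ (e , false)))))))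
      (trans (cong (lab ∘ face) (sym (fc-next (e , false)))) (sym (Λ-0 (σ (e , true)))))
      where
      uncut′ : ¬ Cut e (ℓ (e , false))
      uncut′ (rg , eq) with () ← trans (sym (two e false rg)) eq

    entry-merge : ∀ {x i a} → Entry x i a → On′ i a → merge-at i a ∈ item-merges x
    entry-merge (visit i {e} {a} r∈ refl) on = subst (λ (i′ , e′) → merge-at i a ∈ visit-merge i′ e′ (On? (𝒬 i′) (e′ , false)) ∷ [])
      (sym (Finₚ.remQuot-combine i e)) (here (sym step))
      where
      step : visit-merge i e (On? (𝒬 i) (e , false)) ≡ merge-at i a
      step with On? (𝒬 i) (e , false)
      ... | no ¬on = contradiction on ¬on
      ... | yes _  = cong (merge-at i) (trans (cong rev (forward-∈ {i} {rev a} r∈)) (rev-rev a))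
    entry-merge (start i {a} {B} eq) on = subst (λ ds → merge-at i a ∈ start-merges i ds) (sym eq) (here refl)

    -- The only item dropped at a loaded vertex is the visit of the last position. A visit whose
    -- later position comes before the last one is a different visit, so its identification is kept.
    closing-merged : ∀ u d i → tail (base u) ≡ tail d → On′ i d → num u (prt i d) i ≤ num u d i → suc (num u d i) < size u →
                     Λ d (suc (rk d i)) ≡ Λ (prt i d) (rk (prt i d) i)
    closing-merged u d i h on le lt = finish (itm-entry {i} {d} on)
      where
      vd : vx d ≡ u
      vd = trans (sym (tail⇒vx h)) (vx-base u)
      h′ : tail (base u) ≡ tail (prt i d)
      h′ = trans h (sym (prt-tail i d on))
      vp : vx (prt i d) ≡ u
      vp = trans (sym (tail⇒vx h′)) (vx-base u)
      free : ¬ Dropped (itm i d)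
      free (u′ , eq) with x , itm≡ ← itm-visit i d with d* , i* , h* , o* , l* , e* ← dropped-visit (trans eq (cong inj₁ itm≡))
        with refl , pos ← itm-injective {i*} {i} {d*} {d} o* on (trans e* (sym itm≡)) = absurd pos
        where
        u≡ : d ≡ d* ⊎ d ≡ prt i d* → u ≡ u′
        u≡ (inj₁ refl) = trans (sym vd) (trans (sym (tail⇒vx h*)) (vx-base u′))
        u≡ (inj₂ refl) = trans (sym vd) (trans (tail⇒vx (prt-tail i d* o*)) (trans (sym (tail⇒vx h*)) (vx-base u′)))
        absurd : d ≡ d* ⊎ d ≡ prt i d* → ⊥
        absurd pos with u≡ pos
        absurd (inj₁ refl) | refl = ℕₚ.<⇒≢ lt l*
        absurd (inj₂ e) | refl = ℕₚ.<⇒≱ lt (subst (_≤ suc (num u d i)) l* (s≤s (subst (λ x → num u x i ≤ num u d i) (trans (cong (prt i) e) (prt-prt i d* o*)) le)))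
      use : ∀ {s t s′ t′} → (s , t) ≡ (s′ , t′) → (s , t) ∈ item-merges (itm i d) → lab s′ ≡ lab t′
      use refl st∈ = lab-item {itm i d} free st∈
      finish : Entry (itm i d) i d ⊎ Entry (itm i d) i (prt i d) → Λ d (suc (rk d i)) ≡ Λ (prt i d) (rk (prt i d) i)
      finish (inj₁ en) = use pair (entry-merge en on)
        where
        pair : merge-at i d ≡ (gap d (suc (rk d i)) , gap (prt i d) (rk (prt i d) i))
        pair with num (vx d) (prt i d) i ≤? num (vx d) d i
        ... | yes _ = refl
        ... | no ¬p = contradiction (subst (λ w → num w (prt i d) i ≤ num w d i) (sym vd) le) ¬p
      finish (inj₂ en) = use pair (entry-merge en (prt-On i d on))
        where
        pair : merge-at i (prt i d) ≡ (gap d (suc (rk d i)) , gap (prt i d) (rk (prt i d) i))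
        pair with num (vx (prt i d)) (prt i (prt i d)) i ≤? num (vx (prt i d)) (prt i d) i
        ... | no _ = cong (λ x → gap x (suc (rk x i)) , gap (prt i d) (rk (prt i d) i)) (prt-prt i d on)
        ... | yes p = cong₂ (λ x y → gap x (suc (rk x i)) , gap y (rk y i)) p≡d (trans (prt-prt i d on) (sym p≡d))
          where
          p≡d : prt i d ≡ d
          p≡d = proj₁ (At-vertex.num-injective u {prt i d} {d} {i} {i} h′ h (prt-On i d on) on
            (ℕₚ.≤-antisym le (subst₂ (λ w x → num w x i ≤ num w (prt i d) i) vp (prt-prt i d on) p)))

    around : ∀ d i → On′ i d → Λ d (suc (rk d i)) ≡ Λ (prt i d) (rk (prt i d) i)
    around d i on = At-vertex.all-merged (vx d) Λ (λ d _ → border d) (closing-merged (vx d)) d i (at-base refl) on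

    along : ∀ {d i} → On′ i d → ¬ Cut (edge G d) (rk d i) → Λ d (rk d i) ≡ Λ (rev d) (suc (rk (rev d) i))
    along {d} {i} on ¬cut = trans (cong lab (gap-rev d (rk d i) (ℕₚ.<⇒≤ (rk<ℓ {d} on)) ¬cut)) (cong (Λ (rev d)) eq)
      where
      eq : ℓ d ∸ rk d i ≡ suc (rk (rev d) i)
      eq = trans (cong (_∸ rk d i) (trans (sym (rk-rev {d} on)) (sym (ℕₚ.+-suc (rk d i) _)))) (ℕₚ.m+n∸m≡n (rk d i) _)

    junk-strand : ∀ {i e} → ¬ On′ i (e , false) → lab (strand i e) ≡ lab (face (fc (e , false)))
    junk-strand {i} {e} ¬on = lab-item {visit-item i e} free
      (subst (λ (i′ , e′) → (strand i e , face (fc (e , false))) ∈ visit-merge i′ e′ (On? (𝒬 i′) (e′ , false)) ∷ [])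
        (sym (Finₚ.remQuot-combine i e)) (here (sym step)))
      where
      step : visit-merge i e (On? (𝒬 i) (e , false)) ≡ (strand i e , face (fc (e , false)))
      step with On? (𝒬 i) (e , false)
      ... | no _   = refl
      ... | yes on = contradiction on ¬on
      on-entry : ∀ {x j a} → Entry x j a → x ≡ visit-item i e → ⊥
      on-entry (visit j {e′} {a} r∈ refl) eq with refl , refl ← Finₚ.combine-injective j e′ i e (Sumₚ.inj₁-injective (Sumₚ.inj₂-injective eq)) =
        ¬on (∈⇒On (𝒬 i) {rev a} r∈)
      free : ¬ Dropped (visit-item i e)
      free (u , eq) with d , j , _ , o , _ , itm≡ ← dropped-visit eq with itm-entry {j} {d} o
      ... | inj₁ en = on-entry en itm≡
      ... | inj₂ en = on-entry en itm≡

-- Rung sides of regions and the linear bound on rungs.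

length-concatMap-allFin : ∀ {A : Set} {n} (f : Fin n → List A) → length (concatMap f (allFin n)) ≡ sum (length ∘ f)
length-concatMap-allFin f = go id
  where
  go : ∀ {k} (g : Fin k → _) → length (concatMap f (tabulate g)) ≡ sum (length ∘ f ∘ g)
  go {zero}  g = refl
  go {suc k} g = trans (Listₚ.length-++ (f (g zero))) (cong (length (f (g zero)) +_) (go (g ∘ suc)))

unique-concatMap : ∀ {A : Set} {n} (f : Fin n → List A) (key : A → Fin n) → (∀ i → Unique (f i)) → (∀ i {x} → x ∈ f i → key x ≡ i) →
                   Unique (concatMap f (allFin n))
unique-concatMap f key u k = Uniqueₚ.concat⁺ (Allₚ.map⁺ (All.universal u _))
  (AllPairsₚ.map⁺ (AllPairs.map (λ {i} {j} i≢j {x} (x∈i , x∈j) → i≢j (trans (sym (k i x∈i)) (k j x∈j))) (Uniqueₚ.allFin⁺ _)))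

module Contacts (G : PlaneGraph) {q : ℕ} (𝒬 : Fin q → Path G)
                (uncrossed : ∀ i j → i ≢ j → ¬ Cross G (𝒬 i) (𝒬 j))
                (proper : ∀ i j d → i ≢ j → Trails.On G (𝒬 i) d → Trails.On G (𝒬 j) d → Trails.rest G (𝒬 i) d ≢ [])
                {v f c : ℕ} (V : NumClasses (SameOrbit (PlaneGraph.σ G)) v) (K : NumClasses (Conn (PlaneGraph.σ G)) c)
                (F : NumClasses (SameOrbit (λ d → PlaneGraph.σ G (rev d))) f)
                (euler : v + f ≡ PlaneGraph.m G + 2 * c)
                (Rung : Fin (PlaneGraph.m G) → Set) (rung? : ∀ e → Dec (Rung e))
                (two : ∀ e b → Rung e → Strands.ℓ G 𝒬 uncrossed proper (e , b) ≡ 2)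
                (one-rung : ∀ {i j d d′} → i ≢ j → Rung (edge G d) → Rung (edge G d′) → Trails.On G (𝒬 i) d → Trails.On G (𝒬 j) d →
                            Trails.On G (𝒬 i) d′ → Trails.On G (𝒬 j) d′ → edge G d ≡ edge G d′) where
  open PlaneGraph G
  open Trails G
  open Strands G 𝒬 uncrossed proper
  open Positions G 𝒬 uncrossed proper
  open Vertices G 𝒬 uncrossed proper V K
  open Regions G 𝒬 uncrossed proper V K F euler Rung rung? two

  end-darts : Fin q → List D
  end-darts i = take 1 (darts i) ++ take 1 (rv (darts i))

  right : Fin q → D → Fin N
  right i a = Λ a (suc (rk a i))

  -- Labels of regions that contain an end of a path, or the base corner of a component.
  exceptional : List (Fin N)
  exceptional = concatMap (λ i → map (right i) (end-darts i)) (allFin q) ++ map (λ κ → lab (face (fc (comp κ)))) (allFin c)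

  Touched : Fin N → Set
  Touched y = ∃ λ a → ∃ λ i → On′ i a × right i a ≡ y

  Side : Fin N → D → Set
  Side y d = Rung (edge G d) × Λ d 1 ≡ y

  abstract
    end-exceptional : ∀ {i a} → On′ i a → rst i (rev a) ≡ [] → right i a ∈ exceptional
    end-exceptional {i} {a} on eq = Memₚ.∈-++⁺ˡ (Memₚ.∈-concatMap⁺ _ (Any.map (λ { refl → Memₚ.∈-map⁺ (right i) a∈ }) (Memₚ.∈-allFin i)))
      where
      a∈ : a ∈ end-darts i
      a∈ with A , at ← On⇒rest (𝒬 i) {rev a} on with subst (At (𝒬 i) A (rev a)) eq at
      ... | inj₁ e = Memₚ.∈-++⁺ʳ (take 1 (darts i)) (∈-take-1 (trans (cong rv e) (trans (rv-++ A (rev a ∷ [])) (cong (_∷ rv A) (rev-rev a)))))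
      ... | inj₂ e = Memₚ.∈-++⁺ˡ (∈-take-1 (trans (sym (rv-rv (darts i))) (trans (cong rv e) (trans (rv-++ A (rev a ∷ [])) (cong (_∷ rv A) (rev-rev a))))))

    exceptional-length : length exceptional ≤ 2 * q + c
    exceptional-length = ℕₚ.≤-trans (ℕₚ.≤-reflexive (Listₚ.length-++ (concatMap _ (allFin q)))) (ℕₚ.+-mono-≤ ends
      (ℕₚ.≤-reflexive (trans (Listₚ.length-map _ (allFin c)) (Listₚ.length-tabulate id))))
      where
      ends : length (concatMap (λ i → map (right i) (end-darts i)) (allFin q)) ≤ 2 * q
      ends = ℕₚ.≤-trans (ℕₚ.≤-reflexive (length-concatMap-allFin (λ i → map (right i) (end-darts i)))) (ℕₚ.≤-trans (sum-mono λ i →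
        ℕₚ.≤-trans (ℕₚ.≤-reflexive (trans (Listₚ.length-map (right i) (end-darts i)) (Listₚ.length-++ (take 1 (darts i)))))
          (ℕₚ.+-mono-≤ (length-take-1 (darts i)) (length-take-1 (rv (darts i))))) (ℕₚ.≤-reflexive (trans (sum-const q 2) (ℕₚ.*-comm q 2))))

    -- Follow path i away from a, keeping the region on one side, until a rung appears.
    next-rung : ∀ B {i a} → On′ i a → rst i (rev a) ≡ B →
                right i a ∈ exceptional ⊎ ∃ λ b → Side (right i a) b × On′ i b × rk b i ≡ 1 × b ∈ B
    next-rung [] {i} {a} on eq = inj₁ (end-exceptional {i} {a} on eq)
    next-rung (b ∷ B) {i} {a} on eq with cut? (edge G b) (rk b i) | rest-∷ (𝒬 i) {rev a} on eq | trans (around a i on) (cong (λ x → Λ x (rk x i)) (prt-∷ {i} {a} eq))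
    ... | yes (rg , rk≡1) | _ , ob | turned = inj₂ (b , (rg , trans (cong (Λ b) (sym rk≡1)) (sym turned)) , ob , rk≡1 , here refl)
    ... | no ¬cut | rb , ob | turned with next-rung B {i} {rev b} ob (trans (cong (rst i) (rev-rev b)) rb) | trans turned (along {b} {i} ob ¬cut)
    ... | inj₁ ex | moved = inj₁ (subst (_∈ exceptional) (sym moved) ex)
    ... | inj₂ (b′ , (rg , lb) , ob′ , rk≡ , b′∈) | moved = inj₂ (b′ , (rg , trans lb (sym moved)) , ob′ , rk≡ , there b′∈)

    -- The region lies just clockwise of the strand of rank 0 at `d`. That path is followed away
    -- from `d`, beyond the tail of `d`, along the region to the next rung, where it has rank 1.
    next-side : ∀ {y d} → y ∉ exceptional → Side y d →
      ∃ λ i → ∃ λ b → On′ i d × rk d i ≡ 0 × On′ i b × rk b i ≡ 1 × Side y b × edge G b ≢ edge G d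
    next-side {y} {d} ∉ex (rg , lb) with i , oi , rk≡0 ← strand-at d 0 (subst (0 <_) (sym (two (proj₁ d) (proj₂ d) rg)) (s≤s z≤n))
      with lb′ ← trans (cong (λ k → Λ d (suc k)) rk≡0) lb
      with next-rung (rst i (rev d)) {i} {d} oi refl
    ... | inj₁ ex = contradiction (subst (_∈ exceptional) lb′ ex) ∉ex
    ... | inj₂ (b , (rg′ , lb″) , ob , rk≡1 , b∈) = i , b , oi , rk≡0 , ob , rk≡1 , (rg′ , trans lb″ lb′) , rest-edge≢ (𝒬 i) {rev d} oi b∈

    -- A third side equal to the first would close a region with two sides: the two paths between
    -- them, distinct by their ranks 0 and 1 at the same dart, would share both rungs, against
    -- `one-rung`. This is how simplicity of the contact graph enters.
    three-sides : ∀ {y} → y ∉ exceptional → Touched y → ∃ λ (ds : List D) → length ds ≡ 3 × Unique ds × (∀ {d} → d ∈ ds → Side y d)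
    three-sides {y} ∉ex (a , i , oi , refl) with next-rung (rst i (rev a)) {i} {a} oi refl
    ... | inj₁ ex = contradiction ex ∉ex
    ... | inj₂ (d₁ , s₁ , _) with i₁ , d₂ , o₁₁ , r₁₁ , o₁₂ , r₁₂ , s₂ , e₂ ← next-side {y} {d₁} ∉ex s₁
      with i₂ , d₃ , o₂₂ , r₂₂ , o₂₃ , r₂₃ , s₃ , e₃ ← next-side {y} {d₂} ∉ex s₂ =
      d₁ ∷ d₂ ∷ d₃ ∷ [] , refl ,
      ((λ eq → e₂ (cong (edge G) (sym eq))) ∷ d₁≢d₃ ∷ []) ∷ ((λ eq → e₃ (cong (edge G) (sym eq))) ∷ []) ∷ [] ∷ [] ,
      λ { (here refl) → s₁ ; (there (here refl)) → s₂ ; (there (there (here refl))) → s₃ }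
      where
      d₁≢d₃ : d₁ ≢ d₃
      d₁≢d₃ refl = e₂ (one-rung {i₁} {i₂} {d₂} {d₁} i₁≢i₂ (proj₁ s₂) (proj₁ s₁) o₁₂ o₂₂ o₁₁ o₂₃)
        where
        i₁≢i₂ : i₁ ≢ i₂
        i₁≢i₂ refl with () ← trans (sym r₁₁) r₂₃

    -- Edges without strands do not separate regions. So the region of a face can be carried along a
    -- walk to the base dart of the component until a strand or the base corner is met.
    touched-from-face : ∀ {d κ} → Conn σ d (comp κ) → lab (face (fc d)) ∈ exceptional ⊎ Touched (lab (face (fc d)))
    touched-from-face {d} {κ} conn with ℓ d in ℓ≡
    ... | suc k with i , oi , rk≡0 ← strand-at d 0 (subst (0 <_) (sym ℓ≡) (s≤s z≤n)) =
      inj₂ (rev d , i , oi , trans (sym (along {d} {i} oi λ (_ , rk≡1) → ℕₚ.0≢1+n (trans (sym rk≡0) rk≡1))) (trans (cong (Λ d) rk≡0) (Λ-0 d)))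
    touched-from-face here | zero = inj₁ (Memₚ.∈-++⁺ʳ (concatMap _ (allFin q)) (Memₚ.∈-map⁺ _ (Memₚ.∈-allFin _)))
    touched-from-face {d} (viaσ p) | zero = subst (λ y → y ∈ exceptional ⊎ Touched y)
      (sym (trans (sym (Λ-0 d)) (trans (cong (Λ d) (sym ℓ≡)) (trans (border d) (Λ-0 (σ d)))))) (touched-from-face p)
    touched-from-face {d} (viaα p) | zero = subst (λ y → y ∈ exceptional ⊎ Touched y)
      (sym (trans (sym (Λ-0 d)) (trans (cong lab (gap-rev d 0 z≤n λ ())) (trans (cong (Λ (rev d)) ℓ≡) (Λ-0 (rev d)))))) (touched-from-face p)

    touched : ∀ y → y ∈ exceptional ⊎ Touched y
    touched y with t , refl ← lab-onto y = go t
      where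
      face-case : ∀ d → lab (face (fc d)) ∈ exceptional ⊎ Touched (lab (face (fc d)))
      face-case d = touched-from-face (proj₂ (to-comp d))
      go : ∀ t → lab t ∈ exceptional ⊎ Touched (lab t)
      go (inj₁ x) with d , refl ← fc-onto x = face-case d
      go (inj₂ (inj₁ k)) with i , e , refl ← Finₚ.combine-surjective {q} {m} k with On? (𝒬 i) (e , false)
      ... | yes on = inj₂ ((e , false) , i , on , cong lab (gap-strand {i} {e} on))
      ... | no ¬on = subst (λ y → y ∈ exceptional ⊎ Touched y) (sym (junk-strand {i} {e} ¬on)) (face-case (e , false))
      go (inj₂ (inj₂ e)) with rung? e
      ... | no ¬rg = subst (λ y → y ∈ exceptional ⊎ Touched y) (sym (lab-half {e} ¬rg)) (face-case (e , false))
      ... | yes rg with i , oi , rk≡0 ← strand-at (e , true) 0 (subst (0 <_) (sym (two e true rg)) (s≤s z≤n)) =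
        inj₂ ((e , true) , i , oi , trans (cong (λ k → Λ (e , true) (suc k)) rk≡0) (cong lab (gap₁-cut {e} {1} (rg , refl))))

    exc? : ∀ y → Dec (y ∈ exceptional)
    exc? y = Any.any? (y Finₚ.≟_) exceptional

    triple : ∀ y → Dec (y ∈ exceptional) → List D
    triple y (yes _) = []
    triple y (no ∉ex) with touched y
    ... | inj₁ ex = contradiction ex ∉ex
    ... | inj₂ t  = proj₁ (three-sides ∉ex t)

    triple-unique : ∀ y (d? : Dec (y ∈ exceptional)) → Unique (triple y d?)
    triple-unique y (yes _) = []
    triple-unique y (no ∉ex) with touched y
    ... | inj₁ ex = contradiction ex ∉ex
    ... | inj₂ t  = proj₁ (proj₂ (proj₂ (three-sides ∉ex t)))

    triple-length : ∀ y (d? : Dec (y ∈ exceptional)) → length (triple y d?) ≡ 3 * 𝟙 (¬? d?)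
    triple-length y (yes _) = refl
    triple-length y (no ∉ex) with touched y
    ... | inj₁ ex = contradiction ex ∉ex
    ... | inj₂ t  = proj₁ (proj₂ (three-sides ∉ex t))

    triple-side : ∀ y (d? : Dec (y ∈ exceptional)) {d} → d ∈ triple y d? → Side y d
    triple-side y (no ∉ex) with touched y
    ... | inj₁ ex = contradiction ex ∉ex
    ... | inj₂ t  = proj₂ (proj₂ (proj₂ (three-sides ∉ex t)))

    -- A side `d` determines its region as `Λ d 1`, so the triples of different regions are
    -- disjoint, and a rung has only two darts.
    good-sides : 3 * count (¬? ∘ exc?) ≤ 2 * count rung?
    good-sides = ℕₚ.≤-trans (ℕₚ.≤-reflexive
        (trans (sym (sum-distribˡ-* 3 (𝟙 ∘ ¬? ∘ exc?))) (trans (sum-cong (λ y → sym (triple-length y (exc? y)))) (sym (length-concatMap-allFin pick)))))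
      (ℕₚ.≤-trans (⊆⇒length≤ (unique-concatMap pick (λ d → Λ d 1) (λ y → triple-unique y (exc? y)) (λ y d∈ → proj₂ (triple-side y (exc? y) d∈))) sub)
        (ℕₚ.≤-reflexive (trans (Listₚ.length-++ (map (_, false) rungs)) (trans (cong₂ _+_ (len false) (len true)) (cong (count rung? +_) (sym (ℕₚ.+-identityʳ _)))))))
      where
      pick : Fin N → List D
      pick y = triple y (exc? y)
      rungs : List (Fin m)
      rungs = filter rung? (allFin m)
      len : ∀ (b : Bool) → length (map (_, b) rungs) ≡ count rung?
      len b = trans (Listₚ.length-map (_, b) rungs) (count-filter rung?)
      sub : ∀ {d} → d ∈ concatMap pick (allFin N) → d ∈ map (_, false) rungs ++ map (_, true) rungs
      sub {d} d∈ with y , d∈y ← Any.satisfied (Memₚ.∈-concatMap⁻ pick {xs = allFin N} d∈) = place d (Memₚ.∈-filter⁺ rung? (Memₚ.∈-allFin _) (proj₁ (triple-side y (exc? y) d∈y)))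
        where
        place : ∀ d → edge G d ∈ rungs → d ∈ map (_, false) rungs ++ map (_, true) rungs
        place (e , false) e∈ = Memₚ.∈-++⁺ˡ (Memₚ.∈-map⁺ (_, false) e∈)
        place (e , true)  e∈ = Memₚ.∈-++⁺ʳ (map (_, false) rungs) (Memₚ.∈-map⁺ (_, true) e∈)

    -- Three times the Euler inequality, with the non-exceptional regions paid for by rung sides.
    -- The at most `2 * q + c` exceptional regions contribute `6 * q + 3 * c`, the Euler inequality
    -- another `3 * q`, and the terms in `c` cancel.
    rungs≤ : count rung? ≤ 9 * q
    rungs≤ = ℕₚ.+-cancelˡ-≤ (2 * E + 3 * c) _ _ (begin
      2 * E + 3 * c + E            ≡⟨ shuffle₁ E c ⟩
      3 * (E + c)                  ≤⟨ ℕₚ.*-monoʳ-≤ 3 euler-N ⟩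
      3 * (N + q)                  ≡⟨ cong (λ n → 3 * (n + q)) (sym (count-complement exc?)) ⟩
      3 * (bad + good + q)         ≡⟨ shuffle₂ bad good q ⟩
      3 * good + 3 * bad + 3 * q   ≤⟨ ℕₚ.+-monoˡ-≤ (3 * q) (ℕₚ.+-mono-≤ good-sides (ℕₚ.*-monoʳ-≤ 3 bad≤)) ⟩
      2 * E + 3 * (2 * q + c) + 3 * q ≡⟨ shuffle₃ E q c ⟩
      2 * E + 3 * c + 9 * q        ∎)
      where
      open ℕₚ.≤-Reasoning
      E bad good : ℕ
      E = count rung?
      bad = count exc?
      good = count (¬? ∘ exc?)
      bad≤ : bad ≤ 2 * q + c
      bad≤ = ℕₚ.≤-trans (count≤length exc? (λ _ x∈ → x∈)) exceptional-length
      shuffle₁ : ∀ E c → 2 * E + 3 * c + E ≡ 3 * (E + c)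
      shuffle₁ = solve-∀
      shuffle₂ : ∀ b g q → 3 * (b + g + q) ≡ 3 * g + 3 * b + 3 * q
      shuffle₂ = solve-∀
      shuffle₃ : ∀ E q c → 2 * E + 3 * (2 * q + c) + 3 * q ≡ 2 * E + 3 * c + 9 * q
      shuffle₃ = solve-∀

contacts≤ : (G : PlaneGraph) {q : ℕ} (𝒬 : Fin q → Path G) → (∀ i j → i ≢ j → ¬ Cross G (𝒬 i) (𝒬 j)) →
  (∀ i j d → i ≢ j → Trails.On G (𝒬 i) d → Trails.On G (𝒬 j) d → Trails.rest G (𝒬 i) d ≢ []) →
  (Rung : Fin (PlaneGraph.m G) → Set) (rung? : ∀ e → Dec (Rung e)) →
  (∀ e b → Rung e → count (λ i → Trails.On? G (𝒬 i) (e , b)) ≡ 2) →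
  (∀ {i j} {d d′ : Dart (PlaneGraph.m G)} → i ≢ j → Rung (proj₁ d) → Rung (proj₁ d′) → Trails.On G (𝒬 i) d → Trails.On G (𝒬 j) d →
    Trails.On G (𝒬 i) d′ → Trails.On G (𝒬 j) d′ → proj₁ d ≡ proj₁ d′) →
  count rung? ≤ 9 * q
contacts≤ G 𝒬 uncrossed proper Rung rung? two one with v , f , c , V , F , K , euler ← PlaneGraph.planar G =
  Contacts.rungs≤ G 𝒬 uncrossed proper V K F euler Rung rung?
    (λ e b rg → trans (Strands.ℓ-def G 𝒬 uncrossed proper (e , b)) (two e b rg)) (λ {i} {j} {d} {d′} → one {i} {j} {d} {d′})

-- Random samples as weighted sums over subsets.

ι : Bool → ℕ
ι true  = 1
ι false = 0

cons-fun : ∀ {p} → Bool → (Fin p → Bool) → Fin (suc p) → Bool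
cons-fun b s zero    = b
cons-fun b s (suc i) = s i

-- The sum of F over all subsets s, each weighted by w to the power of the size of its complement;
-- up to the factor (1 + w) ^ p this is the expectation over independent samples of rate 1 / (1 + w).
module Expectation (w : ℕ) where

  Ex : ∀ p → ((Fin p → Bool) → ℕ) → ℕ
  Ex zero    F = F (λ ())
  Ex (suc p) F = Ex p (F ∘ cons-fun true) + w * Ex p (F ∘ cons-fun false)

  Ex-mono : ∀ p {F F′ : (Fin p → Bool) → ℕ} → (∀ s → F s ≤ F′ s) → Ex p F ≤ Ex p F′
  Ex-mono zero    h = h _
  Ex-mono (suc p) h = ℕₚ.+-mono-≤ (Ex-mono p (h ∘ cons-fun true)) (ℕₚ.*-monoʳ-≤ w (Ex-mono p (h ∘ cons-fun false)))

  Ex-cong : ∀ p {F F′ : (Fin p → Bool) → ℕ} → (∀ s → F s ≡ F′ s) → Ex p F ≡ Ex p F′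
  Ex-cong zero    h = h _
  Ex-cong (suc p) h = cong₂ _+_ (Ex-cong p (h ∘ cons-fun true)) (cong (w *_) (Ex-cong p (h ∘ cons-fun false)))

  Ex-+ : ∀ p (F F′ : (Fin p → Bool) → ℕ) → Ex p (λ s → F s + F′ s) ≡ Ex p F + Ex p F′
  Ex-+ zero    F F′ = refl
  Ex-+ (suc p) F F′ = trans (cong₂ (λ a b → a + w * b) (Ex-+ p (F ∘ cons-fun true) (F′ ∘ cons-fun true)) (Ex-+ p (F ∘ cons-fun false) (F′ ∘ cons-fun false)))
    (shuffle w (Ex p (F ∘ cons-fun true)) (Ex p (F′ ∘ cons-fun true)) (Ex p (F ∘ cons-fun false)) (Ex p (F′ ∘ cons-fun false)))
    where
    shuffle : ∀ w a b c d → a + b + w * (c + d) ≡ a + w * c + (b + w * d)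
    shuffle = solve-∀

  Ex-* : ∀ p c (F : (Fin p → Bool) → ℕ) → Ex p (λ s → c * F s) ≡ c * Ex p F
  Ex-* zero    c F = refl
  Ex-* (suc p) c F = trans (cong₂ (λ a b → a + w * b) (Ex-* p c _) (Ex-* p c _)) (shuffle w c _ _)
    where
    shuffle : ∀ w c a b → c * a + w * (c * b) ≡ c * (a + w * b)
    shuffle = solve-∀

  Ex-0 : ∀ p → Ex p (λ _ → 0) ≡ 0
  Ex-0 p = Ex-* p 0 (λ _ → 0)

  Ex-sum : ∀ p {n} (F : Fin n → (Fin p → Bool) → ℕ) → Ex p (λ s → sum (λ i → F i s)) ≡ sum (λ i → Ex p (F i))
  Ex-sum p {zero}  F = Ex-0 p
  Ex-sum p {suc n} F = trans (Ex-+ p (F zero) _) (cong (Ex p (F zero) +_) (Ex-sum p (F ∘ suc)))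

  W : ℕ → ℕ
  W p = Ex p (λ _ → 1)

  0<W : ∀ p → 0 < W p
  0<W zero    = s≤s z≤n
  0<W (suc p) = ℕₚ.≤-trans (0<W p) (ℕₚ.m≤m+n _ _)

  -- Independence: `i` is sampled with probability `1 / (1 + w)`, whatever happens to a quantity
  -- that does not look at `i`.
  Ex-indep : ∀ p i (F : (Fin p → Bool) → ℕ) → (∀ s s′ → (∀ y → y ≢ i → s y ≡ s′ y) → F s ≡ F s′) →
             suc w * Ex p (λ s → ι (s i) * F s) ≡ Ex p F
  Ex-indep (suc p) zero F indep = begin
    suc w * (Ex p (λ s → 1 * F (cons-fun true s)) + w * Ex p (λ s → 0))
      ≡⟨ cong₂ (λ a b → suc w * (a + w * b)) (Ex-cong p (λ s → ℕₚ.*-identityˡ _)) (Ex-0 p) ⟩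
    suc w * (T + w * 0) ≡⟨ shuffle w T ⟩
    T + w * T           ≡⟨ cong (λ b → T + w * b) (Ex-cong p λ s → indep _ _ λ { zero ne → contradiction refl ne ; (suc y) _ → refl }) ⟩
    T + w * Ex p (λ s → F (cons-fun false s)) ∎
    where
    open ≡-Reasoning
    T = Ex p (λ s → F (cons-fun true s))
    shuffle : ∀ w T → suc w * (T + w * 0) ≡ T + w * T
    shuffle = solve-∀
  Ex-indep (suc p) (suc i) F indep =
    trans (shuffle w _ _) (cong₂ (λ a b → a + w * b) (Ex-indep p i (F ∘ cons-fun true) (ind true)) (Ex-indep p i (F ∘ cons-fun false) (ind false)))
    where
    ind : ∀ b s s′ → (∀ y → y ≢ i → s y ≡ s′ y) → F (cons-fun b s) ≡ F (cons-fun b s′)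
    ind b s s′ h = indep _ _ λ { zero _ → refl ; (suc y) ne → h y (λ eq → ne (cong suc eq)) }
    shuffle : ∀ w a b → suc w * (a + w * b) ≡ suc w * a + w * (suc w * b)
    shuffle = solve-∀

  Ex-point : ∀ {p} (i : Fin p) → suc w * Ex p (λ s → ι (s i)) ≡ W p
  Ex-point {p} i = trans (cong (suc w *_) (Ex-cong p λ s → sym (ℕₚ.*-identityʳ _))) (Ex-indep p i (λ _ → 1) λ _ _ _ → refl)

  Ex-pair : ∀ {p} {i j : Fin p} → i ≢ j → suc w * (suc w * Ex p (λ s → ι (s i) * ι (s j))) ≡ W p
  Ex-pair {p} {i} {j} i≢j = trans (cong (suc w *_) (Ex-indep p i (λ s → ι (s j)) λ s s′ h → cong ι (h j (i≢j ∘ sym)))) (Ex-point j)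

  Ex-triple : ∀ {p} {i j x : Fin p} → x ≢ i → x ≢ j →
              suc w * Ex p (λ s → ι (s x) * (ι (s i) * ι (s j))) ≡ Ex p (λ s → ι (s i) * ι (s j))
  Ex-triple {p} {i} {j} {x} x≢i x≢j = Ex-indep p x (λ s → ι (s i) * ι (s j))
    λ s s′ h → cong₂ (λ a b → ι a * ι b) (h i (x≢i ∘ sym)) (h j (x≢j ∘ sym))

  Ex-filter : ∀ {p} {A : Set} {P : (Fin p → Bool) → A → Set} (P? : ∀ s x → Dec (P s x)) (b c : ℕ) (xs : List A) →
              (∀ {x} → x ∈ xs → b ≤ c * Ex p (λ s → 𝟙 (P? s x))) → length xs * b ≤ c * Ex p (λ s → length (filter (P? s) xs))
  Ex-filter P? b c [] h = z≤n
  Ex-filter {p} P? b c (x ∷ xs) h = ℕₚ.≤-trans (ℕₚ.+-mono-≤ (h (here refl)) (Ex-filter P? b c xs (h ∘ there)))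
    (ℕₚ.≤-reflexive (trans (sym (ℕₚ.*-distribˡ-+ c _ _)) (cong (c *_) (trans (sym (Ex-+ p _ _)) (Ex-cong p cons-length)))))
    where
    cons-length : ∀ s → 𝟙 (P? s x) + length (filter (P? s) xs) ≡ length (filter (P? s) (x ∷ xs))
    cons-length s with P? s x
    ... | yes _ = refl
    ... | no _  = refl

-- Kept paths and good contacts of a fixed sample.

module Sampling (G : PlaneGraph) {p : ℕ} (𝒫 : Fin p → Path G)
                (uncrossed : ∀ i j → i ≢ j → ¬ Cross G (𝒫 i) (𝒫 j)) where
  open PlaneGraph G
  open Trails G
  open import Data.List.Membership.DecPropositional (Finₚ._≟_ {m}) using (_∈?_)

  es : Fin p → List (Fin m)
  es i = edges G (𝒫 i)

  end-edges : Fin p → List (Fin m)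
  end-edges i = take 1 (es i) ++ take 1 (reverse (es i))

  Hit : Fin p → Fin p → Set
  Hit i j = Any (_∈ es j) (end-edges i)

  hit? : ∀ i j → Dec (Hit i j)
  hit? i j = Any.any? (_∈? es j) (end-edges i)

  Contact : Set
  Contact = Fin p × Fin p × Fin m

  Valid : Contact → Set
  Valid (i , j , e) = i Fin.< j × e ∈ es i × e ∈ es j × ¬ Hit i j × ¬ Hit j i

  -- A third path that spoils the contact when sampled: it occupies the contact edge, or it causes
  -- one of the two paths to be discarded.
  Bad : Contact → Fin p → Set
  Bad (i , j , e) x = (x ≢ i × x ≢ j) × (e ∈ es x ⊎ Hit i x ⊎ Hit j x)

  bad? : ∀ t x → Dec (Bad t x)
  bad? (i , j , e) x = (¬? (x Finₚ.≟ i) ×-dec ¬? (x Finₚ.≟ j)) ×-dec (e ∈? es x ⊎-dec hit? i x ⊎-dec hit? j x)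

  Good : (Fin p → Bool) → Contact → Set
  Good s t@(i , j , _) = (s i ≡ true × s j ≡ true) × (∀ x → ¬ (Bad t x × s x ≡ true))

  good? : ∀ s t → Dec (Good s t)
  good? s t@(i , j , _) = (s i Boolₚ.≟ true ×-dec s j Boolₚ.≟ true) ×-dec Finₚ.all? (λ x → ¬? (bad? t x ×-dec s x Boolₚ.≟ true))

  abstract
    end-edge : ∀ {i d} → On (𝒫 i) d → rest (𝒫 i) d ≡ [] → edge G d ∈ end-edges i
    end-edge {i} {d} on eq with A , at ← On⇒rest (𝒫 i) {d} on with subst (At (𝒫 i) A d) eq at
    ... | inj₁ e = Memₚ.∈-++⁺ʳ (take 1 (es i)) (∈-take-1 (trans (cong (reverse ∘ map (edge G)) e)
                     (trans (cong reverse (Listₚ.map-++ (edge G) A (d ∷ []))) (Listₚ.reverse-++ (map (edge G) A) (edge G d ∷ [])))))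
    ... | inj₂ e = Memₚ.∈-++⁺ˡ (∈-take-1 (cong (map (edge G)) (trans (sym (rv-rv (Path.darts (𝒫 i)))) (trans (cong rv e) (rv-++ A (d ∷ []))))))

  module Sample (s : Fin p → Bool) (ts : List Contact) (unique : Unique ts) (valid : ∀ {t} → t ∈ ts → Valid t)
                (functional : ∀ {i j e e′} → (i , j , e) ∈ ts → (i , j , e′) ∈ ts → e ≡ e′) where

    -- Discarding the sampled paths with another sampled path on an end edge is what makes `proper`
    -- true of the others: no two of them share an edge on which one of them ends.
    Chosen : Fin p → Set
    Chosen i = s i ≡ true × (∀ x → ¬ ((x ≢ i × Hit i x) × s x ≡ true))

    chosen? : ∀ i → Dec (Chosen i)
    chosen? i = s i Boolₚ.≟ true ×-dec Finₚ.all? (λ x → ¬? ((¬? (x Finₚ.≟ i) ×-dec hit? i x) ×-dec s x Boolₚ.≟ true))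

    xs : List (Fin p)
    xs = filter chosen? (allFin p)

    q : ℕ
    q = length xs

    𝒬 : Fin q → Path G
    𝒬 a = 𝒫 (lookup xs a)

    Rung : Fin m → Set
    Rung e = Any (λ t → Good s t × proj₂ (proj₂ t) ≡ e) ts

    rung? : ∀ e → Dec (Rung e)
    rung? e = Any.any? (λ t → good? s t ×-dec proj₂ (proj₂ t) Finₚ.≟ e) ts

    abstract
      xs-unique : Unique xs
      xs-unique = Uniqueₚ.filter⁺ chosen? (Uniqueₚ.allFin⁺ p)

      chosen : ∀ a → Chosen (lookup xs a)
      chosen a = proj₂ (Memₚ.∈-filter⁻ chosen? {xs = allFin p} (Memₚ.∈-lookup {xs = xs} a))

      distinct : ∀ {a b} → a ≢ b → lookup xs a ≢ lookup xs b
      distinct {a} {b} a≢b eq = a≢b (lookup-injective xs-unique a b eq)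

      index : ∀ {i} → Chosen i → ∃ λ a → lookup xs a ≡ i
      index {i} ch = Any.index i∈ , sym (Anyₚ.lookup-index i∈)
        where
        i∈ : i ∈ xs
        i∈ = Memₚ.∈-filter⁺ chosen? (Memₚ.∈-allFin i) ch

      good-chosen : ∀ {i j e} → (i , j , e) ∈ ts → Good s (i , j , e) → Chosen i × Chosen j
      good-chosen {i} {j} {e} t∈ ((si , sj) , free) with i<j , _ , _ , ¬ij , ¬ji ← valid t∈ =
        (si , λ { x ((x≢i , hit) , sx) → free x (((x≢i , λ { refl → ¬ij hit }) , inj₂ (inj₁ hit)) , sx) }) ,
        (sj , λ { x ((x≢j , hit) , sx) → free x ((((λ { refl → ¬ji hit }) , x≢j) , inj₂ (inj₂ hit)) , sx) })

      users : ∀ {i j e x} → Good s (i , j , e) → s x ≡ true → e ∈ es x → x ≡ i ⊎ x ≡ j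
      users {i} {j} {e} {x} (_ , free) sx e∈ with x Finₚ.≟ i | x Finₚ.≟ j
      ... | yes p | _     = inj₁ p
      ... | no _  | yes p = inj₂ p
      ... | no ¬p | no ¬r = contradiction (((¬p , ¬r) , inj₁ e∈) , sx) (free x)

      same-pair : ∀ {i j i′ j′ e} → (i , j , e) ∈ ts → (i′ , j′ , e) ∈ ts → Good s (i , j , e) → Good s (i′ , j′ , e) → i ≡ i′ × j ≡ j′
      same-pair {i} {j} {i′} {j′} t∈ t∈′ g g′ with i<j , ei , ej , _ ← valid t∈ | i<j′ , ei′ , ej′ , _ ← valid t∈′
        with users {i′} {j′} g′ (proj₁ (proj₁ g)) ei | users {i′} {j′} g′ (proj₂ (proj₁ g)) ej
      ... | inj₁ refl | inj₂ refl = refl , refl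
      ... | inj₁ refl | inj₁ refl = contradiction i<j (Finₚ.<-irrefl refl)
      ... | inj₂ refl | inj₂ refl = contradiction i<j (Finₚ.<-irrefl refl)
      ... | inj₂ refl | inj₁ refl = contradiction i<j (Finₚ.<-asym i<j′)

      rungs≤q : count rung? ≤ 9 * q
      rungs≤q = contacts≤ G 𝒬 (λ a b a≢b → uncrossed _ _ (distinct a≢b)) proper Rung rung? two (λ {a} {b} {d} {d′} → one {a} {b} {d} {d′})
        where
        proper : ∀ a b d → a ≢ b → On (𝒬 a) d → On (𝒬 b) d → rest (𝒬 a) d ≢ []
        proper a b d a≢b oa ob eq = proj₂ (chosen a) (lookup xs b)
          ((distinct a≢b ∘ sym , Any.map (λ { refl → ob }) (end-edge {lookup xs a} {d} oa eq)) , proj₁ (chosen b))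
        two : ∀ e b → Rung e → count (λ a → On? (𝒬 a) (e , b)) ≡ 2
        two e b rg with (i , j , _) , t∈ , (g , refl) ← find rg
          with (ci , cj) ← good-chosen t∈ g with i<j , ei , ej , _ ← valid t∈
          with a , refl ← index ci | a′ , refl ← index cj =
          ℕₚ.≤-antisym (count≤length (λ a → On? (𝒬 a) (e , b)) {a ∷ a′ ∷ []} only)
            (unique-length≤count (λ a → On? (𝒬 a) (e , b)) {a ∷ a′ ∷ []} (((λ { refl → Finₚ.<-irrefl refl i<j }) ∷ []) ∷ [] ∷ []) λ { (here refl) → ei ; (there (here refl)) → ej })
          where
          only : ∀ x → On (𝒬 x) (e , b) → x ∈ a ∷ a′ ∷ []
          only x on with users g (proj₁ (chosen x)) on
          ... | inj₁ eq = here (lookup-injective xs-unique x a eq)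
          ... | inj₂ eq = there (here (lookup-injective xs-unique x a′ eq))
        one : ∀ {a b} {d d′ : D} → a ≢ b → Rung (proj₁ d) → Rung (proj₁ d′) → On (𝒬 a) d → On (𝒬 b) d → On (𝒬 a) d′ → On (𝒬 b) d′ → proj₁ d ≡ proj₁ d′
        one {a} {b} a≢b rg rg′ oa ob oa′ ob′ with (i , j , e) , t∈ , (g , refl) ← find rg | (i′ , j′ , e′) , t∈′ , (g′ , refl) ← find rg′
          = pick (users g (proj₁ (chosen a)) oa) (users g (proj₁ (chosen b)) ob) (users g′ (proj₁ (chosen a)) oa′) (users g′ (proj₁ (chosen b)) ob′)
          where
          x y : Fin p
          x = lookup xs a
          y = lookup xs b
          lt : i Fin.< j
          lt = proj₁ (valid t∈)
          lt′ : i′ Fin.< j′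
          lt′ = proj₁ (valid t∈′)
          pick : x ≡ i ⊎ x ≡ j → y ≡ i ⊎ y ≡ j → x ≡ i′ ⊎ x ≡ j′ → y ≡ i′ ⊎ y ≡ j′ → e ≡ e′
          pick (inj₁ p) (inj₁ r) _ _ = contradiction (trans p (sym r)) (distinct a≢b)
          pick (inj₂ p) (inj₂ r) _ _ = contradiction (trans p (sym r)) (distinct a≢b)
          pick _ _ (inj₁ p) (inj₁ r) = contradiction (trans p (sym r)) (distinct a≢b)
          pick _ _ (inj₂ p) (inj₂ r) = contradiction (trans p (sym r)) (distinct a≢b)
          pick (inj₁ p) (inj₂ r) (inj₁ p′) (inj₂ r′) = functional t∈ (subst₂ (λ u v → (u , v , e′) ∈ ts) (trans (sym p′) p) (trans (sym r′) r) t∈′)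
          pick (inj₂ p) (inj₁ r) (inj₂ p′) (inj₁ r′) = functional t∈ (subst₂ (λ u v → (u , v , e′) ∈ ts) (trans (sym r′) r) (trans (sym p′) p) t∈′)
          pick (inj₁ p) (inj₂ r) (inj₂ p′) (inj₁ r′) = contradiction (subst₂ Fin._<_ (trans (sym r′) r) (trans (sym p′) p) lt′) (Finₚ.<-asym lt)
          pick (inj₂ p) (inj₁ r) (inj₁ p′) (inj₂ r′) = contradiction (subst₂ Fin._<_ (trans (sym p′) p) (trans (sym r′) r) lt′) (Finₚ.<-asym lt)

      -- No third sampled path lies on the edge of a good contact, so the edge determines the pair
      -- and distinct good contacts are distinct rungs.
      good≤ : length (filter (good? s) ts) ≤ 9 * sum (ι ∘ s)
      good≤ = ℕₚ.≤-trans (length≤-injective (proj₂ ∘ proj₂) (Uniqueₚ.filter⁺ (good? s) unique) inj into)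
        (ℕₚ.≤-trans (ℕₚ.≤-reflexive (count-filter rung?)) (ℕₚ.≤-trans rungs≤q (ℕₚ.*-monoʳ-≤ 9
          (ℕₚ.≤-trans (ℕₚ.≤-reflexive (count-filter chosen?)) (sum-mono λ i → chosen≤ i (chosen? i))))))
        where
        split : ∀ {t} → t ∈ filter (good? s) ts → t ∈ ts × Good s t
        split = Memₚ.∈-filter⁻ (good? s)
        inj : ∀ {t t′} → t ∈ filter (good? s) ts → t′ ∈ filter (good? s) ts → proj₂ (proj₂ t) ≡ proj₂ (proj₂ t′) → t ≡ t′
        inj {i , j , e} {i′ , j′ , e} t∈ t∈′ refl with refl , refl ← same-pair (proj₁ (split t∈)) (proj₁ (split t∈′)) (proj₂ (split t∈)) (proj₂ (split t∈′)) = refl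
        into : ∀ {t} → t ∈ filter (good? s) ts → proj₂ (proj₂ t) ∈ filter rung? (allFin m)
        into t∈ with t∈ts , g ← split t∈ = Memₚ.∈-filter⁺ rung? (Memₚ.∈-allFin _) (Any.map (λ { refl → g , refl }) t∈ts)
        chosen≤ : ∀ i (ch : Dec (Chosen i)) → 𝟙 ch ≤ ι (s i)
        chosen≤ i (no _) = z≤n
        chosen≤ i (yes (si , _)) rewrite si = s≤s z≤n

-- The average degree of the sharing graph.

module Density (G : PlaneGraph) {p : ℕ} (𝒫 : Fin p → Path G)
               (uncrossed : ∀ i j → i ≢ j → ¬ Cross G (𝒫 i) (𝒫 j))
               (k′ : ℕ) (load≤ : ∀ e → load G 𝒫 e ≤ suc k′) where
  open PlaneGraph G
  open Sampling G 𝒫 uncrossed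
  -- The weight is `10 * k - 1`, so that `rate` is `10 * k`, twice the bound `5 * k` on the number
  -- of bad paths.
  open Expectation (9 + 10 * k′)
  open import Data.List.Membership.DecPropositional (Finₚ._≟_ {m}) using (_∈?_)

  k rate : ℕ
  k = suc k′
  rate = suc (9 + 10 * k′)

  abstract
    users≤k : ∀ e → count (λ i → e ∈? es i) ≤ k
    users≤k e = ℕₚ.≤-trans (ℕₚ.≤-reflexive (sym (count-filter (λ i → e ∈? es i)))) (load≤ e)

    hits≤ : ∀ i → count (hit? i) ≤ 2 * k
    hits≤ i = ℕₚ.≤-trans (any≤ (end-edges i)) (ℕₚ.*-monoˡ-≤ k (ℕₚ.≤-trans (ℕₚ.≤-reflexive (Listₚ.length-++ (take 1 (es i))))
      (ℕₚ.+-mono-≤ (length-take-1 (es i)) (length-take-1 (reverse (es i))))))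
      where
      any≤ : ∀ xs → count (λ j → Any.any? (_∈? es j) xs) ≤ length xs * k
      any≤ [] = ℕₚ.≤-reflexive (sum-zero {p} λ _ → refl)
      any≤ (x ∷ xs) = ℕₚ.≤-trans (sum-mono split) (ℕₚ.≤-trans (ℕₚ.≤-reflexive (sum-distrib-+ (λ j → 𝟙 (x ∈? es j)) (λ j → 𝟙 (Any.any? (_∈? es j) xs)))) (ℕₚ.+-mono-≤ (users≤k x) (any≤ xs)))
        where
        split : ∀ j → 𝟙 (Any.any? (_∈? es j) (x ∷ xs)) ≤ 𝟙 (x ∈? es j) + 𝟙 (Any.any? (_∈? es j) xs)
        split j = 𝟙-⊎ (Any.any? (_∈? es j) (x ∷ xs)) (x ∈? es j) (Any.any? (_∈? es j) xs) λ { (here x∈) → inj₁ x∈ ; (there h) → inj₂ h }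

    bad≤ : ∀ t → count (bad? t) ≤ 5 * k
    bad≤ t@(i , j , e) = ℕₚ.≤-trans (sum-mono split) (ℕₚ.≤-trans (ℕₚ.≤-reflexive (trans (sum-distrib-+ (λ x → 𝟙 (e ∈? es x)) (λ x → 𝟙 (hit? i x) + 𝟙 (hit? j x)))
        (cong (count (λ x → e ∈? es x) +_) (sum-distrib-+ (𝟙 ∘ hit? i) (𝟙 ∘ hit? j)))))
      (ℕₚ.≤-trans (ℕₚ.+-mono-≤ (users≤k e) (ℕₚ.+-mono-≤ (hits≤ i) (hits≤ j))) (ℕₚ.≤-reflexive (shuffle k))))
      where
      shuffle : ∀ k → k + (2 * k + 2 * k) ≡ 5 * k
      shuffle = solve-∀
      split : ∀ x → 𝟙 (bad? t x) ≤ 𝟙 (e ∈? es x) + (𝟙 (hit? i x) + 𝟙 (hit? j x))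
      split x = ℕₚ.≤-trans (𝟙-⊎ (bad? t x) (e ∈? es x) (hit? i x ⊎-dec hit? j x) proj₂)
        (ℕₚ.+-monoʳ-≤ (𝟙 (e ∈? es x)) (𝟙-⊎ (hit? i x ⊎-dec hit? j x) (hit? i x) (hit? j x) id))

    -- If both paths are sampled and the contact is not good, some bad path is sampled, and its term
    -- in the sum is 1.
    union-bound : ∀ i j e s →
      ι (s i) * ι (s j) ≤ 𝟙 (good? s (i , j , e)) + sum (λ x → 𝟙 (bad? (i , j , e) x) * (ι (s x) * (ι (s i) * ι (s j))))
    union-bound i j e s = go (s i) (s j) refl refl
      where
      t : Contact
      t = i , j , e
      go : ∀ a b → s i ≡ a → s j ≡ b → ι a * ι b ≤ 𝟙 (good? s t) + sum (λ x → 𝟙 (bad? t x) * (ι (s x) * (ι a * ι b)))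
      go false _     _  _  = z≤n
      go true  false _  _  = z≤n
      go true  true  si sj with Finₚ.any? (λ x → bad? t x ×-dec s x Boolₚ.≟ true)
      ... | no none = ℕₚ.≤-trans (ℕₚ.≤-reflexive (sym (𝟙-yes (good? s t) ((si , sj) , λ x h → none (x , h))))) (ℕₚ.m≤m+n _ _)
      ... | yes (x , bd , sx) = ℕₚ.≤-trans (ℕₚ.≤-trans (ℕₚ.≤-reflexive (sym (cong₂ (λ a b → a * (ι b * 1)) (𝟙-yes (bad? t x) bd) sx)))
              (term≤sum (λ x → 𝟙 (bad? t x) * (ι (s x) * 1)) x)) (ℕₚ.m≤n+m _ _)

    -- Each of the at most `5 * k` bad paths is sampled with probability `1 / (10 * k)`,
    -- independently of `i` and `j`. So, given that both are sampled, the contact is good with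
    -- probability at least one half.
    good-often : ∀ {t} → Valid t → W p ≤ 2 * (rate * rate) * Ex p (λ s → 𝟙 (good? s t))
    good-often {t@(i , j , e)} val = begin
      W p                              ≡⟨ sym (Ex-pair i≢j) ⟩
      rate * (rate * w₂)               ≤⟨ ℕₚ.*-monoʳ-≤ rate (ℕₚ.*-monoʳ-≤ rate w₂≤) ⟩
      rate * (rate * (2 * g))          ≡⟨ shuffle₁ rate g ⟩
      2 * (rate * rate) * g            ∎
      where
      open ℕₚ.≤-Reasoning
      i≢j : i ≢ j
      i≢j eq = Finₚ.<-irrefl eq (proj₁ val)
      w₂ g : ℕ
      w₂ = Ex p (λ s → ι (s i) * ι (s j))
      g = Ex p (λ s → 𝟙 (good? s t))
      shuffle₁ : ∀ r g → r * (r * (2 * g)) ≡ 2 * (r * r) * g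
      shuffle₁ = solve-∀
      triple : Fin p → (Fin p → Bool) → ℕ
      triple x s = ι (s x) * (ι (s i) * ι (s j))
      bads : ℕ
      bads = sum (λ x → 𝟙 (bad? t x) * Ex p (triple x))
      step : w₂ ≤ g + bads
      step = ℕₚ.≤-trans (Ex-mono p (union-bound i j e)) (ℕₚ.≤-reflexive (trans (Ex-+ p (λ s → 𝟙 (good? s t)) (λ s → sum (λ x → 𝟙 (bad? t x) * triple x s))) (cong (g +_)
        (trans (Ex-sum p (λ x s → 𝟙 (bad? t x) * triple x s)) (sum-cong λ x → Ex-* p (𝟙 (bad? t x)) (triple x))))))
      bads≤ : rate * bads ≤ 5 * k * w₂
      bads≤ = ℕₚ.≤-trans (ℕₚ.≤-reflexive (trans (sym (sum-distribˡ-* rate (λ x → 𝟙 (bad? t x) * Ex p (triple x)))) (trans (sum-cong each) (sum-distribˡ-* w₂ (𝟙 ∘ bad? t)))))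
        (ℕₚ.≤-trans (ℕₚ.*-monoʳ-≤ w₂ (bad≤ t)) (ℕₚ.≤-reflexive (ℕₚ.*-comm w₂ (5 * k))))
        where
        each : ∀ x → rate * (𝟙 (bad? t x) * Ex p (λ s → ι (s x) * (ι (s i) * ι (s j)))) ≡ w₂ * 𝟙 (bad? t x)
        each x = go (bad? t x)
          where
          go : (b : Dec (Bad t x)) → rate * (𝟙 b * Ex p (λ s → ι (s x) * (ι (s i) * ι (s j)))) ≡ w₂ * 𝟙 b
          go (no _) = trans (ℕₚ.*-zeroʳ rate) (sym (ℕₚ.*-zeroʳ w₂))
          go (yes ((x≢i , x≢j) , _)) = trans (cong (rate *_) (ℕₚ.*-identityˡ (Ex p (triple x)))) (trans (Ex-triple {p} {i} {j} {x} x≢i x≢j) (sym (ℕₚ.*-identityʳ w₂)))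
      w₂≤ : w₂ ≤ 2 * g
      w₂≤ = ℕₚ.*-cancelˡ-≤ (5 * k) (ℕₚ.+-cancelˡ-≤ (5 * k * w₂) _ _ (begin
        5 * k * w₂ + 5 * k * w₂     ≡⟨ shuffle₂ k′ w₂ ⟩
        rate * w₂                   ≤⟨ ℕₚ.*-monoʳ-≤ rate step ⟩
        rate * (g + bads)           ≡⟨ ℕₚ.*-distribˡ-+ rate g bads ⟩
        rate * g + rate * bads      ≤⟨ ℕₚ.+-monoʳ-≤ (rate * g) bads≤ ⟩
        rate * g + 5 * k * w₂       ≡⟨ shuffle₃ k′ g w₂ ⟩
        5 * k * w₂ + 5 * k * (2 * g) ∎))
        where
        shuffle₂ : ∀ k′ w → 5 * suc k′ * w + 5 * suc k′ * w ≡ suc (9 + 10 * k′) * w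
        shuffle₂ = solve-∀
        shuffle₃ : ∀ k′ g w → suc (9 + 10 * k′) * g + 5 * suc k′ * w ≡ 5 * suc k′ * w + 5 * suc k′ * (2 * g)
        shuffle₃ = solve-∀

    -- The expected number of good contacts is at least `length ts / (2 * rate * rate)` and at most
    -- 9 times the expected sample size `p / rate`. This leaves `18 * rate * p`, which is
    -- `180 * k * p`.
    contacts-bound : (ts : List Contact) → Unique ts → (∀ {t} → t ∈ ts → Valid t) →
      (∀ {i j e e′} → (i , j , e) ∈ ts → (i , j , e′) ∈ ts → e ≡ e′) → length ts ≤ 180 * k * p
    contacts-bound ts unique valid functional = ℕₚ.*-cancelʳ-≤ (length ts) (180 * k * p) (W p) ⦃ >-nonZero (0<W p) ⦄ (begin
      length ts * W p                                    ≤⟨ Ex-filter good? (W p) (2 * (rate * rate)) ts (good-often ∘ valid) ⟩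
      2 * (rate * rate) * Ex p (λ s → length (filter (good? s) ts)) ≤⟨ ℕₚ.*-monoʳ-≤ (2 * (rate * rate)) (Ex-mono p λ s → Sample.good≤ s ts unique valid functional) ⟩
      2 * (rate * rate) * Ex p (λ s → 9 * sum (ι ∘ s))   ≡⟨ cong (2 * (rate * rate) *_) (trans (Ex-* p 9 (λ s → sum (ι ∘ s))) (cong (9 *_) (Ex-sum p (λ i s → ι (s i))))) ⟩
      2 * (rate * rate) * (9 * S)                        ≡⟨ shuffle₁ rate S ⟩
      18 * rate * (rate * S)                             ≡⟨ cong (18 * rate *_) (trans (sym (sum-distribˡ-* rate (λ i → Ex p (λ s → ι (s i))))) (trans (sum-cong (λ i → Ex-point {p} i)) (sum-const p (W p)))) ⟩
      18 * rate * (p * W p)                              ≡⟨ shuffle₂ k′ p (W p) ⟩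
      180 * k * p * W p                                  ∎)
      where
      open ℕₚ.≤-Reasoning
      S : ℕ
      S = sum (λ i → Ex p (λ s → ι (s i)))
      shuffle₁ : ∀ r S → 2 * (r * r) * (9 * S) ≡ 18 * r * (r * S)
      shuffle₁ = solve-∀
      shuffle₂ : ∀ k′ p w → 18 * suc (9 + 10 * k′) * (p * w) ≡ 180 * suc k′ * p * w
      shuffle₂ = solve-∀

  Shares : Fin p → Fin p → Set
  Shares i j = Share G 𝒫 i j

  shares? : ∀ i j → Dec (Shares i j)
  shares? i j = Any.any? (_∈? es j) (es i)

  Clean : Fin p → Fin p → Set
  Clean i j = i Fin.< j × Shares i j × ¬ Hit i j × ¬ Hit j i

  clean? : ∀ i j → Dec (Clean i j)
  clean? i j = (i Finₚ.<? j) ×-dec shares? i j ×-dec ¬? (hit? i j) ×-dec ¬? (hit? j i)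

  contact : ∀ i j → Dec (Clean i j) → List Contact
  contact i j (yes (_ , sh , _)) = (i , j , Any.lookup sh) ∷ []
  contact i j (no _)             = []

  contacts-of : Fin p → List Contact
  contacts-of i = concatMap (λ j → contact i j (clean? i j)) (allFin p)

  Neighbours : Fin p → Fin p → Set
  Neighbours i j = i ≢ j × Shares i j

  neighbours? : ∀ i j → Dec (Neighbours i j)
  neighbours? i j = ¬? (i Finₚ.≟ j) ×-dec shares? i j

  degree : Fin p → ℕ
  degree i = count (neighbours? i)

  abstract
    shares-sym : ∀ {i j} → Shares i j → Shares j i
    shares-sym sh with e , e∈i , e∈j ← find sh = Any.map (λ { refl → e∈i }) e∈j

    contact-keys : ∀ i j c {t} → t ∈ contact i j c → proj₁ t ≡ i × proj₁ (proj₂ t) ≡ j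
    contact-keys i j (yes _) (here refl) = refl , refl

    ∈-contacts : ∀ {t} → t ∈ concatMap contacts-of (allFin p) → t ∈ contact (proj₁ t) (proj₁ (proj₂ t)) (clean? (proj₁ t) (proj₁ (proj₂ t)))
    ∈-contacts {t} t∈ with i , t∈i ← Any.satisfied (Memₚ.∈-concatMap⁻ contacts-of {xs = allFin p} t∈)
      with j , t∈ij ← Any.satisfied (Memₚ.∈-concatMap⁻ (λ j → contact i j (clean? i j)) {xs = allFin p} t∈i)
      with refl , refl ← contact-keys i j (clean? i j) t∈ij = t∈ij

    clean≤ : sum (λ i → count (clean? i)) ≤ 180 * k * p
    clean≤ = ℕₚ.≤-trans (ℕₚ.≤-reflexive (sym (trans (length-concatMap-allFin contacts-of)
        (sum-cong λ i → trans (length-concatMap-allFin (λ j → contact i j (clean? i j))) (sum-cong λ j → len i j (clean? i j))))))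
      (contacts-bound (concatMap contacts-of (allFin p)) unique (λ t∈ → valid _ _ (clean? _ _) (∈-contacts t∈)) functional)
      where
      len : ∀ i j (c : Dec (Clean i j)) → length (contact i j c) ≡ 𝟙 c
      len i j (yes _) = refl
      len i j (no _)  = refl
      single : ∀ i j c → Unique (contact i j c)
      single i j (yes _) = [] ∷ []
      single i j (no _)  = []
      inner : ∀ i {t} → t ∈ contacts-of i → proj₁ t ≡ i
      inner i t∈ with j , t∈ij ← Any.satisfied (Memₚ.∈-concatMap⁻ (λ j → contact i j (clean? i j)) {xs = allFin p} t∈) = proj₁ (contact-keys i j (clean? i j) t∈ij)
      unique : Unique (concatMap contacts-of (allFin p))
      unique = unique-concatMap contacts-of proj₁
        (λ i → unique-concatMap (λ j → contact i j (clean? i j)) (proj₁ ∘ proj₂) (λ j → single i j (clean? i j)) (λ j t∈ → proj₂ (contact-keys i j (clean? i j) t∈)))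
        inner
      valid : ∀ i j c {t} → t ∈ contact i j c → Valid t
      valid i j (yes (i<j , sh , ¬h , ¬h′)) (here refl) = i<j , Memₚ.∈-lookup (Any.index sh) , Anyₚ.lookup-result sh , ¬h , ¬h′
      functional : ∀ {i j e e′} → (i , j , e) ∈ concatMap contacts-of (allFin p) → (i , j , e′) ∈ concatMap contacts-of (allFin p) → e ≡ e′
      functional {i} {j} t∈ t∈′ = go (clean? i j) (∈-contacts t∈) (∈-contacts t∈′)
        where
        go : ∀ {e e′} c → (i , j , e) ∈ contact i j c → (i , j , e′) ∈ contact i j c → e ≡ e′
        go (yes _) (here refl) (here refl) = refl

    -- An ordered pair of neighbours is accounted for by a hit one way or the other, or by a clean
    -- pair in one of the two orders. These four double sums are at most `2kp`, `2kp`, `180kp` and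
    -- `180kp`.
    degree-sum : sum degree ≤ 364 * k * p
    degree-sum = begin
      sum degree
        ≤⟨ sum-mono (λ i → sum-mono (λ j → split i j)) ⟩
      sum (λ i → sum (λ j → (H i j + H j i) + (C i j + C j i)))
        ≡⟨ sum-cong (λ i → trans (sum-distrib-+ (λ j → H i j + H j i) (λ j → C i j + C j i))
             (cong₂ _+_ (sum-distrib-+ (H i) (λ j → H j i)) (sum-distrib-+ (C i) (λ j → C j i)))) ⟩
      sum (λ i → (sum (H i) + sum (λ j → H j i)) + (sum (C i) + sum (λ j → C j i)))
        ≡⟨ trans (sum-distrib-+ (λ i → sum (H i) + sum (λ j → H j i)) (λ i → sum (C i) + sum (λ j → C j i)))
             (cong₂ _+_ (sum-distrib-+ (λ i → sum (H i)) (λ i → sum (λ j → H j i))) (sum-distrib-+ (λ i → sum (C i)) (λ i → sum (λ j → C j i)))) ⟩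
      (ΣH + sum (λ i → sum (λ j → H j i))) + (ΣC + sum (λ i → sum (λ j → C j i)))
        ≡⟨ cong₂ (λ a b → (ΣH + a) + (ΣC + b)) (sum-comm (λ i j → H j i)) (sum-comm (λ i j → C j i)) ⟩
      (ΣH + ΣH) + (ΣC + ΣC)
        ≤⟨ ℕₚ.+-mono-≤ (ℕₚ.+-mono-≤ H≤ H≤) (ℕₚ.+-mono-≤ clean≤ clean≤) ⟩
      (p * (2 * k) + p * (2 * k)) + (180 * k * p + 180 * k * p)
        ≡⟨ shuffle k p ⟩
      364 * k * p ∎
      where
      open ℕₚ.≤-Reasoning
      H C : Fin p → Fin p → ℕ
      H i j = 𝟙 (hit? i j)
      C i j = 𝟙 (clean? i j)
      ΣH ΣC : ℕ
      ΣH = sum (λ i → sum (H i))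
      ΣC = sum (λ i → sum (C i))
      shuffle : ∀ k p → (p * (2 * k) + p * (2 * k)) + (180 * k * p + 180 * k * p) ≡ 364 * k * p
      shuffle = solve-∀
      H≤ : ΣH ≤ p * (2 * k)
      H≤ = ℕₚ.≤-trans (sum-mono hits≤) (ℕₚ.≤-reflexive (sum-const p (2 * k)))
      classify : ∀ i j → Neighbours i j → (Hit i j ⊎ Hit j i) ⊎ (Clean i j ⊎ Clean j i)
      classify i j (i≢j , sh) with hit? i j | hit? j i | Finₚ.<-cmp i j
      ... | yes h | _      | _           = inj₁ (inj₁ h)
      ... | no _  | yes h  | _           = inj₁ (inj₂ h)
      ... | no ¬h | no ¬h′ | tri< lt _ _ = inj₂ (inj₁ (lt , sh , ¬h , ¬h′))
      ... | no ¬h | no ¬h′ | tri> _ _ gt = inj₂ (inj₂ (gt , shares-sym {i} {j} sh , ¬h′ , ¬h))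
      ... | no _  | no _   | tri≈ _ eq _ = contradiction eq i≢j
      split : ∀ i j → 𝟙 (neighbours? i j) ≤ (H i j + H j i) + (C i j + C j i)
      split i j = ℕₚ.≤-trans (𝟙-⊎ (neighbours? i j) (hit? i j ⊎-dec hit? j i) (clean? i j ⊎-dec clean? j i) (classify i j))
        (ℕₚ.+-mono-≤ (𝟙-⊎ (hit? i j ⊎-dec hit? j i) (hit? i j) (hit? j i) id) (𝟙-⊎ (clean? i j ⊎-dec clean? j i) (clean? i j) (clean? j i) id))

    low-degree : Fin p → ∃ λ i → degree i ≤ 364 * k
    low-degree i₀ with Finₚ.any? (λ i → degree i ≤? 364 * k)
    ... | yes hit = hit
    ... | no none = contradiction (ℕₚ.<-≤-trans (sum-mono-< (λ i → ℕₚ.<⇒≤ (ℕₚ.≰⇒> λ le → none (i , le))) i₀ (ℕₚ.≰⇒> λ le → none (i₀ , le)))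
        (ℕₚ.≤-trans degree-sum (ℕₚ.≤-reflexive (trans (ℕₚ.*-comm (364 * k) p) (sym (sum-const p (364 * k))))))) (ℕₚ.<-irrefl refl)

-- Greedy colouring by removal of a path of low degree.

sum-punchIn : ∀ {n} (f : Fin (suc n) → ℕ) i → sum (f ∘ punchIn i) ≤ sum f
sum-punchIn {n}     f zero    = ℕₚ.m≤n+m _ _
sum-punchIn {suc n} f (suc i) = ℕₚ.+-monoʳ-≤ (f zero) (sum-punchIn (f ∘ suc) i)

module Greedy {p C : ℕ} {R : Fin (suc p) → Fin (suc p) → Set} (R-sym : ∀ {i j} → R i j → R j i)
              (v : Fin (suc p)) (near? : ∀ j → Dec (v ≢ j × R v j)) (few : count near? ≤ C)
              (old : Fin p → Fin (suc C)) (old-proper : ∀ i j → i ≢ j → R (punchIn v i) (punchIn v j) → old i ≢ old j) where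

  private
    paint : Fin (suc C) → (j : Fin (suc p)) → Dec (v ≡ j) → Fin (suc C)
    paint a j (yes _)  = a
    paint a j (no v≢j) = old (punchOut v≢j)

    near : List (Fin (suc p))
    near = filter near? (allFin (suc p))

    used : List (Fin (suc C))
    used = map (λ j → paint zero j (v Finₚ.≟ j)) near

    free : ∃ λ a → a ∉ used
    free with Finₚ.any? (λ a → ¬? (Any.any? (a Finₚ.≟_) used))
    ... | yes hit = hit
    ... | no none = contradiction
      (ℕₚ.≤-trans (ℕₚ.≤-trans (ℕₚ.≤-reflexive (sym (Listₚ.length-tabulate {n = suc C} id)))
          (⊆⇒length≤ (Uniqueₚ.allFin⁺ (suc C)) (λ {a} _ → everywhere a)))
        (ℕₚ.≤-trans (ℕₚ.≤-reflexive (trans (Listₚ.length-map (λ j → paint zero j (v Finₚ.≟ j)) near) (count-filter near?))) few))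
      ℕₚ.1+n≰n
      where
      everywhere : ∀ a → a ∈ used
      everywhere a with Any.any? (a Finₚ.≟_) used
      ... | yes a∈ = a∈
      ... | no a∉  = contradiction (a , a∉) none

    fresh : ∀ {j} (v≢j : v ≢ j) → R v j → proj₁ free ≢ old (punchOut v≢j)
    fresh {j} v≢j r eq = proj₂ free (subst (_∈ used) (trans (same (v Finₚ.≟ j)) (sym eq))
      (Memₚ.∈-map⁺ (λ j → paint zero j (v Finₚ.≟ j)) (Memₚ.∈-filter⁺ near? (Memₚ.∈-allFin j) (v≢j , r))))
      where
      same : (d : Dec (v ≡ j)) → paint zero j d ≡ old (punchOut v≢j)
      same (yes v≡j) = contradiction v≡j v≢j
      same (no _)    = cong old (Finₚ.punchOut-cong v refl)

    paint-proper : ∀ {i j} (d : Dec (v ≡ i)) (d′ : Dec (v ≡ j)) → i ≢ j → R i j → paint (proj₁ free) i d ≢ paint (proj₁ free) j d′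
    paint-proper (yes refl) (yes refl) i≢j _ = contradiction refl i≢j
    paint-proper (yes refl) (no v≢j)   _   r = fresh v≢j r
    paint-proper (no v≢i)   (yes refl) _   r = fresh v≢i (R-sym r) ∘ sym
    paint-proper (no v≢i)   (no v≢j)   i≢j r = old-proper _ _ (i≢j ∘ Finₚ.punchOut-injective v≢i v≢j)
      (subst₂ R (sym (Finₚ.punchIn-punchOut v≢i)) (sym (Finₚ.punchIn-punchOut v≢j)) r)

  extended : Σ (Fin (suc p) → Fin (suc C)) λ col → ∀ i j → i ≢ j → R i j → col i ≢ col j
  extended = (λ j → paint (proj₁ free) j (v Finₚ.≟ j)) , λ i j → paint-proper (v Finₚ.≟ i) (v Finₚ.≟ j)

load-punchIn : (G : PlaneGraph) {p : ℕ} (𝒫 : Fin (suc p) → Path G) → ∀ v e → load G (𝒫 ∘ punchIn v) e ≤ load G 𝒫 e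
load-punchIn G 𝒫 v e = ℕₚ.≤-trans (ℕₚ.≤-reflexive (count-filter (λ i → e ∈? edges G (𝒫 (punchIn v i)))))
  (ℕₚ.≤-trans (sum-punchIn (λ i → 𝟙 (e ∈? edges G (𝒫 i))) v) (ℕₚ.≤-reflexive (sym (count-filter (λ i → e ∈? edges G (𝒫 i))))))
  where open import Data.List.Membership.DecPropositional (Finₚ._≟_ {PlaneGraph.m G}) using (_∈?_)

-- Removing a path preserves both the load bound and uncrossedness, so the low-degree bound applies
-- to every remaining subfamily and the removed path always finds a free colour on its return.
colourable : (G : PlaneGraph) (k : ℕ) → ∀ p (𝒫 : Fin p → Path G) → (∀ i j → i ≢ j → ¬ Cross G (𝒫 i) (𝒫 j)) →
             (∀ e → load G 𝒫 e ≤ suc k) → ColourableU G 𝒫 (suc (364 * suc k))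
colourable G k zero    𝒫 _ _ = (λ ()) , λ ()
colourable G k (suc p) 𝒫 uncrossed load≤ with v , few ← Density.low-degree G 𝒫 uncrossed k load≤ zero
  with old , old-proper ← colourable G k p (𝒫 ∘ punchIn v) (λ i j i≢j → uncrossed _ _ (i≢j ∘ Finₚ.punchIn-injective v i j)) (λ e → ℕₚ.≤-trans (load-punchIn G 𝒫 v e) (load≤ e)) =
  Greedy.extended {R = Share G 𝒫} (λ {i} {j} → shares-sym {i} {j}) v (neighbours? v) few old old-proper
  where
  open Density G 𝒫 uncrossed k load≤ using (shares-sym; neighbours?)

-- From the bound linear in the load to the stated one.

filter-witness : ∀ {A : Set} {P : A → Set} (P? : ∀ x → Dec (P x)) xs → 0 < length (filter P? xs) → ∃ P
filter-witness P? (x ∷ xs) 0< with P? x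
... | yes px = x , px
... | no _   = filter-witness P? xs 0<

edge⇒load : (G : PlaneGraph) {p : ℕ} (𝒫 : Fin p → Path G) → 0 < edgeCountU G 𝒫 → ∃ λ e → 0 < load G 𝒫 e
edge⇒load G {p} 𝒫 0<E = user (filter-witness adjacent? (cartesianProduct (allFin p) (allFin p)) 0<E)
  where
  open import Data.List.Membership.DecPropositional (Finₚ._≟_ {PlaneGraph.m G}) using (_∈?_)
  Adjacent : Fin p × Fin p → Set
  Adjacent (i , j) = toℕ i < toℕ j × Share G 𝒫 i j
  adjacent? : ∀ ij → Dec (Adjacent ij)
  adjacent? (i , j) = (toℕ i <? toℕ j) ×-dec Any.any? (_∈? edges G (𝒫 j)) (edges G (𝒫 i))
  user : ∃ Adjacent → ∃ λ e → 0 < load G 𝒫 e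
  user ((i , j) , _ , sh) with e , e∈i , _ ← find sh = e ,
    ℕₚ.≤-trans (unique-length≤count (λ i → e ∈? edges G (𝒫 i)) {i ∷ []} ([] ∷ []) (λ { (here refl) → e∈i }))
      (ℕₚ.≤-reflexive (sym (count-filter (λ i → e ∈? edges G (𝒫 i)))))

theorem15 : ∃ λ (C : ℕ) →
    (G : PlaneGraph) (p : ℕ) (𝒫 : Fin p → Path G) (k : ℕ) →
    (∀ i j → i ≢ j → ¬ Cross G (𝒫 i) (𝒫 j)) →
    (∀ x → load G 𝒫 x ≤ k) →
    2 ≤ edgeCountU G 𝒫 →
    ColourableU G 𝒫 (C * (k * k) * ⌊log₂ edgeCountU G 𝒫 ⌋)
theorem15 = 365 , bound
  where
  bound : (G : PlaneGraph) (p : ℕ) (𝒫 : Fin p → Path G) (k : ℕ) → (∀ i j → i ≢ j → ¬ Cross G (𝒫 i) (𝒫 j)) →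
          (∀ x → load G 𝒫 x ≤ k) → 2 ≤ edgeCountU G 𝒫 → ColourableU G 𝒫 (365 * (k * k) * ⌊log₂ edgeCountU G 𝒫 ⌋)
  -- At load 0 no edge lies on a path, so `U` could not have an edge.
  bound G p 𝒫 zero uncrossed load≤ 2≤E with e , 0<load ← edge⇒load G 𝒫 (ℕₚ.<⇒≤ 2≤E) = contradiction (ℕₚ.≤-trans 0<load (load≤ e)) λ ()
  bound G p 𝒫 (suc k) uncrossed load≤ 2≤E with col , proper ← colourable G k p 𝒫 uncrossed load≤ =
    (λ i → inject≤ (col i) enough) , λ i j i≢j sh eq → proper i j i≢j sh (Finₚ.inject≤-injective enough enough _ _ eq)
    where
    open ℕₚ.≤-Reasoning
    log≥1 : 1 ≤ ⌊log₂ edgeCountU G 𝒫 ⌋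
    log≥1 = ⌊log₂⌋-mono-≤ 2≤E
    shuffle : ∀ k → 365 * (suc k * suc k) ≡ suc (364 * suc k) + (k + 365 * (suc k * k))
    shuffle = solve-∀
    -- For a positive load the linear bound is below 365 times its square, and the logarithm
    -- contributes a factor of at least 1 because `U` has two edges.
    enough : suc (364 * suc k) ≤ 365 * (suc k * suc k) * ⌊log₂ edgeCountU G 𝒫 ⌋
    enough = begin
      suc (364 * suc k)                                   ≤⟨ ℕₚ.m≤m+n _ _ ⟩
      suc (364 * suc k) + (k + 365 * (suc k * k))         ≡⟨ sym (shuffle k) ⟩
      365 * (suc k * suc k)                               ≡⟨ sym (ℕₚ.*-identityʳ _) ⟩
      365 * (suc k * suc k) * 1                           ≤⟨ ℕₚ.*-monoʳ-≤ (365 * (suc k * suc k)) log≥1 ⟩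
      365 * (suc k * suc k) * ⌊log₂ edgeCountU G 𝒫 ⌋      ∎
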